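{- Let $n$ and $k$ be integers with $2\le k\le n-1$ such that $\mathscr{G}_n^k\setminus\{K_n^k\}$ is nonempty. Then the second last graph in the $S$-order among $\mathscr{G}_n^k$ is uniquely $H$, where $H=G_3$ if $k\in\{2,3,\dots,n-2\}$ and $H=K_{1,n-1}^*$ if $k=n-1$. That is, $H\in\mathscr{G}_n^k$, $H\prec_s K_n^k$, and $G\prec_s H$ for every $G\in\mathscr{G}_n^k$ isomorphic to neither $K_n^k$ nor $H$.
   Context: All graphs are finite, simple, undirected and connected. A cut edge of a connected graph is an edge whose deletion breaks the graph into two components. $\mathscr{G}_n^k$ is the set of all connected $n$-vertex graphs with exactly $k$ cut edges (graphs are considered up to isomorphism). For an $n$-vertex graph $G$ with adjacency eigenvalues $\lambda_1(G)\ge\dots\ge\lambda_n(G)$, the $i$th spectral moment is $S_i(G)=\sum_{j=1}^n\lambda_j(G)^i$ for $i=0,1,\dots,n-1$. For two $n$-vertex graphs $G_1,G_2$, write $G_1\prec_s G_2$ ($G_1$ comes before $G_2$ in the $S$-order) if for some $j\in\{1,\dots,n-1\}$ we have $S_i(G_1)=S_i(G_2)$ for $i=0,1,\dots,j-1$ and $S_j(G_1)<S_j(G_2)$. $K_m$ is the complete graph on $m$ vertices. $K_n^k$ is the $n$-vertex graph obtained by attaching $k$ pendant vertices to one vertex of $K_{n-k}$ (so $K_n^{n-1}$ is the star $K_{1,n-1}$); it is the last graph in the $S$-order among $\mathscr{G}_n^k$. $G_3$ is the $n$-vertex graph obtained from $K_n^k$ as follows: let $u$ be the vertex of the clique $K_{n-k}$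 to which the $k$ pendant vertices are attached, let $uw$ be one of the $k$ pendant edges, and let $v\ne u$ be another vertex of $K_{n-k}$; then $G_3=K_n^k-uw+vw$. $K_{1,n-1}^*$ is the $n$-vertex tree obtained from the star $K_{1,n-2}$ by attaching a leaf to one leaf of $K_{1,n-2}$.
   Formalization: The formal theorem excludes the single pair n = 4, k = 3, where the claim is false: the class is {K_{1,3}, P_4}, both graphs have S_0,…,S_3 = 4, 0, 6, 0, so H = P_4 does not come before K_{1,3} in the S-order. -}

module Defs where

open import Level using (_⊔_) renaming (suc to lsuc)
open import Algebra.Apartness.Bundles using (HeytingField; HeytingCommutativeRing)
open import Algebra.Bundles using (CommutativeRing; Semiring)
import Algebra.Definitions.RawSemiring as RawSemiringDefs
open import Data.Bool.Base using (Bool; true; false; if_then_else_; not; _∧_; _∨_; T)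
open import Data.Bool.Properties using (∨-comm)
open import Data.Fin.Base as Fin using (Fin; zero; suc; toℕ; fromℕ)
open import Data.Fin.Permutation using (Permutation′; _⟨$⟩ʳ_)
open import Data.Fin.Properties using (_≟_)
open import Data.List.Base using (List; length)
open import Data.List.Membership.Propositional using (_∈_)
open import Data.List.Relation.Unary.Unique.Propositional using (Unique)
open import Data.Nat.Base as ℕ using (ℕ; zero; suc; _∸_; _<ᵇ_; _≡ᵇ_)
open import Data.Product.Base using (_×_; _,_; ∃-syntax; Σ-syntax)
open import Data.Sum.Base using (_⊎_)
open import Function.Bundles using (_⇔_)
open import Relation.Binary.Core using (Rel)
open import Relation.Binary.Construct.Closure.ReflexiveTransitive using (Star)
open import Relation.Binary.PropositionalEquality using (_≡_; refl; sym; cong; cong₂)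
open import Relation.Binary.Structures using (IsStrictPartialOrder)
open import Relation.Nullary using (¬_; does; yes; no; contradiction)

record Graph (n : ℕ) : Set where
  field
    adj        : Fin n → Fin n → Bool
    adj-sym    : ∀ i j → adj i j ≡ adj j i
    adj-irrefl : ∀ i → adj i i ≡ false

open Graph public

Adj : ∀ {n} → Graph n → Rel (Fin n) _
Adj G i j = T (adj G i j)

Connected : ∀ {n} → Graph n → Set
Connected {n} G = ∀ (i j : Fin n) → Star (Adj G) i j

infix 4 _≅_
_≅_ : ∀ {n} → Graph n → Graph n → Set
_≅_ {n} G H = Σ[ π ∈ Permutation′ n ] (∀ i j → adj G i j ≡ adj H (π ⟨$⟩ʳ i) (π ⟨$⟩ʳ j))

_==_ : ∀ {n} → Fin n → Fin n → Bool
i == j = does (i ≟ j)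

private
  ==-sym : ∀ {n} (i j : Fin n) → (i == j) ≡ (j == i)
  ==-sym i j with i ≟ j | j ≟ i
  ... | yes _ | yes _ = refl
  ... | no _  | no _  = refl
  ... | yes p | no q  = contradiction (sym p) q
  ... | no p  | yes q = contradiction (sym q) p

  ==-refl : ∀ {n} (i : Fin n) → (i == i) ≡ true
  ==-refl i with i ≟ i
  ... | yes _ = refl
  ... | no p  = contradiction refl p

-- The symmetric, loop-free closure of a Boolean relation.
fromRel : ∀ {n} → (Fin n → Fin n → Bool) → Graph n
fromRel r = record
  { adj        = λ i j → not (i == j) ∧ (r i j ∨ r j i)
  ; adj-sym    = λ i j → cong₂ (λ x y → not x ∧ y) (==-sym i j) (∨-comm (r i j) (r j i))
  ; adj-irrefl = λ i → cong (λ x → not x ∧ (r i i ∨ r i i)) (==-refl i)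
  }

deleteEdge : ∀ {n} → Graph n → Fin n → Fin n → Graph n
deleteEdge G u w = fromRel λ i j →
  adj G i j ∧ not (((i == u) ∧ (j == w)) ∨ ((i == w) ∧ (j == u)))

addEdge : ∀ {n} → Graph n → Fin n → Fin n → Graph n
addEdge G v w = fromRel λ i j → adj G i j ∨ ((i == v) ∧ (j == w))

-- The new vertex is `zero`; the vertices of G are shifted by `suc`.
attachPendant : ∀ {n} → Graph n → Fin n → Graph (suc n)
attachPendant {n} G v = fromRel r
  where
  r : Fin (suc n) → Fin (suc n) → Bool
  r zero    zero    = false
  r zero    (suc j) = j == v
  r (suc i) zero    = false
  r (suc i) (suc j) = adj G i j

IsCutEdge : ∀ {n} → Graph n → Fin n → Fin n → Set
IsCutEdge G i j = Adj G i j × ¬ Connected (deleteEdge G i j)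

-- Each undirected edge is listed once, as the pair with i < j.
CutEdgeCount : ∀ {n} → Graph n → ℕ → Set
CutEdgeCount {n} G k = ∃[ es ]
  Unique es × length es ≡ k ×
  (∀ (i j : Fin n) → ((i , j) ∈ es) ⇔ (i Fin.< j × IsCutEdge G i j))

𝒢 : ∀ n → ℕ → Graph n → Set
𝒢 n k G = Connected G × CutEdgeCount G k

-- For k < n: the vertices below n ∸ k form the clique, u = 0, and the
-- vertices n ∸ k, …, n ∸ 1 are pendant at u.
K : ∀ n → ℕ → Graph n
K n k = fromRel λ i j →
  ((toℕ i <ᵇ (n ∸ k)) ∧ (toℕ j <ᵇ (n ∸ k))) ∨ (toℕ i ≡ᵇ 0)

-- K_n^k − uw + vw for n = 2 + p, with u = 0, v = 1, w = n ∸ 1.  When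
-- 1 ≤ k ≤ n ∸ 2, v is a second clique vertex and w is pendant at u.
G₃ : ∀ p → ℕ → Graph (2 ℕ.+ p)
G₃ p k = addEdge (deleteEdge (K (2 ℕ.+ p) k) zero w) (suc zero) w
  where
  w : Fin (2 ℕ.+ p)
  w = fromℕ (suc p)

-- K*_{1,n-1} for n = 3 + p.  The star K_{1,n-2} is K_{n-1}^{n-2}, with
-- centre 0, and the new vertex is attached to its leaf 1.
K⁎ : ∀ p → Graph (3 ℕ.+ p)
K⁎ p = attachPendant (K (2 ℕ.+ p) (1 ℕ.+ p)) (suc zero)

-- The value for n < 3 is immaterial: 2 ≤ k ≤ n ∸ 1 forces n ≥ 3.
H : ∀ n → ℕ → Graph n
H (suc (suc (suc p))) k = if k ≡ᵇ 2 ℕ.+ p then K⁎ p else G₃ (suc p) k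
H n                   k = K n k

-- The real numbers, characterised as a Cauchy-complete Archimedean
-- ordered field.  Classically the only model is ℝ; the axioms are phrased
-- so that the constructive (Cauchy) reals are a model too, hence
-- apartness in place of ¬ (x ≈ y) and no trichotomy.
record RealNumbers c ℓ₁ ℓ₂ : Set (lsuc (c ⊔ ℓ₁ ⊔ ℓ₂)) where
  infix 4 _<_ _≤_
  field
    heytingField : HeytingField c ℓ₁ ℓ₂

  open HeytingField heytingField public
    using (Carrier; _≈_; _#_; _+_; _*_; -_; 0#; 1#; heytingCommutativeRing)

  open HeytingCommutativeRing heytingCommutativeRing public using (commutativeRing)

  open CommutativeRing commutativeRing public using (_-_)

  open RawSemiringDefs (Semiring.rawSemiring (CommutativeRing.semiring commutativeRing)) public
    using (sum; _^_) renaming (_×_ to _·_)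

  field
    _<_                  : Rel Carrier ℓ₂
    isStrictPartialOrder : IsStrictPartialOrder _≈_ _<_
    #⇔<⊎>                : ∀ x y → (x # y) ⇔ (x < y ⊎ y < x)
    +-monoˡ-<            : ∀ z {x y} → x < y → (x + z) < (y + z)
    *-pos                : ∀ {x y} → 0# < x → 0# < y → 0# < (x * y)
    archimedean          : ∀ x → ∃[ m ] (x < (m · 1#))

  _≤_ : Rel Carrier ℓ₂
  x ≤ y = ¬ (y < x)

  -- ∣ x - y ∣ < ε
  Within : Carrier → Carrier → Carrier → Set ℓ₂
  Within ε x y = (x - y) < ε × (y - x) < ε

  IsCauchy : (ℕ → Carrier) → Set (c ⊔ ℓ₂)
  IsCauchy s = ∀ ε → 0# < ε →
    ∃[ N ] ∀ p q → N ℕ.≤ p → N ℕ.≤ q → Within ε (s p) (s q)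

  _ConvergesTo_ : (ℕ → Carrier) → Carrier → Set (c ⊔ ℓ₂)
  s ConvergesTo x = ∀ ε → 0# < ε → ∃[ N ] ∀ p → N ℕ.≤ p → Within ε (s p) x

  field
    complete : ∀ s → IsCauchy s → ∃[ x ] (s ConvergesTo x)

module Spectral {c ℓ₁ ℓ₂} (ℝ : RealNumbers c ℓ₁ ℓ₂) where
  open RealNumbers ℝ

  adjMatrix : ∀ {n} → Graph n → Fin n → Fin n → Carrier
  adjMatrix G i j = if adj G i j then 1# else 0#

  record IsBasis {n} (v : Fin n → Fin n → Carrier) : Set (c ⊔ ℓ₁) where
    field
      independent : ∀ (a : Fin n → Carrier) →
        (∀ i → sum (λ j → a j * v j i) ≈ 0#) → ∀ j → a j ≈ 0#
      spanning    : ∀ (x : Fin n → Carrier) →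
        Σ[ a ∈ (Fin n → Carrier) ] (∀ i → sum (λ j → a j * v j i) ≈ x i)

  -- μ lists the adjacency eigenvalues λ₁ ≥ … ≥ λₙ of G with multiplicity:
  -- ℝⁿ has a basis whose j-th member is an eigenvector for μ j.
  record IsSpectrum {n} (G : Graph n) (μ : Fin n → Carrier) : Set (c ⊔ ℓ₁ ⊔ ℓ₂) where
    field
      antitone    : ∀ {i j} → i Fin.≤ j → μ j ≤ μ i
      eigenvector : Fin n → Fin n → Carrier
      isBasis     : IsBasis eigenvector
      isEigen     : ∀ j i →
        sum (λ l → adjMatrix G i l * eigenvector j l) ≈ μ j * eigenvector j i

  module SOrder {n} (eig : Graph n → Fin n → Carrier) where

    S : ℕ → Graph n → Carrier
    S i G = sum (λ j → eig G j ^ i)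

    infix 4 _≺_
    _≺_ : Rel (Graph n) (ℓ₁ ⊔ ℓ₂)
    G₁ ≺ G₂ = ∃[ j ] 1 ℕ.≤ j × j ℕ.≤ n ∸ 1 ×
      (∀ i → i ℕ.< j → S i G₁ ≈ S i G₂) × S j G₁ < S j G₂

{-# OPTIONS --safe #-}
-- The m-th spectral moment is the number of closed m-walks: a basis of
-- eigenvectors turns the sum of the λ_j^m into the trace of the m-th power of
-- the adjacency matrix.  Only m ≤ 4 is needed.
--
-- Fix a spanning tree.  Every cut edge is a tree edge, and no other edge
-- crosses the cut it defines, so deleting the k cut edges leaves k + 1 parts
-- whose n ∸ k ∸ 1 vertices besides the part roots bound the number of the
-- remaining edges by (n ∸ k)(n ∸ k ∸ 1)/2.  Equality forces a clique with
-- forests hanging from it; otherwise S₂ already decides.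
--
-- For a clique on 2 + b vertices with forests (a tree is the case b = 0, with
-- any of its edges as the clique) S₂ and S₃ depend only on n and b, and S₄ is
-- an increasing function of the sum of c² + 2b[clique]c over the vertices,
-- where c is the number of children.  The children numbers add up to n ∸ 2 ∸ b,
-- so the largest value belongs to a single parent in the clique (K_n^k) and
-- the second largest to two parents in the clique, one of them with one child.
module Submission where

open import Defs

import Algebra.Properties.CommutativeSemigroup
import Algebra.Properties.Group
import Algebra.Properties.Ring
import Algebra.Properties.Semiring.Mult
import Algebra.Properties.Semiring.Sum
open import Algebra.Apartness.Properties.HeytingCommutativeRing using (1#0)
open import Algebra.Bundles using (CommutativeRing)
open import Data.Bool.Base using (Bool; true; false; if_then_else_; T; _∧_; _∨_; not)
open import Data.Bool.Properties using (T-∧; T-∨)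
open import Data.Empty using (⊥; ⊥-elim)
open import Data.Fin.Base as Fin using (Fin; zero; suc; toℕ; fromℕ)
open import Data.Fin.Patterns using (0F; 1F; 2F; 3F; 4F)
open import Data.Fin.Permutation as Perm
  using (Permutation′; _⟨$⟩ʳ_; _⟨$⟩ˡ_; inverseˡ; inverseʳ; insert; insert-punchIn)
open import Data.Fin.Properties as Fin using (_≟_; suc-injective; any?; toℕ-injective; toℕ-fromℕ)
open import Data.List.Base using (List; _++_; map; length; filter; tabulate; allFin; cartesianProduct)
import Data.List.Membership.DecPropositional
open import Data.List.Membership.Propositional using (_∈_)
open import Data.List.Membership.Propositional.Properties
  using (∈-filter⁺; ∈-filter⁻; ∈-cartesianProduct⁺; ∈-allFin)
open import Data.List.Membership.Propositional.Properties.WithK using (unique∧set⇒bag)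
open import Data.List.Properties using (filter-++; length-++; map-tabulate)
open import Data.List.Relation.Binary.BagAndSetEquality using (∼bag⇒↭)
open import Data.List.Relation.Binary.Permutation.Propositional.Properties using (↭-length)
open import Data.List.Relation.Unary.Unique.Propositional using (Unique)
import Data.List.Relation.Unary.Unique.Propositional.Properties as Unique
open import Data.Nat.Base
  using (ℕ; zero; suc; _<ᵇ_; _≡ᵇ_; _+_; _*_; _∸_; _≤_; _<_; z≤n; s≤s; _≤′_; ≤′-refl; ≤′-step)
open import Data.Nat.Properties as ℕ hiding (_≟_; suc-injective)
open import Data.Nat.Solver using (module +-*-Solver)
open import Data.Product.Base using (_×_; _,_; ∃-syntax; Σ-syntax; proj₁; proj₂)
open import Data.Product.Properties using (≡-dec)
open import Data.Sum.Base as Sum using (_⊎_; inj₁; inj₂; [_,_]′)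
open import Function.Base using (_∘_; id; case_of_)
open import Function.Bundles using (mk⇔; Equivalence)
open import Relation.Binary.Construct.Closure.ReflexiveTransitive using (Star; ε; _◅_; _◅◅_; reverse; gmap)
open import Relation.Binary.Definitions using (tri<; tri≈; tri>)
open import Relation.Binary.PropositionalEquality
import Relation.Binary.Reasoning.Setoid
open import Relation.Binary.Structures using (module IsStrictPartialOrder)
open import Relation.Nullary using (¬_; Dec; yes; no; does; contradiction)
open import Relation.Nullary.Decidable
  using (_×-dec_; _⊎-dec_; ¬?; T?; dec-true; dec-false; map′; decidable-stable)

open import Algebra.Properties.Semiring.Sum +-*-semiring
  using (sum; sum-cong-≗; sum-remove; ∑-distrib-+; ∑-comm; *-distribˡ-sum; *-distribʳ-sum; sum-replicate-zero)
open +-*-Solver using (solve; con; _:+_; _:*_; _:=_)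

-- Sums of natural numbers

-- `S₄` is the sum of the squared codegrees, and a clique with hanging forests has rigid codegrees:
-- the degree on the diagonal, `b` for two clique vertices, and at most 1 elsewhere, because no
-- triangle or 4-cycle leaves the clique. Off the exceptional pairs a codegree therefore equals its
-- square, and the sum of all codegrees is the sum of the squared degrees. So the children numbers
-- enter `S₄` through the squared degrees alone. The S-order stops at `S_{n-1}`, so this comparison
-- needs n ≥ 5. With a clique of at least three vertices, k ≥ 2 forces that. Among trees, n = 3
-- leaves only the star, and n = 4 is a genuine exception: the star and the path on four vertices
-- share `S₀`, ..., `S₃`. For b > 0 a parent outside the clique costs weight. For b = 0 the weight
-- does not see where the parents lie, so a tree has to be rooted anew at its two branching vertices
-- before it can be recognised.

𝟙 : Bool → ℕ
𝟙 b = if b then 1 else 0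

⟦_⟧ : ∀ {p} {P : Set p} → Dec P → ℕ
⟦ d ⟧ = 𝟙 (does d)

⟦⟧-yes : ∀ {p} {P : Set p} (d : Dec P) → P → ⟦ d ⟧ ≡ 1
⟦⟧-yes d p = cong 𝟙 (dec-true d p)

⟦⟧-no : ∀ {p} {P : Set p} (d : Dec P) → ¬ P → ⟦ d ⟧ ≡ 0
⟦⟧-no d ¬p = cong 𝟙 (dec-false d ¬p)

⟦⟧-≤ : ∀ {p q} {P : Set p} {Q : Set q} (d : Dec P) (e : Dec Q) → (P → Q) → ⟦ d ⟧ ≤ ⟦ e ⟧
⟦⟧-≤ (no _)  e f = z≤n
⟦⟧-≤ (yes p) e f = ≤-reflexive (sym (⟦⟧-yes e (f p)))

⟦⟧-cong : ∀ {p q} {P : Set p} {Q : Set q} (d : Dec P) (e : Dec Q) → (P → Q) → (Q → P) → ⟦ d ⟧ ≡ ⟦ e ⟧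
⟦⟧-cong d e f g = ≤-antisym (⟦⟧-≤ d e f) (⟦⟧-≤ e d g)

⟦⟧-⊎ : ∀ {p q r} {P : Set p} {Q : Set q} {R : Set r} (d : Dec P) (e : Dec Q) (f : Dec R) →
       (P → Q ⊎ R) → (Q → P) → (R → P) → (Q → ¬ R) → ⟦ d ⟧ ≡ ⟦ e ⟧ + ⟦ f ⟧
⟦⟧-⊎ d (yes q) f _ q→p _ q→¬r = trans (⟦⟧-yes d (q→p q)) (cong suc (sym (⟦⟧-no f (q→¬r q))))
⟦⟧-⊎ d (no ¬q) f p→ _ r→p _ =
  ⟦⟧-cong d f (λ p → [ (λ q → contradiction q ¬q) , id ]′ (p→ p)) r→p

sum-≤ : ∀ {n} {f g : Fin n → ℕ} → (∀ i → f i ≤ g i) → sum f ≤ sum g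
sum-≤ {zero}  f≤g = z≤n
sum-≤ {suc n} f≤g = +-mono-≤ (f≤g zero) (sum-≤ (f≤g ∘ suc))

sum-< : ∀ {n} {f g : Fin n → ℕ} → (∀ i → f i ≤ g i) → ∀ i → f i < g i → sum f < sum g
sum-< f≤g zero    f<g = +-mono-<-≤ f<g (sum-≤ (f≤g ∘ suc))
sum-< f≤g (suc i) f<g = +-mono-≤-< (f≤g zero) (sum-< (f≤g ∘ suc) i f<g)

term≤sum : ∀ {n} (f : Fin n → ℕ) i → f i ≤ sum f
term≤sum f zero    = m≤m+n _ _
term≤sum f (suc i) = ≤-trans (term≤sum (f ∘ suc) i) (m≤n+m _ _)

two-terms≤sum : ∀ {n} (f : Fin n → ℕ) {i j} → i ≢ j → f i + f j ≤ sum f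
two-terms≤sum f {zero}  {zero}  i≢j = contradiction refl i≢j
two-terms≤sum f {zero}  {suc j} i≢j = +-monoʳ-≤ _ (term≤sum (f ∘ suc) j)
two-terms≤sum f {suc i} {zero}  i≢j =
  ≤-trans (≤-reflexive (+-comm (f (suc i)) _)) (+-monoʳ-≤ _ (term≤sum (f ∘ suc) i))
two-terms≤sum f {suc i} {suc j} i≢j =
  ≤-trans (two-terms≤sum (f ∘ suc) (i≢j ∘ cong suc)) (m≤n+m _ _)

sum-zero : ∀ {n} {f : Fin n → ℕ} → (∀ i → f i ≡ 0) → sum f ≡ 0
sum-zero {n} f≡0 = trans (sum-cong-≗ f≡0) (sum-replicate-zero n)

sum-δ : ∀ {n} i (f : Fin n → ℕ) → sum (λ j → ⟦ i ≟ j ⟧ * f j) ≡ f i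
sum-δ zero    f = trans (cong₂ _+_ (*-identityˡ (f zero)) (sum-zero {f = λ j → ⟦ zero ≟ suc j ⟧ * f (suc j)} (λ _ → refl))) (+-identityʳ _)
sum-δ (suc i) f = sum-δ i (f ∘ suc)

sum-point : ∀ {n} (i : Fin n) → sum (λ j → ⟦ i ≟ j ⟧) ≡ 1
sum-point {n} i = trans (sum-cong-≗ {n} λ j → sym (*-identityʳ _)) (sum-δ i (λ _ → 1))

sum-const : ∀ n {c} → sum {n} (λ _ → c) ≡ n * c
sum-const zero    = refl
sum-const (suc n) = cong (_ +_) (sum-const n)

sum≤1 : ∀ {n} (f : Fin n → ℕ) → (∀ i → f i ≤ 1) → (∀ i j → 0 < f i → 0 < f j → i ≡ j) → sum f ≤ 1
sum≤1 {zero}  f f≤1 uniq = z≤n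
sum≤1 {suc n} f f≤1 uniq with f zero in eq
... | zero  = sum≤1 (f ∘ suc) (f≤1 ∘ suc) λ i j p q → suc-injective (uniq _ _ p q)
... | suc m = ≤-trans (≤-reflexive (trans (cong₂ _+_ (sym eq) (sum-zero rest)) (+-identityʳ _))) (f≤1 zero)
  where
  rest : ∀ i → f (suc i) ≡ 0
  rest i = n≤0⇒n≡0 (≮⇒≥ λ p → case (uniq zero (suc i) (subst (0 <_) (sym eq) (s≤s z≤n)) p))
    where
    case : zero ≢ suc i
    case ()

sum≡0⇒ : ∀ {n} (f : Fin n → ℕ) → sum f ≡ 0 → ∀ i → f i ≡ 0
sum≡0⇒ f eq i = n≤0⇒n≡0 (≤-trans (term≤sum f i) (≤-reflexive eq))

sum≡1⇒ : ∀ {n} (f : Fin n → ℕ) → sum f ≡ 1 → ∃[ i ] f i ≡ 1 × (∀ j → j ≢ i → f j ≡ 0)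
sum≡1⇒ {suc n} f eq with f zero in eq₀
... | zero  = let i , fi , rest = sum≡1⇒ (f ∘ suc) eq in
  suc i , fi , λ { zero _ → eq₀ ; (suc j) j≢i → rest j (j≢i ∘ cong suc) }
... | suc zero = zero , eq₀ , λ { zero z → contradiction refl z
                                ; (suc j) _ → sum≡0⇒ (f ∘ suc) (cong (_∸ 1) eq) j }

sum>0⇒ : ∀ {n} (f : Fin n → ℕ) → 0 < sum f → ∃[ i ] 0 < f i
sum>0⇒ {suc n} f pos with f zero in eq
... | zero  = let i , p = sum>0⇒ (f ∘ suc) pos in suc i , p
... | suc _ = zero , subst (0 <_) (sym eq) (s≤s z≤n)

∑∑ : ∀ {n} → (Fin n → Fin n → ℕ) → ℕ
∑∑ M = sum λ i → sum (M i)

∑∑-cong : ∀ {n} {M N : Fin n → Fin n → ℕ} → (∀ i j → M i j ≡ N i j) → ∑∑ M ≡ ∑∑ N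
∑∑-cong {n} eq = sum-cong-≗ {n} λ i → sum-cong-≗ {n} (eq i)

∑∑-+ : ∀ {n} (M N : Fin n → Fin n → ℕ) → ∑∑ (λ i j → M i j + N i j) ≡ ∑∑ M + ∑∑ N
∑∑-+ {n} M N = trans (sum-cong-≗ {n} λ i → ∑-distrib-+ (M i) (N i)) (∑-distrib-+ (sum ∘ M) (sum ∘ N))

∑∑-transpose : ∀ {n} (M : Fin n → Fin n → ℕ) → ∑∑ (λ i j → M j i) ≡ ∑∑ M
∑∑-transpose M = ∑-comm (λ i j → M j i)

∑∑-≤ : ∀ {n} {M N : Fin n → Fin n → ℕ} → (∀ i j → M i j ≤ N i j) → ∑∑ M ≤ ∑∑ N
∑∑-≤ le = sum-≤ λ i → sum-≤ (le i)

∑∑-< : ∀ {n} {M N : Fin n → Fin n → ℕ} → (∀ i j → M i j ≤ N i j) → ∀ i j → M i j < N i j → ∑∑ M < ∑∑ N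
∑∑-< le i j lt = sum-< (λ i → sum-≤ (le i)) i (sum-< (le i) j lt)

-- Spectral moments and closed walks

edge : ∀ {n} → Graph n → Fin n → Fin n → ℕ
edge G i j = 𝟙 (adj G i j)

walks : ∀ {n} → Graph n → ℕ → Fin n → Fin n → ℕ
walks G zero    i j = ⟦ i ≟ j ⟧
walks G (suc m) i j = sum λ l → edge G i l * walks G m l j

closedWalks : ∀ {n} → Graph n → ℕ → ℕ
closedWalks G m = sum λ i → walks G m i i

module _ {c ℓ₁ ℓ₂} (ℝ : RealNumbers c ℓ₁ ℓ₂) where
  private
    module ℝ = RealNumbers ℝ
    module R = CommutativeRing ℝ.commutativeRing
    module ∑ = Algebra.Properties.Semiring.Sum R.semiring
    module Mult = Algebra.Properties.Semiring.Mult R.semiring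
    module Ring = Algebra.Properties.Ring R.ring
    module Group = Algebra.Properties.Group R.+-group
  open RealNumbers ℝ using (Carrier; _≈_; 0#; 1#; _^_; _·_)
    renaming (_<_ to _<ᴿ_; _+_ to _⊕_; _*_ to _⊛_; -_ to ⊖_; sum to ∑)
  open Spectral ℝ
  open Relation.Binary.Reasoning.Setoid R.setoid

  ι : ℕ → Carrier
  ι m = m · 1#

  ι-sum : ∀ {n} (f : Fin n → ℕ) → ι (sum f) ≈ ∑ (ι ∘ f)
  ι-sum {zero}  f = R.refl
  ι-sum {suc n} f = R.trans (Mult.×-homo-+ 1# (f zero) _) (R.+-congˡ (ι-sum (f ∘ suc)))

  ι-adj : ∀ {n} (G : Graph n) i j → ι (edge G i j) ≈ adjMatrix G i j
  ι-adj G i j with adj G i j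
  ... | true  = R.+-identityʳ 1#
  ... | false = R.refl

  ∑-zero : ∀ {n} {f : Fin n → Carrier} → (∀ i → f i ≈ 0#) → ∑ f ≈ 0#
  ∑-zero {n} f≈0 = R.trans (∑.sum-cong-≋ f≈0) (∑.sum-replicate-zero n)

  ∑-δ : ∀ {n} i (f : Fin n → Carrier) → ∑ (λ j → ι ⟦ i ≟ j ⟧ ⊛ f j) ≈ f i
  ∑-δ zero f = R.trans
    (R.+-cong (R.trans (R.*-congʳ (R.+-identityʳ 1#)) (R.*-identityˡ _))
      (∑-zero λ j → R.zeroˡ (f (suc j))))
    (R.+-identityʳ _)
  ∑-δ (suc i) f = R.trans (R.+-congʳ (R.zeroˡ _)) (R.trans (R.+-identityˡ _) (∑-δ i (f ∘ suc)))

  ∑-assoc : ∀ {m n} (x : Fin m → Carrier) (M : Fin m → Fin n → Carrier) (y : Fin n → Carrier) →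
            ∑ (λ j → ∑ (λ i → x i ⊛ M i j) ⊛ y j) ≈ ∑ (λ i → x i ⊛ ∑ (λ j → M i j ⊛ y j))
  ∑-assoc {m} {n} x M y = begin
    ∑ (λ j → ∑ (λ i → x i ⊛ M i j) ⊛ y j)    ≈⟨ ∑.sum-cong-≋ (λ j → ∑.*-distribʳ-sum {m} (y j) _) ⟩
    ∑ (λ j → ∑ (λ i → (x i ⊛ M i j) ⊛ y j))  ≈⟨ ∑.∑-comm (λ j i → (x i ⊛ M i j) ⊛ y j) ⟩
    ∑ (λ i → ∑ (λ j → (x i ⊛ M i j) ⊛ y j))  ≈⟨ ∑.sum-cong-≋ (λ i → ∑.sum-cong-≋ λ j → R.*-assoc (x i) (M i j) (y j)) ⟩
    ∑ (λ i → ∑ (λ j → x i ⊛ (M i j ⊛ y j)))  ≈⟨ ∑.sum-cong-≋ (λ i → ∑.*-distribˡ-sum {n} (x i) _) ⟨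
    ∑ (λ i → x i ⊛ ∑ (λ j → M i j ⊛ y j))    ∎

  walks-eigen : ∀ {n} (G : Graph n) {μ} {v : Fin n → Carrier} →
    (∀ i → ∑ (λ l → adjMatrix G i l ⊛ v l) ≈ μ ⊛ v i) →
    ∀ m i → ∑ (λ l → ι (walks G m i l) ⊛ v l) ≈ (μ ^ m) ⊛ v i
  walks-eigen G {v = v} Av≈μv zero i = R.trans (∑-δ i v) (R.sym (R.*-identityˡ (v i)))
  walks-eigen {n} G {μ} {v} Av≈μv (suc m) i = begin
    ∑ (λ l → ι (walks G (suc m) i l) ⊛ v l)
      ≈⟨ ∑.sum-cong-≋ {n} (λ l → R.*-congʳ (R.trans (ι-sum {n} _) (∑.sum-cong-≋ {n} λ y →
           R.trans (Mult.×1-homo-* (edge G i y) _) (R.*-congʳ (ι-adj G i y))))) ⟩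
    ∑ (λ l → ∑ (λ y → adjMatrix G i y ⊛ ι (walks G m y l)) ⊛ v l)
      ≈⟨ ∑-assoc {n} {n} (adjMatrix G i) (λ y l → ι (walks G m y l)) v ⟩
    ∑ (λ y → adjMatrix G i y ⊛ ∑ (λ l → ι (walks G m y l) ⊛ v l))
      ≈⟨ ∑.sum-cong-≋ {n} (λ y → R.*-congˡ (walks-eigen G Av≈μv m y)) ⟩
    ∑ (λ y → adjMatrix G i y ⊛ ((μ ^ m) ⊛ v y))
      ≈⟨ ∑.sum-cong-≋ {n} (λ y → x∙yz≈y∙xz (adjMatrix G i y) (μ ^ m) (v y)) ⟩
    ∑ (λ y → (μ ^ m) ⊛ (adjMatrix G i y ⊛ v y))
      ≈⟨ ∑.*-distribˡ-sum {n} (μ ^ m) _ ⟨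
    (μ ^ m) ⊛ ∑ (λ y → adjMatrix G i y ⊛ v y)
      ≈⟨ R.*-congˡ (Av≈μv i) ⟩
    (μ ^ m) ⊛ (μ ⊛ v i)
      ≈⟨ x∙yz≈yx∙z (μ ^ m) μ (v i) ⟩
    (μ ⊛ (μ ^ m)) ⊛ v i ∎
    where open Algebra.Properties.CommutativeSemigroup R.*-commutativeSemigroup

  -- The coefficients of the standard basis vectors form the inverse of the
  -- eigenvector matrix, so the moment is a trace in either order.
  moment≈closedWalks : ∀ {n} (G : Graph n) {μ} → IsSpectrum G μ →
    ∀ m → ∑ (λ j → μ j ^ m) ≈ ι (closedWalks G m)
  moment≈closedWalks {n} G {μ} spec m = begin
    ∑ (λ j → μ j ^ m)
      ≈⟨ ∑.sum-cong-≋ {n} (λ j → R.*-identityʳ (μ j ^ m)) ⟨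
    ∑ (λ j → (μ j ^ m) ⊛ 1#)
      ≈⟨ ∑.sum-cong-≋ {n} (λ j → R.*-congˡ (R.trans (left-inverse j j)
           (R.trans (R.reflexive (cong ι (⟦⟧-yes (j ≟ j) refl))) (R.+-identityʳ 1#)))) ⟨
    ∑ (λ j → (μ j ^ m) ⊛ ∑ (λ y → v j y ⊛ a y j))
      ≈⟨ ∑.sum-cong-≋ {n} (λ j → R.trans (∑.*-distribˡ-sum {n} (μ j ^ m) _)
           (∑.sum-cong-≋ {n} λ y → R.trans (R.sym (R.*-assoc (μ j ^ m) (v j y) (a y j))) (R.*-comm _ (a y j)))) ⟩
    ∑ (λ j → ∑ (λ y → a y j ⊛ ((μ j ^ m) ⊛ v j y)))
      ≈⟨ ∑.∑-comm (λ j y → a y j ⊛ ((μ j ^ m) ⊛ v j y)) ⟩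
    ∑ (λ y → ∑ (λ j → a y j ⊛ ((μ j ^ m) ⊛ v j y)))
      ≈⟨ ∑.sum-cong-≋ diagonal ⟩
    ∑ (λ y → ι (walks G m y y))
      ≈⟨ ι-sum {n} _ ⟨
    ι (closedWalks G m) ∎
    where
    open IsSpectrum spec
    open IsBasis isBasis
    v = eigenvector
    a : Fin n → Fin n → Carrier
    a y = proj₁ (spanning λ i → ι ⟦ y ≟ i ⟧)
    right-inverse : ∀ y i → ∑ (λ j → a y j ⊛ v j i) ≈ ι ⟦ y ≟ i ⟧
    right-inverse y = proj₂ (spanning λ i → ι ⟦ y ≟ i ⟧)
    ∑-δʳ : ∀ i (f : Fin n → Carrier) → ∑ (λ y → f y ⊛ ι ⟦ y ≟ i ⟧) ≈ f i
    ∑-δʳ i f = R.trans (∑.sum-cong-≋ {n} λ y → R.trans (R.*-comm (f y) _)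
      (R.*-congʳ (R.reflexive (cong ι (⟦⟧-cong (y ≟ i) (i ≟ y) sym sym))))) (∑-δ i f)
    -- Write `V` for the matrix with the eigenvectors as rows and `A` for the coefficients, so that
    -- AV = I. The rows of VA - I are then coefficients of vanishing combinations of the
    -- eigenvectors, because (VA - I)V = V(AV) - V = 0, and independence makes them zero.
    left-inverse : ∀ k j → ∑ (λ y → v k y ⊛ a y j) ≈ ι ⟦ k ≟ j ⟧
    left-inverse k j = Group.x∙y⁻¹≈ε⇒x≈y _ _ (independent (λ j → ∑ (λ y → v k y ⊛ a y j) ⊕ ⊖ ι ⟦ k ≟ j ⟧) vanishes j)
      where
      vanishes : ∀ i → ∑ (λ j → (∑ (λ y → v k y ⊛ a y j) ⊕ ⊖ ι ⟦ k ≟ j ⟧) ⊛ v j i) ≈ 0#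
      vanishes i = begin
        ∑ (λ j → (∑ (λ y → v k y ⊛ a y j) ⊕ ⊖ ι ⟦ k ≟ j ⟧) ⊛ v j i)
          ≈⟨ ∑.sum-cong-≋ {n} (λ j → R.trans (R.distribʳ (v j i) _ _)
               (R.+-congˡ (R.trans (R.sym (Ring.-‿distribˡ-* _ _)) (Ring.-‿distribʳ-* _ _)))) ⟩
        ∑ (λ j → ∑ (λ y → v k y ⊛ a y j) ⊛ v j i ⊕ ι ⟦ k ≟ j ⟧ ⊛ ⊖ v j i)
          ≈⟨ ∑.∑-distrib-+ (λ j → ∑ (λ y → v k y ⊛ a y j) ⊛ v j i) (λ j → ι ⟦ k ≟ j ⟧ ⊛ ⊖ v j i) ⟩
        ∑ (λ j → ∑ (λ y → v k y ⊛ a y j) ⊛ v j i) ⊕ ∑ (λ j → ι ⟦ k ≟ j ⟧ ⊛ ⊖ v j i)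
          ≈⟨ R.+-cong (∑-assoc (v k) a (λ j → v j i)) (∑-δ k (λ j → ⊖ v j i)) ⟩
        ∑ (λ y → v k y ⊛ ∑ (λ j → a y j ⊛ v j i)) ⊕ ⊖ v k i
          ≈⟨ R.+-congʳ (R.trans (∑.sum-cong-≋ {n} λ y → R.*-congˡ (right-inverse y i)) (∑-δʳ i (v k))) ⟩
        v k i ⊕ ⊖ v k i
          ≈⟨ R.-‿inverseʳ (v k i) ⟩
        0# ∎
    diagonal : ∀ y → ∑ (λ j → a y j ⊛ ((μ j ^ m) ⊛ v j y)) ≈ ι (walks G m y y)
    diagonal y = begin
      ∑ (λ j → a y j ⊛ ((μ j ^ m) ⊛ v j y))
        ≈⟨ ∑.sum-cong-≋ {n} (λ j → R.*-congˡ (R.trans (∑.sum-cong-≋ {n} λ l → R.*-comm (v j l) _) (walks-eigen G (isEigen j) m y))) ⟨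
      ∑ (λ j → a y j ⊛ ∑ (λ l → v j l ⊛ ι (walks G m y l)))
        ≈⟨ ∑-assoc (a y) v (λ l → ι (walks G m y l)) ⟨
      ∑ (λ l → ∑ (λ j → a y j ⊛ v j l) ⊛ ι (walks G m y l))
        ≈⟨ ∑.sum-cong-≋ {n} (λ l → R.*-congʳ (right-inverse y l)) ⟩
      ∑ (λ l → ι ⟦ y ≟ l ⟧ ⊛ ι (walks G m y l))
        ≈⟨ ∑-δ y (λ l → ι (walks G m y l)) ⟩
      ι (walks G m y y) ∎

  private module < = IsStrictPartialOrder ℝ.isStrictPartialOrder

  -- Apartness of 1 and 0 gives one of two signs. In the wrong case -1 is positive, and so is its
  -- square, which is 1.
  0<1 : 0# <ᴿ 1#
  0<1 with Equivalence.to (ℝ.#⇔<⊎> 1# 0#) (1#0 ℝ.heytingCommutativeRing)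
  ... | inj₂ 0<1 = 0<1
  ... | inj₁ 1<0 = <.<-respʳ-≈ [-1]²≈1 (ℝ.*-pos 0<-1 0<-1)
    where
    [-1]²≈1 : (⊖ 1#) ⊛ (⊖ 1#) ≈ 1#
    [-1]²≈1 = R.trans (R.sym (Ring.-‿distribˡ-* 1# (⊖ 1#)))
      (R.trans (R.-‿cong (R.*-identityˡ (⊖ 1#))) (Group.⁻¹-involutive 1#))
    0<-1 : 0# <ᴿ (⊖ 1#)
    0<-1 = <.<-respˡ-≈ (R.-‿inverseʳ 1#) (<.<-respʳ-≈ (R.+-identityˡ _) (ℝ.+-monoˡ-< (⊖ 1#) 1<0))

  ι-step : ∀ m → ι m <ᴿ ι (suc m)
  ι-step m = <.<-respˡ-≈ (R.+-identityˡ _) (ℝ.+-monoˡ-< (ι m) 0<1)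

  ι-mono-< : ∀ {m n} → m < n → ι m <ᴿ ι n
  ι-mono-< {m} m<n = go (≤⇒≤′ m<n)
    where
    go : ∀ {n} → suc m ≤′ n → ι m <ᴿ ι n
    go ≤′-refl             = ι-step m
    go (≤′-step {n} p) = <.trans (go p) (ι-step n)

  module _ {n} {eig : Graph n → Fin n → Carrier} (isSpectrum : ∀ G → IsSpectrum G (eig G)) where
    open SOrder eig

    ≺-from-closedWalks : ∀ {G H} m → 1 ≤ m → m ≤ n ∸ 1 →
      (∀ i → i < m → closedWalks G i ≡ closedWalks H i) →
      closedWalks G m < closedWalks H m → G ≺ H
    ≺-from-closedWalks {G} {H} m 1≤m m<n eq lt = m , 1≤m , m<n ,
      (λ i i<m → R.trans (moment G i) (R.trans (R.reflexive (cong ι (eq i i<m))) (R.sym (moment H i)))) ,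
      <.<-respˡ-≈ (R.sym (moment G m)) (<.<-respʳ-≈ (R.sym (moment H m)) (ι-mono-< lt))
      where
      moment : ∀ G i → S i G ≈ ι (closedWalks G i)
      moment G i = moment≈closedWalks G (isSpectrum G) i

-- Cut edges and rooted forests

T-== : ∀ {n} {i j : Fin n} → T (i == j) → i ≡ j
T-== {i = i} {j} t with i ≟ j
... | yes eq = eq

==-T : ∀ {n} {i j : Fin n} → i ≡ j → T (i == j)
==-T {i = i} {j} eq = subst T (sym (dec-true (i ≟ j) eq)) _

module _ {x y : Bool} where
  ∧⁺ : T x → T y → T (x ∧ y)
  ∧⁺ a b = Equivalence.from T-∧ (a , b)
  ∧⁻ : T (x ∧ y) → T x × T y
  ∧⁻ = Equivalence.to T-∧
  ∨⁺ : T x ⊎ T y → T (x ∨ y)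
  ∨⁺ = Equivalence.from T-∨
  ∨⁻ : T (x ∨ y) → T x ⊎ T y
  ∨⁻ = Equivalence.to T-∨

T-not⁺ : ∀ {x} → ¬ T x → T (not x)
T-not⁺ {true}  ¬t = ¬t _
T-not⁺ {false} ¬t = _

T-not⁻ : ∀ {x} → T (not x) → ¬ T x
T-not⁻ {true}  ()
T-not⁻ {false} _ ()

T-ext : ∀ {x y} → (T x → T y) → (T y → T x) → x ≡ y
T-ext {true}  {true}  f g = refl
T-ext {true}  {false} f g = ⊥-elim (f _)
T-ext {false} {true}  f g = ⊥-elim (g _)
T-ext {false} {false} f g = refl

fromRel⁺ : ∀ {n} (r : Fin n → Fin n → Bool) {i j} → i ≢ j → T (r i j) ⊎ T (r j i) → Adj (fromRel r) i j
fromRel⁺ r i≢j rij = ∧⁺ (T-not⁺ (i≢j ∘ T-==)) (∨⁺ rij)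

fromRel⁻ : ∀ {n} (r : Fin n → Fin n → Bool) {i j} → Adj (fromRel r) i j → i ≢ j × (T (r i j) ⊎ T (r j i))
fromRel⁻ r {i} {j} a = let p , q = ∧⁻ {not (i == j)} a in (λ eq → T-not⁻ p (==-T eq)) , ∨⁻ q

SameEdge : ∀ {n} (i j u w : Fin n) → Set
SameEdge i j u w = (i ≡ u × j ≡ w) ⊎ (i ≡ w × j ≡ u)

SameEdge-swapˡ : ∀ {n} {i j u w : Fin n} → SameEdge i j u w → SameEdge j i u w
SameEdge-swapˡ = [ (λ (p , q) → inj₂ (q , p)) , (λ (p , q) → inj₁ (q , p)) ]′

SameEdge-swapʳ : ∀ {n} {i j u w : Fin n} → SameEdge i j u w → SameEdge i j w u
SameEdge-swapʳ = Sum.swap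

module _ {n} (G : Graph n) where

  Adj-sym : ∀ {i j} → Adj G i j → Adj G j i
  Adj-sym {i} {j} = subst T (adj-sym G i j)

  Adj⇒≢ : ∀ {i j} → Adj G i j → i ≢ j
  Adj⇒≢ {i} a refl = subst T (adj-irrefl G i) a

  adj? : ∀ i j → Dec (Adj G i j)
  adj? i j = T? (adj G i j)

  private
    remaining : (u w i j : Fin n) → Bool
    remaining u w i j = adj G i j ∧ not (((i == u) ∧ (j == w)) ∨ ((i == w) ∧ (j == u)))

    remaining⁺ : ∀ {u w i j} → Adj G i j → ¬ SameEdge i j u w → T (remaining u w i j)
    remaining⁺ {u} {w} {i} {j} a ne = ∧⁺ a (T-not⁺ λ t → ne (Sum.map same same (∨⁻ {(i == u) ∧ (j == w)} t)))
      where
      same : ∀ {i j u w : Fin n} → T ((i == u) ∧ (j == w)) → i ≡ u × j ≡ w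
      same {i} {u = u} t = let p , q = ∧⁻ {i == u} t in T-== p , T-== q

    remaining⁻ : ∀ {u w i j} → T (remaining u w i j) → Adj G i j × ¬ SameEdge i j u w
    remaining⁻ {u} {w} {i} {j} t = let a , ne = ∧⁻ {adj G i j} t in a , λ s → T-not⁻ ne (∨⁺ {(i == u) ∧ (j == w)}
      (Sum.map (λ (p , q) → ∧⁺ (==-T p) (==-T q)) (λ (p , q) → ∧⁺ (==-T p) (==-T q)) s))

  deleteEdge⁺ : ∀ {u w i j} → Adj G i j → ¬ SameEdge i j u w → Adj (deleteEdge G u w) i j
  deleteEdge⁺ {u} {w} a ne = fromRel⁺ (remaining u w) (Adj⇒≢ a) (inj₁ (remaining⁺ a ne))

  deleteEdge⁻ : ∀ {u w i j} → Adj (deleteEdge G u w) i j → Adj G i j × ¬ SameEdge i j u w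
  deleteEdge⁻ {u} {w} a with proj₂ (fromRel⁻ (remaining u w) a)
  ... | inj₁ t = remaining⁻ t
  ... | inj₂ t = let a , ne = remaining⁻ t in Adj-sym a , ne ∘ SameEdge-swapˡ

  connected-via : ∀ r → (∀ x → Star (Adj G) x r) → Connected G
  connected-via r walk i j = walk i ◅◅ reverse Adj-sym (walk j)

module _ {n} {R : Fin n → Fin n → Set} {D : Fin n → Set} (D? : ∀ x → Dec (D x)) where

  crossing : ∀ {x y} → Star R x y → D x → ¬ D y → ∃[ a ] ∃[ b ] (R a b × D a × ¬ D b)
  crossing ε        Dx ¬Dy = contradiction Dx ¬Dy
  crossing (_◅_ {x} {z} r walk) Dx ¬Dy with D? z
  ... | yes Dz = crossing walk Dz ¬Dy
  ... | no ¬Dz = x , z , r , Dx , ¬Dz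

module _ {n} (G : Graph n) where

  IsCutEdge-sym : ∀ {i j} → IsCutEdge G i j → IsCutEdge G j i
  IsCutEdge-sym (a , disc) = Adj-sym G a , λ conn → disc λ x y →
    gmap id (λ e → let a , ne = deleteEdge⁻ G e in deleteEdge⁺ G a (ne ∘ SameEdge-swapʳ)) (conn x y)

  -- After the deletion a walk from `x` to `y` would still have to leave `D`, and it could do so
  -- only along an edge of `G` other than xy.
  separated⇒cutEdge : ∀ {x y} → Adj G x y → {D : Fin n → Set} → (∀ z → Dec (D z)) → D x → ¬ D y →
    (∀ a b → Adj G a b → D a → ¬ D b → SameEdge a b x y) → IsCutEdge G x y
  separated⇒cutEdge {x} {y} a D? Dx ¬Dy only = a , λ conn →
    let a , b , e , Da , ¬Db = crossing D? (conn x y) Dx ¬Dy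
        ab , ne = deleteEdge⁻ G e
    in ne (only a b ab Da ¬Db)

-- Acyclicity is encoded by a measure that drops along parent pointers. The measure need not be the
-- depth, so the same `up` and `height` remain valid when the set of roots is enlarged; this is how
-- a spanning tree is later cut into the forests hanging from a clique.
record Forest {n} (Root : Fin n → Set) : Set where
  field
    root?    : ∀ x → Dec (Root x)
    up       : Fin n → Fin n
    height   : Fin n → ℕ
    descends : ∀ {x} → ¬ Root x → height (up x) < height x

module ForestProperties {n} {Root : Fin n → Set} (F : Forest Root) where
  open Forest F

  climb : (P : Fin n → Set) → (∀ {x} → Root x → P x) → (∀ {x} → ¬ Root x → P (up x) → P x) → ∀ x → P x
  climb P base step x = go (suc (height x)) x ≤-refl
    where
    -- `m` is fuel: a strict bound on the height, which drops at each parent.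
    go : ∀ m x → height x < m → P x
    go (suc m) x (s≤s h≤m) with root? x
    ... | yes r = base r
    ... | no ¬r = step ¬r (go m (up x) (<-≤-trans (descends ¬r) h≤m))

  up≢ : ∀ {x} → ¬ Root x → up x ≢ x
  up≢ ¬r eq = <-irrefl (cong height eq) (descends ¬r)

  infix 4 _⊒_
  -- `x` is `y` or an ancestor of `y`. Thus `x ⊒_` is the subtree below `x`, which serves as one
  -- side of the cut given by the edge above `x`.
  data _⊒_ (x : Fin n) : Fin n → Set where
    here  : x ⊒ x
    above : ∀ {y} → ¬ Root y → x ⊒ up y → x ⊒ y

  ⊒-height : ∀ {x y} → x ⊒ y → x ≡ y ⊎ height x < height y
  ⊒-height here = inj₁ refl
  ⊒-height (above ¬r x⊒) with ⊒-height x⊒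
  ... | inj₁ refl = inj₂ (descends ¬r)
  ... | inj₂ lt   = inj₂ (<-trans lt (descends ¬r))

  ⊒-antisym : ∀ {x y} → x ⊒ y → y ⊒ x → x ≡ y
  ⊒-antisym p q with ⊒-height p | ⊒-height q
  ... | inj₁ eq | _       = eq
  ... | inj₂ _  | inj₁ eq = sym eq
  ... | inj₂ a  | inj₂ b  = contradiction b (<-asym a)

  ⊒-root : ∀ {x y} → Root y → x ⊒ y → x ≡ y
  ⊒-root r here         = refl
  ⊒-root r (above ¬r _) = contradiction r ¬r

  ⊒-up : ∀ {x y} → x ≢ y → x ⊒ y → x ⊒ up y
  ⊒-up x≢y here        = contradiction refl x≢y
  ⊒-up x≢y (above _ p) = p

  ⋣-up : ∀ {x} → ¬ Root x → ¬ (x ⊒ up x)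
  ⋣-up ¬r p with ⊒-height p
  ... | inj₁ eq = up≢ ¬r (sym eq)
  ... | inj₂ lt = <-asym lt (descends ¬r)

  _⊒?_ : ∀ x y → Dec (x ⊒ y)
  x ⊒? y = climb (λ y → Dec (x ⊒ y))
    (λ {y} r → map′ (λ { refl → here }) (⊒-root r) (x ≟ y))
    (λ {y} ¬r x⊒? → map′ [ (λ { refl → here }) , above ¬r ]′
      (λ { here → inj₁ refl ; (above _ p) → inj₂ p }) ((x ≟ y) ⊎-dec x⊒?)) y

  Up : Fin n → Fin n → Set
  Up x y = ¬ Root x × y ≡ up x

  up? : ∀ x y → Dec (Up x y)
  up? x y = ¬? (root? x) ×-dec (y ≟ up x)

  Up-asym : ∀ {x y} → Up x y → ¬ Up y x
  Up-asym {x} {y} (¬r , y≡) (¬s , x≡) = <-asym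
    (subst (λ z → height z < height x) (sym y≡) (descends ¬r))
    (subst (λ z → height z < height y) (sym x≡) (descends ¬s))

-- Counting cut edges by double sums over ordered pairs

length-filter-tabulate : ∀ {n} {A : Set} {P : A → Set} (P? : ∀ a → Dec (P a)) (f : Fin n → A) →
  length (filter P? (tabulate f)) ≡ sum (λ i → ⟦ P? (f i) ⟧)
length-filter-tabulate {zero}  P? f = refl
length-filter-tabulate {suc n} P? f with does (P? (f zero))
... | true  = cong suc (length-filter-tabulate P? (f ∘ suc))
... | false = length-filter-tabulate P? (f ∘ suc)

length-filter-pairs : ∀ {m n} {P : Fin m × Fin n → Set} (P? : ∀ e → Dec (P e)) →
  length (filter P? (cartesianProduct (allFin m) (allFin n))) ≡ sum (λ i → sum λ j → ⟦ P? (i , j) ⟧)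
length-filter-pairs {m} {n} P? = go id
  where
  open ≡-Reasoning
  go : ∀ {m} (f : Fin m → _) → length (filter P? (cartesianProduct (tabulate f) (allFin n))) ≡ sum (λ i → sum λ j → ⟦ P? (f i , j) ⟧)
  go {zero}  f = refl
  go {suc m} f = begin
    length (filter P? (map (f zero ,_) (allFin n) ++ rest))
      ≡⟨ cong length (filter-++ P? (map (f zero ,_) (allFin n)) rest) ⟩
    length (filter P? (map (f zero ,_) (allFin n)) ++ filter P? rest)
      ≡⟨ length-++ (filter P? (map (f zero ,_) (allFin n))) ⟩
    length (filter P? (map (f zero ,_) (allFin n))) + length (filter P? rest)
      ≡⟨ cong₂ _+_ (trans (cong (length ∘ filter P?) (map-tabulate {n = n} id (f zero ,_))) (length-filter-tabulate P? (f zero ,_))) (go (f ∘ suc)) ⟩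
    sum (λ j → ⟦ P? (f zero , j) ⟧) + sum (λ i → sum λ j → ⟦ P? (f (suc i) , j) ⟧) ∎
    where rest = cartesianProduct (tabulate (f ∘ suc)) (allFin n)

∑∑-symmetric : ∀ {n} {R : Fin n → Fin n → Set} (R? : ∀ i j → Dec (R i j)) →
  (∀ {i j} → R i j → R j i) → (∀ {i} → ¬ R i i) →
  let half = ∑∑ λ i j → ⟦ (i Fin.<? j) ×-dec R? i j ⟧ in ∑∑ (λ i j → ⟦ R? i j ⟧) ≡ half + half
∑∑-symmetric {n} {R} R? R-sym R-irrefl = begin
  ∑∑ (λ i j → ⟦ R? i j ⟧)
    ≡⟨ ∑∑-cong (λ i j → ⟦⟧-⊎ (R? i j) ((i Fin.<? j) ×-dec R? i j) ((j Fin.<? i) ×-dec R? j i)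
         (split i j) proj₂ (R-sym ∘ proj₂) (λ (lt , _) (gt , _) → Fin.<-asym lt gt)) ⟩
  ∑∑ (λ i j → ordered i j + ordered j i)
    ≡⟨ ∑∑-+ ordered (λ i j → ordered j i) ⟩
  ∑∑ ordered + ∑∑ (λ i j → ordered j i)
    ≡⟨ cong (∑∑ ordered +_) (∑∑-transpose ordered) ⟩
  ∑∑ ordered + ∑∑ ordered ∎
  where
  open ≡-Reasoning
  ordered : Fin n → Fin n → ℕ
  ordered i j = ⟦ (i Fin.<? j) ×-dec R? i j ⟧
  split : ∀ i j → R i j → (i Fin.< j × R i j) ⊎ (j Fin.< i × R j i)
  split i j r with Fin.<-cmp i j
  ... | tri< lt _ _   = inj₁ (lt , r)
  ... | tri≈ _ refl _ = contradiction r R-irrefl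
  ... | tri> _ _ gt   = inj₂ (gt , R-sym r)

double-injective : ∀ {a b} → a + a ≡ b + b → a ≡ b
double-injective {a} {b} eq with <-cmp a b
... | tri< lt _ _ = contradiction eq (<⇒≢ (+-mono-< lt lt))
... | tri≈ _ eq _ = eq
... | tri> _ _ gt = contradiction (sym eq) (<⇒≢ (+-mono-< gt gt))

module _ {n} (G : Graph n) where
  IsCutEdge-irrefl : ∀ {i} → ¬ IsCutEdge G i i
  IsCutEdge-irrefl (a , _) = Adj⇒≢ G a refl

  module _ (cut? : ∀ i j → Dec (IsCutEdge G i j)) where
    private
      listed? : (e : Fin n × Fin n) → Dec (proj₁ e Fin.< proj₂ e × IsCutEdge G (proj₁ e) (proj₂ e))
      listed? (i , j) = (i Fin.<? j) ×-dec cut? i j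

      cutEdges : List (Fin n × Fin n)
      cutEdges = filter listed? (cartesianProduct (allFin n) (allFin n))

      unique : Unique cutEdges
      unique = Unique.filter⁺ listed? (Unique.cartesianProduct⁺ (Unique.allFin⁺ n) (Unique.allFin⁺ n))

      sound : ∀ {e} → e ∈ cutEdges → proj₁ e Fin.< proj₂ e × IsCutEdge G (proj₁ e) (proj₂ e)
      sound e∈ = proj₂ (∈-filter⁻ listed? {xs = cartesianProduct (allFin n) (allFin n)} e∈)

      listed : ∀ {e} → proj₁ e Fin.< proj₂ e × IsCutEdge G (proj₁ e) (proj₂ e) → e ∈ cutEdges
      listed c = ∈-filter⁺ listed? (∈-cartesianProduct⁺ (∈-allFin _) (∈-allFin _)) c

      ∑∑-cut : ∑∑ (λ i j → ⟦ cut? i j ⟧) ≡ length cutEdges + length cutEdges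
      ∑∑-cut = trans (∑∑-symmetric cut? (IsCutEdge-sym G) IsCutEdge-irrefl)
        (cong (λ l → l + l) (sym (length-filter-pairs listed?)))

    -- The list in `CutEdgeCount` is arbitrary, but two duplicate-free lists with the same members
    -- are permutations of each other, so its length is that of the filtered list `cutEdges`.
    cutEdgeCount⇒∑∑ : ∀ {k} → CutEdgeCount G k → ∑∑ (λ i j → ⟦ cut? i j ⟧) ≡ k + k
    cutEdgeCount⇒∑∑ (es , es! , refl , mem) = trans ∑∑-cut (cong (λ l → l + l) (↭-length (∼bag⇒↭
      (unique∧set⇒bag unique es! (mk⇔ (Equivalence.from (mem _ _) ∘ sound) (listed ∘ Equivalence.to (mem _ _)))))))

    ∑∑⇒cutEdgeCount : ∀ {k} → ∑∑ (λ i j → ⟦ cut? i j ⟧) ≡ k + k → CutEdgeCount G k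
    ∑∑⇒cutEdgeCount {k} eq = cutEdges , unique , double-injective (trans (sym ∑∑-cut) eq) ,
      λ i j → mk⇔ sound listed

  -- A cut edge is defined by a negated connectedness. Searching the list of cut edges decides it
  -- without any search for walks.
  cutEdgeCount⇒cut? : ∀ {k} → CutEdgeCount G k → ∀ i j → Dec (IsCutEdge G i j)
  cutEdgeCount⇒cut? (es , _ , _ , mem) i j with Fin.<-cmp i j
  ... | tri< lt _ _   = map′ (proj₂ ∘ Equivalence.to (mem i j)) (Equivalence.from (mem i j) ∘ (lt ,_)) ((i , j) ∈? es)
    where open Data.List.Membership.DecPropositional (≡-dec _≟_ _≟_)
  ... | tri≈ _ refl _ = no IsCutEdge-irrefl
  ... | tri> _ _ gt   = map′ (IsCutEdge-sym G ∘ proj₂ ∘ Equivalence.to (mem j i))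
    (Equivalence.from (mem j i) ∘ (gt ,_) ∘ IsCutEdge-sym G) ((j , i) ∈? es)
    where open Data.List.Membership.DecPropositional (≡-dec _≟_ _≟_)

-- Cliques with hanging forests

module _ {n} {Root : Fin n → Set} (F : Forest Root) where
  open Forest F
  open ForestProperties F

  roots nonroots : ℕ
  roots    = sum λ x → ⟦ root? x ⟧
  nonroots = sum λ x → ⟦ ¬? (root? x) ⟧

  children : Fin n → ℕ
  children y = sum λ x → ⟦ up? x y ⟧

  root-or-not : ∀ x → ⟦ root? x ⟧ + ⟦ ¬? (root? x) ⟧ ≡ 1
  root-or-not x with root? x
  ... | yes _ = refl
  ... | no _  = refl

  roots+nonroots : roots + nonroots ≡ n
  roots+nonroots = begin
    roots + nonroots
      ≡⟨ ∑-distrib-+ (λ x → ⟦ root? x ⟧) (λ x → ⟦ ¬? (root? x) ⟧) ⟨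
    sum (λ x → ⟦ root? x ⟧ + ⟦ ¬? (root? x) ⟧)
      ≡⟨ sum-cong-≗ {n} root-or-not ⟩
    sum {n} (λ _ → 1)
      ≡⟨ trans (sum-const n) (*-identityʳ n) ⟩
    n ∎
    where open ≡-Reasoning

  ∑-up : ∀ x → sum (λ y → ⟦ up? x y ⟧) ≡ ⟦ ¬? (root? x) ⟧
  ∑-up x with root? x
  ... | yes _ = sum-zero {n} (λ _ → refl)
  ... | no _  = trans (sum-cong-≗ {n} λ y → ⟦⟧-cong (y ≟ up x) (up x ≟ y) sym sym) (sum-point (up x))

  ∑∑-up : ∑∑ (λ x y → ⟦ up? x y ⟧) ≡ nonroots
  ∑∑-up = sum-cong-≗ {n} ∑-up

  ∑-children : sum children ≡ nonroots
  ∑-children = trans (∑∑-transpose (λ x y → ⟦ up? x y ⟧)) ∑∑-up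

  ∑∑-up-or-down : {R : Fin n → Fin n → Set} (R? : ∀ i j → Dec (R i j)) →
    (∀ {i j} → R i j → Up i j ⊎ Up j i) → (∀ {i j} → Up i j → R i j) → (∀ {i j} → Up j i → R i j) →
    ∑∑ (λ i j → ⟦ R? i j ⟧) ≡ nonroots + nonroots
  ∑∑-up-or-down R? to from from′ = begin
    ∑∑ (λ i j → ⟦ R? i j ⟧)
      ≡⟨ ∑∑-cong (λ i j → ⟦⟧-⊎ (R? i j) (up? i j) (up? j i) to from from′ Up-asym) ⟩
    ∑∑ (λ i j → ⟦ up? i j ⟧ + ⟦ up? j i ⟧)
      ≡⟨ ∑∑-+ (λ i j → ⟦ up? i j ⟧) (λ i j → ⟦ up? j i ⟧) ⟩
    ∑∑ (λ i j → ⟦ up? i j ⟧) + ∑∑ (λ i j → ⟦ up? j i ⟧)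
      ≡⟨ cong₂ _+_ ∑∑-up ∑-children ⟩
    nonroots + nonroots ∎
    where open ≡-Reasoning

Clique : ∀ {n} → (Fin n → Set) → Fin n → Fin n → Set
Clique C i j = C i × C j × i ≢ j

-- The last three fields say that the edges of `G` are exactly the pairs in `C` and the parent
-- edges. The size of `C` is left open, so a tree can be viewed with a single vertex or with an edge
-- as its core.
record CliqueForest {n} (G : Graph n) (C : Fin n → Set) : Set where
  field
    forest : Forest C
  open Forest forest public
  open ForestProperties forest public
  field
    link    : ∀ {i j} → Adj G i j → Clique C i j ⊎ (Up i j ⊎ Up j i)
    clique⁺ : ∀ {i j} → Clique C i j → Adj G i j
    up⁺     : ∀ {x} → ¬ C x → Adj G x (up x)

module _ {n} {G : Graph n} {C : Fin n → Set} (F : CliqueForest G C) where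
  open CliqueForest F

  -- The subtree of `x` contains no vertex of `C`, so no clique edge leaves it, and a parent edge
  -- leaves it only at its top `x`.
  upEdge-isCut : ∀ {x} → ¬ C x → IsCutEdge G x (up x)
  upEdge-isCut {x} ¬Cx = separated⇒cutEdge G (up⁺ ¬Cx) {x ⊒_} (x ⊒?_) here (⋣-up ¬Cx) only
    where
    only : ∀ a b → Adj G a b → x ⊒ a → ¬ (x ⊒ b) → SameEdge a b x (up x)
    only a b ab x⊒a x⋣b with link ab
    ... | inj₁ (Ca , _) = contradiction (subst C (sym (⊒-root Ca x⊒a)) Ca) ¬Cx
    ... | inj₂ (inj₂ (¬Cb , refl)) = contradiction (above ¬Cb x⊒a) x⋣b
    ... | inj₂ (inj₁ (¬Ca , refl)) with x ≟ a
    ...   | yes refl = inj₁ (refl , refl)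
    ...   | no x≢a   = contradiction (⊒-up x≢a x⊒a) x⋣b

  cliqueForest-connected : ∀ {r} → C r → Connected G
  cliqueForest-connected {r} Cr = connected-via G r (climb (λ x → Star (Adj G) x r) base (λ ¬Cx → up⁺ ¬Cx ◅_))
    where
    base : ∀ {x} → C x → Star (Adj G) x r
    base {x} Cx with x ≟ r
    ... | yes refl = ε
    ... | no x≢r   = clique⁺ (Cx , Cr , x≢r) ◅ ε

  module _ (third : ∀ {i j} → Clique C i j → ∃[ l ] C l × l ≢ i × l ≢ j) where

    -- The third vertex provides the detour i, l, j. For a one-vertex core `third` holds vacuously,
    -- which lets the same count of cut edges serve for trees.
    cliqueEdge-isNotCut : ∀ {i j} → Clique C i j → ¬ IsCutEdge G i j
    cliqueEdge-isNotCut {i} {j} ij@(Ci , Cj , i≢j) (_ , disconnected) =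
      disconnected (connected-via G′ i (climb (λ x → Star (Adj G′) x i) base
        λ ¬Cx → deleteEdge⁺ G (up⁺ ¬Cx) [ (λ (p , _) → ¬Cx (subst C (sym p) Ci)) , (λ (p , _) → ¬Cx (subst C (sym p) Cj)) ]′ ◅_))
      where
      G′ = deleteEdge G i j
      base : ∀ {x} → C x → Star (Adj G′) x i
      base {x} Cx with x ≟ i | x ≟ j
      ... | yes refl | _ = ε
      ... | no x≢i | no x≢j = deleteEdge⁺ G (clique⁺ (Cx , Ci , x≢i)) [ x≢i ∘ proj₁ , x≢j ∘ proj₁ ]′ ◅ ε
      ... | no x≢i | yes refl = let l , Cl , l≢i , l≢j = third ij in
        deleteEdge⁺ G (clique⁺ (Cx , Cl , l≢j ∘ sym)) [ x≢i ∘ proj₁ , l≢i ∘ proj₂ ]′ ◅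
        deleteEdge⁺ G (clique⁺ (Cl , Ci , l≢i)) [ l≢i ∘ proj₁ , l≢j ∘ proj₁ ]′ ◅ ε

    cliqueForest-𝒢 : ∀ {r k} → C r → nonroots forest ≡ k → 𝒢 n k G
    cliqueForest-𝒢 Cr refl = cliqueForest-connected Cr ,
      ∑∑⇒cutEdgeCount G cut? (∑∑-up-or-down forest cut? cut⇒up up⇒cut (IsCutEdge-sym G ∘ up⇒cut))
      where
      up⇒cut : ∀ {i j} → Up i j → IsCutEdge G i j
      up⇒cut (¬Ci , refl) = upEdge-isCut ¬Ci
      cut⇒up : ∀ {i j} → IsCutEdge G i j → Up i j ⊎ Up j i
      cut⇒up cut with link (proj₁ cut)
      ... | inj₁ ij = contradiction cut (cliqueEdge-isNotCut ij)
      ... | inj₂ ud = ud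
      cut? : ∀ i j → Dec (IsCutEdge G i j)
      cut? i j = map′ [ up⇒cut , IsCutEdge-sym G ∘ up⇒cut ]′ cut⇒up (up? i j ⊎-dec up? j i)

0/1-≤ : ∀ q → q ≤ 1 → q * q ≡ q
0/1-≤ zero          _ = refl
0/1-≤ (suc zero)    _ = refl
0/1-≤ (suc (suc _)) (s≤s ())

⟦⟧-≤1 : ∀ {p} {P : Set p} (d : Dec P) → ⟦ d ⟧ ≤ 1
⟦⟧-≤1 (yes _) = ≤-refl
⟦⟧-≤1 (no _)  = z≤n

⟦⟧-> : ∀ {p} {P : Set p} (d : Dec P) → 0 < ⟦ d ⟧ → P
⟦⟧-> (yes p) _ = p

⟦⟧-× : ∀ {p q} {P : Set p} {Q : Set q} (d : Dec P) (e : Dec Q) → ⟦ d ×-dec e ⟧ ≡ ⟦ d ⟧ * ⟦ e ⟧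
⟦⟧-× (yes _) e = sym (+-identityʳ _)
⟦⟧-× (no _)  e = refl

Clique? : ∀ {n} {P : Fin n → Set} → (∀ i → Dec (P i)) → ∀ i j → Dec (Clique P i j)
Clique? P? i j = P? i ×-dec (P? j ×-dec ¬? (i ≟ j))

-- The added indicator is the missing diagonal entry; with it the row becomes a product of two
-- indicators.
Clique-row : ∀ {n} {P : Fin n → Set} (P? : ∀ i → Dec (P i)) i →
  sum (λ j → ⟦ Clique? P? i j ⟧) + ⟦ P? i ⟧ ≡ ⟦ P? i ⟧ * sum (λ j → ⟦ P? j ⟧)
Clique-row {n} {P} P? i = begin
  sum (λ j → ⟦ Clique? P? i j ⟧) + ⟦ P? i ⟧
    ≡⟨ cong (sum (λ j → ⟦ Clique? P? i j ⟧) +_) (sum-δ i (λ _ → ⟦ P? i ⟧)) ⟨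
  sum (λ j → ⟦ Clique? P? i j ⟧) + sum (λ j → ⟦ i ≟ j ⟧ * ⟦ P? i ⟧)
    ≡⟨ ∑-distrib-+ (λ j → ⟦ Clique? P? i j ⟧) (λ j → ⟦ i ≟ j ⟧ * ⟦ P? i ⟧) ⟨
  sum (λ j → ⟦ Clique? P? i j ⟧ + ⟦ i ≟ j ⟧ * ⟦ P? i ⟧)
    ≡⟨ sum-cong-≗ {n} pointwise ⟩
  sum (λ j → ⟦ P? i ⟧ * ⟦ P? j ⟧)
    ≡⟨ *-distribˡ-sum {n} ⟦ P? i ⟧ (λ j → ⟦ P? j ⟧) ⟨
  ⟦ P? i ⟧ * sum (λ j → ⟦ P? j ⟧) ∎
  where
  open ≡-Reasoning
  pointwise : ∀ j → ⟦ Clique? P? i j ⟧ + ⟦ i ≟ j ⟧ * ⟦ P? i ⟧ ≡ ⟦ P? i ⟧ * ⟦ P? j ⟧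
  pointwise j = trans (cong (⟦ Clique? P? i j ⟧ +_) (sym (⟦⟧-× (i ≟ j) (P? i)))) (trans
    (sym (⟦⟧-⊎ (P? i ×-dec P? j) (Clique? P? i j) ((i ≟ j) ×-dec P? i)
      split (λ (a , b , _) → a , b) (λ { (refl , a) → a , a }) (λ (_ , _ , ne) (eq , _) → ne eq)))
    (⟦⟧-× (P? i) (P? j)))
    where
    split : P i × P j → Clique P i j ⊎ (i ≡ j × P i)
    split (Pi , Pj) with i ≟ j
    ... | yes e = inj₂ (e , Pi)
    ... | no ne = inj₁ (Pi , Pj , ne)

-- Closed walks of length at most four through degrees and codegrees

degree : ∀ {n} → Graph n → Fin n → ℕ
degree G i = sum (edge G i)

codegree : ∀ {n} → Graph n → Fin n → Fin n → ℕ
codegree G i j = sum λ z → edge G i z * edge G z j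

module _ {n} (G : Graph n) where
  open ≡-Reasoning

  edge-sym : ∀ i j → edge G i j ≡ edge G j i
  edge-sym i j = cong 𝟙 (adj-sym G i j)

  edge-idem : ∀ i j → edge G i j * edge G i j ≡ edge G i j
  edge-idem i j = 0/1-≤ _ (⟦⟧-≤1 (adj? G i j))

  walks₁ : ∀ i j → walks G 1 i j ≡ edge G i j
  walks₁ i j = trans (sum-cong-≗ {n} λ l → trans (*-comm (edge G i l) _)
    (cong (_* edge G i l) (⟦⟧-cong (l ≟ j) (j ≟ l) sym sym))) (sum-δ j (edge G i))

  walks₂ : ∀ i j → walks G 2 i j ≡ codegree G i j
  walks₂ i j = sum-cong-≗ {n} λ z → cong (edge G i z *_) (walks₁ z j)

  codegree-sym : ∀ i j → codegree G i j ≡ codegree G j i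
  codegree-sym i j = sum-cong-≗ {n} λ z → trans (*-comm (edge G i z) _) (cong₂ _*_ (edge-sym z j) (edge-sym i z))

  codegree-diagonal : ∀ i → codegree G i i ≡ degree G i
  codegree-diagonal i = sum-cong-≗ {n} λ z → trans (cong (edge G i z *_) (edge-sym z i)) (edge-idem i z)

  closedWalks₁ : closedWalks G 1 ≡ 0
  closedWalks₁ = sum-zero λ i → trans (walks₁ i i) (cong 𝟙 (adj-irrefl G i))

  closedWalks₂ : closedWalks G 2 ≡ sum (degree G)
  closedWalks₂ = sum-cong-≗ {n} λ i → trans (walks₂ i i) (codegree-diagonal i)

  closedWalks₃ : closedWalks G 3 ≡ ∑∑ (λ i j → edge G i j * codegree G i j)
  closedWalks₃ = ∑∑-cong λ i j → cong (edge G i j *_) (trans (walks₂ j i) (codegree-sym j i))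

  -- The codegrees are the entries of the squared adjacency matrix. Its symmetry turns the trace of
  -- its square into a sum of squared entries.
  closedWalks₄ : closedWalks G 4 ≡ ∑∑ (λ i j → codegree G i j * codegree G i j)
  closedWalks₄ = sum-cong-≗ {n} λ i → begin
    sum (λ y → edge G i y * sum (λ z → edge G y z * walks G 2 z i))
      ≡⟨ sum-cong-≗ {n} (λ y → *-distribˡ-sum {n} (edge G i y) _) ⟩
    sum (λ y → sum (λ z → edge G i y * (edge G y z * walks G 2 z i)))
      ≡⟨ ∑-comm (λ y z → edge G i y * (edge G y z * walks G 2 z i)) ⟩
    sum (λ z → sum (λ y → edge G i y * (edge G y z * walks G 2 z i)))
      ≡⟨ sum-cong-≗ {n} (λ z → sum-cong-≗ {n} λ y → *-assoc (edge G i y) _ _) ⟨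
    sum (λ z → sum (λ y → edge G i y * edge G y z * walks G 2 z i))
      ≡⟨ sum-cong-≗ {n} (λ z → *-distribʳ-sum {n} (walks G 2 z i) (λ y → edge G i y * edge G y z)) ⟨
    sum (λ z → codegree G i z * walks G 2 z i)
      ≡⟨ sum-cong-≗ {n} (λ z → cong (codegree G i z *_) (trans (walks₂ z i) (codegree-sym z i))) ⟩
    sum (λ z → codegree G i z * codegree G i z) ∎

  -- Walks of length two are counted by their middle vertex.
  ∑∑-codegree : ∑∑ (codegree G) ≡ sum (λ z → degree G z * degree G z)
  ∑∑-codegree = begin
    sum (λ i → sum λ j → sum λ z → edge G i z * edge G z j)
      ≡⟨ sum-cong-≗ {n} (λ i → ∑-comm (λ j z → edge G i z * edge G z j)) ⟩
    sum (λ i → sum λ z → sum λ j → edge G i z * edge G z j)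
      ≡⟨ ∑-comm (λ i z → sum λ j → edge G i z * edge G z j) ⟩
    sum (λ z → sum λ i → sum λ j → edge G i z * edge G z j)
      ≡⟨ sum-cong-≗ {n} (λ z → sum-cong-≗ {n} λ i → trans (sym (*-distribˡ-sum {n} (edge G i z) (edge G z))) (cong (_* degree G z) (edge-sym i z))) ⟩
    sum (λ z → sum λ i → edge G z i * degree G z)
      ≡⟨ sum-cong-≗ {n} (λ z → *-distribʳ-sum {n} (degree G z) (edge G z)) ⟨
    sum (λ z → degree G z * degree G z) ∎

-- Moments of a clique with hanging forests

module CliqueForestMoments {n} {G : Graph n} {C : Fin n → Set} (F : CliqueForest G C)
                           {b} (roots≡ : roots (CliqueForest.forest F) ≡ 2 + b) where
  open CliqueForest F
  open ≡-Reasoning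

  clique? : ∀ i j → Dec (Clique C i j)
  clique? = Clique? root?

  c : Fin n → ℕ
  c = children forest

  private
    d : Fin n → ℕ
    d = degree G

    q : Fin n → Fin n → ℕ
    q = codegree G

    isRoot : Fin n → ℕ
    isRoot x = ⟦ root? x ⟧

    k′ : ℕ
    k′ = nonroots forest

    child-lower : ∀ {x y} → Up y x → height x < height y
    child-lower {x} {y} (¬Cy , refl) = descends ¬Cy

    downward : ∀ {x y} → Adj G x y → ¬ C x → y ≢ up x → Up y x
    downward xy ¬Cx y≢ with link xy
    ... | inj₁ (Cx , _)       = contradiction Cx ¬Cx
    ... | inj₂ (inj₁ (_ , e)) = contradiction e y≢
    ... | inj₂ (inj₂ down)    = down

    -- A walk that leaves x downward and never turns back keeps descending.
    downward-next : ∀ {x y z} → Up y x → Adj G y z → z ≢ x → Up z y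
    downward-next (¬Cy , x≡) yz z≢x = downward yz ¬Cy (λ e → z≢x (trans e (sym x≡)))

    distinct⇒one-down : ∀ {x y z} → Adj G x y → Adj G x z → ¬ C x → y ≢ z → Up y x ⊎ Up z x
    distinct⇒one-down {x} {y} {z} xy xz ¬Cx y≢z with y ≟ up x
    ... | no y≢    = inj₁ (downward xy ¬Cx y≢)
    ... | yes refl = inj₂ (downward xz ¬Cx (y≢z ∘ sym))

    -- Two distinct neighbours of `i` cannot both be its parent, so one is a child. Walking round
    -- the cycle through that child moves from parent to child at every step and raises `height`
    -- each time, even at the step that returns to `i`.
    no-triangle-outside : ∀ {i j z} → ¬ C i → Adj G i j → Adj G j z → ¬ Adj G i z
    no-triangle-outside {i} {j} {z} ¬Ci ij jz iz =
      [ (λ ji → cycle ji jz iz) , (λ zi → cycle zi (Adj-sym G jz) ij) ]′ (distinct⇒one-down ij iz ¬Ci (Adj⇒≢ G jz))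
      where
      cycle : ∀ {j z} → Up j i → Adj G j z → Adj G i z → ⊥
      cycle ji jz iz =
        let zj = downward-next ji jz (Adj⇒≢ G iz ∘ sym)
            iz′ = downward-next zj (Adj-sym G iz) (λ { refl → <-irrefl refl (child-lower ji) })
        in <-asym (<-trans (child-lower ji) (child-lower zj)) (child-lower iz′)

    no-square-outside : ∀ {i j y z} → ¬ C i → i ≢ j → y ≢ z →
      Adj G i y → Adj G y j → Adj G j z → ¬ Adj G i z
    no-square-outside {i} {j} ¬Ci i≢j y≢z iy yj jz iz =
      [ (λ yi → cycle y≢z yi yj jz iz) , (λ zi → cycle (y≢z ∘ sym) zi (Adj-sym G jz) (Adj-sym G yj) iy) ]′
        (distinct⇒one-down iy iz ¬Ci y≢z)
      where
      cycle : ∀ {y z} → y ≢ z → Up y i → Adj G y j → Adj G j z → Adj G i z → ⊥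
      cycle y≢z yi yj jz iz =
        let jy = downward-next yi yj (i≢j ∘ sym)
            zj = downward-next jy jz (y≢z ∘ sym)
            iz′ = downward-next zj (Adj-sym G iz) i≢j
        in <-asym (<-trans (child-lower yi) (child-lower jy)) (<-trans (child-lower zj) (child-lower iz′))

    common : ∀ {i j z} → 0 < edge G i z * edge G z j → Adj G i z × Adj G z j
    common {i} {j} {z} pos with adj G i z | adj G z j
    ... | true  | true  = _ , _
    ... | true  | false = contradiction pos λ ()
    ... | false | _     = contradiction pos λ ()

    outside : ∀ {i j} → i ≢ j → ¬ Clique C i j → ¬ C i ⊎ ¬ C j
    outside {i} {j} i≢j ¬ij with root? i
    ... | no ¬Ci = inj₁ ¬Ci
    ... | yes Ci = inj₂ λ Cj → ¬ij (Ci , Cj , i≢j)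

    -- Two common neighbours would close a 4-cycle through a vertex outside `C`.
    codegree-outside : ∀ {i j} → i ≢ j → ¬ Clique C i j → q i j ≤ 1
    codegree-outside {i} {j} i≢j ¬ij = sum≤1 _
      (λ z → *-mono-≤ (⟦⟧-≤1 (adj? G i z)) (⟦⟧-≤1 (adj? G z j)))
      λ y z py pz → decidable-stable (y ≟ z) λ y≢z →
        let iy , yj = common py
            iz , zj = common pz
        in [ (λ ¬Ci → no-square-outside ¬Ci i≢j y≢z iy yj (Adj-sym G zj) iz)
           , (λ ¬Cj → no-square-outside ¬Cj (i≢j ∘ sym) y≢z (Adj-sym G yj) (Adj-sym G iy) iz (Adj-sym G zj)) ]′
           (outside i≢j ¬ij)

    codegree-upEdge : ∀ {i j} → Adj G i j → ¬ Clique C i j → q i j ≡ 0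
    codegree-upEdge {i} {j} ij ¬ij = n≤0⇒n≡0 (≮⇒≥ λ pos →
      let z , p = sum>0⇒ (λ z → edge G i z * edge G z j) pos
          iz , zj = common p
      in [ (λ ¬Ci → no-triangle-outside ¬Ci ij (Adj-sym G zj) iz)
         , (λ ¬Cj → no-triangle-outside ¬Cj (Adj-sym G ij) iz (Adj-sym G zj)) ]′
         (outside (Adj⇒≢ G ij) ¬ij))

    -- The common neighbours are the remaining clique vertices: one outside `C` would have both `i`
    -- and `j` as its parent. Adding the points `i` and `j` completes the count to all 2 + b roots.
    codegree-clique : ∀ {i j} → Clique C i j → q i j ≡ b
    codegree-clique {i} {j} ij@(Ci , Cj , i≢j) = +-cancelʳ-≡ 2 _ _ (begin
      q i j + 2
        ≡⟨ cong₂ (λ s t → q i j + (s + t)) (sum-point i) (sum-point j) ⟨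
      q i j + (sum (λ z → ⟦ i ≟ z ⟧) + sum (λ z → ⟦ j ≟ z ⟧))
        ≡⟨ cong (q i j +_) (∑-distrib-+ (λ z → ⟦ i ≟ z ⟧) (λ z → ⟦ j ≟ z ⟧)) ⟨
      q i j + sum (λ z → ⟦ i ≟ z ⟧ + ⟦ j ≟ z ⟧)
        ≡⟨ ∑-distrib-+ (λ z → edge G i z * edge G z j) (λ z → ⟦ i ≟ z ⟧ + ⟦ j ≟ z ⟧) ⟨
      sum (λ z → edge G i z * edge G z j + (⟦ i ≟ z ⟧ + ⟦ j ≟ z ⟧))
        ≡⟨ sum-cong-≗ {n} pointwise ⟩
      roots forest
        ≡⟨ trans roots≡ (+-comm 2 b) ⟩
      b + 2 ∎)
      where
      pointwise : ∀ z → edge G i z * edge G z j + (⟦ i ≟ z ⟧ + ⟦ j ≟ z ⟧) ≡ isRoot z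
      pointwise z = begin
        ⟦ adj? G i z ⟧ * ⟦ adj? G z j ⟧ + (⟦ i ≟ z ⟧ + ⟦ j ≟ z ⟧)
          ≡⟨ cong₂ _+_ (sym (⟦⟧-× (adj? G i z) (adj? G z j)))
               (sym (⟦⟧-⊎ ((i ≟ z) ⊎-dec (j ≟ z)) (i ≟ z) (j ≟ z) id inj₁ inj₂ λ { refl refl → i≢j refl })) ⟩
        ⟦ adj? G i z ×-dec adj? G z j ⟧ + ⟦ (i ≟ z) ⊎-dec (j ≟ z) ⟧
          ≡⟨ ⟦⟧-⊎ (root? z) (adj? G i z ×-dec adj? G z j) ((i ≟ z) ⊎-dec (j ≟ z))
               split common⇒root [ (λ { refl → Ci }) , (λ { refl → Cj }) ]′
               (λ (iz , zj) → [ Adj⇒≢ G iz , Adj⇒≢ G zj ∘ sym ]′) ⟨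
        isRoot z ∎
        where
        split : C z → (Adj G i z × Adj G z j) ⊎ (i ≡ z ⊎ j ≡ z)
        split Cz with i ≟ z | j ≟ z
        ... | yes e | _ = inj₂ (inj₁ e)
        ... | no _ | yes e = inj₂ (inj₂ e)
        ... | no i≢z | no j≢z = inj₁ (clique⁺ (Ci , Cz , i≢z) , clique⁺ (Cz , Cj , j≢z ∘ sym))
        common⇒root : Adj G i z × Adj G z j → C z
        common⇒root (iz , zj) = decidable-stable (root? z) λ ¬Cz → i≢j (trans (parent (Adj-sym G iz) Ci ¬Cz) (sym (parent zj Cj ¬Cz)))
          where
          parent : ∀ {y} → Adj G z y → C y → ¬ C z → y ≡ up z
          parent zy Cy ¬Cz with link zy
          ... | inj₁ (Cz , _)         = contradiction Cz ¬Cz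
          ... | inj₂ (inj₁ (_ , e))   = e
          ... | inj₂ (inj₂ (¬Cy , _)) = contradiction Cy ¬Cy

    pairs : ℕ
    pairs = ∑∑ λ i j → ⟦ clique? i j ⟧

    ∑-clique : ∀ i → sum (λ j → ⟦ clique? i j ⟧) ≡ isRoot i * (1 + b)
    ∑-clique i = +-cancelʳ-≡ (isRoot i) _ _ (begin
      sum (λ j → ⟦ clique? i j ⟧) + isRoot i
        ≡⟨ Clique-row root? i ⟩
      isRoot i * roots forest
        ≡⟨ cong (isRoot i *_) roots≡ ⟩
      isRoot i * (2 + b)
        ≡⟨ *-suc (isRoot i) (1 + b) ⟩
      isRoot i + isRoot i * (1 + b)
        ≡⟨ +-comm (isRoot i) _ ⟩
      isRoot i * (1 + b) + isRoot i ∎)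

    pairs≡ : pairs ≡ (2 + b) * (1 + b)
    pairs≡ = trans (sum-cong-≗ {n} ∑-clique) (trans (sym (*-distribʳ-sum {n} (1 + b) isRoot)) (cong (_* (1 + b)) roots≡))

  -- One formula covers both kinds of vertices: the 1 is the parent of a nonroot, or one of the 1 +
  -- b clique neighbours of a root.
  degree≡ : ∀ i → degree G i ≡ 1 + isRoot i * b + c i
  degree≡ i = begin
    sum (edge G i)
      ≡⟨ sum-cong-≗ {n} (λ j → trans
           (⟦⟧-⊎ (adj? G i j) (clique? i j) (up? i j ⊎-dec up? j i) link clique⁺ up-or-down⁺ clique-disjoint)
           (cong (⟦ clique? i j ⟧ +_) (⟦⟧-⊎ (up? i j ⊎-dec up? j i) (up? i j) (up? j i) id inj₁ inj₂ Up-asym))) ⟩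
    sum (λ j → ⟦ clique? i j ⟧ + (⟦ up? i j ⟧ + ⟦ up? j i ⟧))
      ≡⟨ trans (∑-distrib-+ (λ j → ⟦ clique? i j ⟧) (λ j → ⟦ up? i j ⟧ + ⟦ up? j i ⟧))
           (cong (sum (λ j → ⟦ clique? i j ⟧) +_) (∑-distrib-+ (λ j → ⟦ up? i j ⟧) (λ j → ⟦ up? j i ⟧))) ⟩
    sum (λ j → ⟦ clique? i j ⟧) + (sum (λ j → ⟦ up? i j ⟧) + c i)
      ≡⟨ cong₂ (λ s t → s + (t + c i)) (∑-clique i) (∑-up forest i) ⟩
    isRoot i * (1 + b) + (⟦ ¬? (root? i) ⟧ + c i)
      ≡⟨ +-assoc (isRoot i * (1 + b)) _ _ ⟨
    isRoot i * (1 + b) + ⟦ ¬? (root? i) ⟧ + c i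
      ≡⟨ cong (_+ c i) (trans (cong (_+ ⟦ ¬? (root? i) ⟧) (trans (*-suc (isRoot i) b) (+-comm (isRoot i) _)))
           (trans (+-assoc (isRoot i * b) _ _) (trans (cong (isRoot i * b +_) (root-or-not forest i)) (+-comm _ 1)))) ⟩
    1 + isRoot i * b + c i ∎
    where
    up-or-down⁺ : ∀ {j} → Up i j ⊎ Up j i → Adj G i j
    up-or-down⁺ (inj₁ (¬Ci , refl)) = up⁺ ¬Ci
    up-or-down⁺ (inj₂ (¬Cj , refl)) = Adj-sym G (up⁺ ¬Cj)
    clique-disjoint : ∀ {j} → Clique C i j → ¬ (Up i j ⊎ Up j i)
    clique-disjoint (Ci , Cj , _) = [ (λ (¬Ci , _) → ¬Ci Ci) , (λ (¬Cj , _) → ¬Cj Cj) ]′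

  closedWalks₂≡ : closedWalks G 2 ≡ n + (2 + b) * b + k′
  closedWalks₂≡ = begin
    closedWalks G 2
      ≡⟨ trans (closedWalks₂ G) (sum-cong-≗ {n} degree≡) ⟩
    sum (λ i → 1 + isRoot i * b + c i)
      ≡⟨ trans (∑-distrib-+ (λ i → 1 + isRoot i * b) c) (cong (_+ sum c) (∑-distrib-+ (λ _ → 1) (λ i → isRoot i * b))) ⟩
    sum {n} (λ _ → 1) + sum (λ i → isRoot i * b) + sum c
      ≡⟨ cong₂ _+_ (cong₂ _+_ (trans (sum-const n) (*-identityʳ n))
           (trans (sym (*-distribʳ-sum {n} b isRoot)) (cong (_* b) roots≡))) (∑-children forest) ⟩
    n + (2 + b) * b + k′ ∎

  closedWalks₃≡ : closedWalks G 3 ≡ (2 + b) * (1 + b) * b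
  closedWalks₃≡ = begin
    closedWalks G 3
      ≡⟨ trans (closedWalks₃ G) (∑∑-cong pointwise) ⟩
    ∑∑ (λ i j → ⟦ clique? i j ⟧ * b)
      ≡⟨ sum-cong-≗ {n} (λ i → *-distribʳ-sum {n} b (λ j → ⟦ clique? i j ⟧)) ⟨
    sum (λ i → sum (λ j → ⟦ clique? i j ⟧) * b)
      ≡⟨ *-distribʳ-sum {n} b (λ i → sum (λ j → ⟦ clique? i j ⟧)) ⟨
    pairs * b
      ≡⟨ cong (_* b) pairs≡ ⟩
    (2 + b) * (1 + b) * b ∎
    where
    pointwise : ∀ i j → edge G i j * q i j ≡ ⟦ clique? i j ⟧ * b
    pointwise i j = aux (clique? i j) (adj? G i j)
      where
      aux : (cl : Dec (Clique C i j)) (ad : Dec (Adj G i j)) → ⟦ ad ⟧ * q i j ≡ ⟦ cl ⟧ * b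
      aux (yes ij) (yes _) = cong (_+ 0) (codegree-clique ij)
      aux (yes ij) (no ¬a) = contradiction (clique⁺ ij) ¬a
      aux (no ¬ij) (yes a) = trans (+-identityʳ _) (codegree-upEdge a ¬ij)
      aux (no ¬ij) (no _)  = refl

  -- The part of the squared degree that depends on how the children are distributed. The remaining
  -- terms have a sum fixed by `n`, `b` and the number of nonroots.
  weight : Fin n → ℕ
  weight i = c i * c i + 2 * b * (isRoot i * c i)

  private
    ∑-degree² : sum (λ i → d i * d i) ≡ n + (2 + b) * (b * (2 + b)) + 2 * k′ + sum weight
    ∑-degree² = begin
      sum (λ i → d i * d i)
        ≡⟨ sum-cong-≗ {n} pointwise ⟩
      sum (λ i → 1 + isRoot i * (b * (2 + b)) + 2 * c i + weight i)
        ≡⟨ ∑-distrib-+ (λ i → 1 + isRoot i * (b * (2 + b)) + 2 * c i) weight ⟩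
      sum (λ i → 1 + isRoot i * (b * (2 + b)) + 2 * c i) + sum weight
        ≡⟨ cong (_+ sum weight) (trans (∑-distrib-+ (λ i → 1 + isRoot i * (b * (2 + b))) (λ i → 2 * c i))
             (cong (_+ sum (λ i → 2 * c i)) (∑-distrib-+ (λ _ → 1) (λ i → isRoot i * (b * (2 + b)))))) ⟩
      sum {n} (λ _ → 1) + sum (λ i → isRoot i * (b * (2 + b))) + sum (λ i → 2 * c i) + sum weight
        ≡⟨ cong (_+ sum weight) (cong₂ _+_ (cong₂ _+_ (trans (sum-const n) (*-identityʳ n))
             (trans (sym (*-distribʳ-sum {n} (b * (2 + b)) isRoot)) (cong (_* (b * (2 + b))) roots≡)))
             (trans (sym (*-distribˡ-sum {n} 2 c)) (cong (2 *_) (∑-children forest)))) ⟩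
      n + (2 + b) * (b * (2 + b)) + 2 * k′ + sum weight ∎
      where
      expand : ∀ e x → e * e ≡ e → (1 + e * b + x) * (1 + e * b + x) ≡ 1 + e * (b * (2 + b)) + 2 * x + (x * x + 2 * b * (e * x))
      expand e x e² = begin
        (1 + e * b + x) * (1 + e * b + x)
          ≡⟨ solve 3 (λ e b x → (con 1 :+ e :* b :+ x) :* (con 1 :+ e :* b :+ x) :=
               con 1 :+ (e :* e :* (b :* b) :+ e :* (b :* con 2)) :+ con 2 :* x :+ (x :* x :+ con 2 :* b :* (e :* x))) refl e b x ⟩
        1 + (e * e * (b * b) + e * (b * 2)) + 2 * x + (x * x + 2 * b * (e * x))
          ≡⟨ cong (λ t → 1 + (t * (b * b) + e * (b * 2)) + 2 * x + (x * x + 2 * b * (e * x))) e² ⟩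
        1 + (e * (b * b) + e * (b * 2)) + 2 * x + (x * x + 2 * b * (e * x))
          ≡⟨ solve 3 (λ e b x → con 1 :+ (e :* (b :* b) :+ e :* (b :* con 2)) :+ con 2 :* x :+ (x :* x :+ con 2 :* b :* (e :* x)) :=
               con 1 :+ e :* (b :* (con 2 :+ b)) :+ con 2 :* x :+ (x :* x :+ con 2 :* b :* (e :* x))) refl e b x ⟩
        1 + e * (b * (2 + b)) + 2 * x + (x * x + 2 * b * (e * x)) ∎
      pointwise : ∀ i → d i * d i ≡ 1 + isRoot i * (b * (2 + b)) + 2 * c i + weight i
      pointwise i = trans (cong (λ t → t * t) (degree≡ i)) (expand (isRoot i) (c i) (0/1-≤ _ (⟦⟧-≤1 (root? i))))

  -- A codegree off the diagonal and off the clique is 0 or 1, hence its own square. The exceptional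
  -- pairs are balanced by adding d and b on the left and their squares on the right, which avoids
  -- subtraction. The factor 2 arises because the sum of the codegrees and the diagonal squares both
  -- equal the sum of the squared degrees.
  closedWalks₄≡ : closedWalks G 4 + (n + (2 + b) * b + k′) + (2 + b) * (1 + b) * b ≡
    2 * (n + (2 + b) * (b * (2 + b)) + 2 * k′ + sum weight) + (2 + b) * (1 + b) * (b * b)
  closedWalks₄≡ = begin
    closedWalks G 4 + (n + (2 + b) * b + k′) + (2 + b) * (1 + b) * b
      ≡⟨ cong₂ _+_ (cong₂ _+_ (sym (closedWalks₄ G)) (trans ∑∑-diagonal (trans (sym (closedWalks₂ G)) closedWalks₂≡))) ∑∑-cl ⟨
    ∑∑ (λ i j → q i j * q i j) + ∑∑ (λ i j → ⟦ i ≟ j ⟧ * d j) + ∑∑ (λ i j → ⟦ clique? i j ⟧ * b)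
      ≡⟨ trans (∑∑-+ (λ i j → q i j * q i j + ⟦ i ≟ j ⟧ * d j) (λ i j → ⟦ clique? i j ⟧ * b))
           (cong (_+ ∑∑ (λ i j → ⟦ clique? i j ⟧ * b)) (∑∑-+ (λ i j → q i j * q i j) (λ i j → ⟦ i ≟ j ⟧ * d j))) ⟨
    ∑∑ (λ i j → q i j * q i j + ⟦ i ≟ j ⟧ * d j + ⟦ clique? i j ⟧ * b)
      ≡⟨ ∑∑-cong pointwise ⟩
    ∑∑ (λ i j → q i j + ⟦ i ≟ j ⟧ * (d j * d j) + ⟦ clique? i j ⟧ * (b * b))
      ≡⟨ trans (∑∑-+ (λ i j → q i j + ⟦ i ≟ j ⟧ * (d j * d j)) (λ i j → ⟦ clique? i j ⟧ * (b * b)))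
           (cong (_+ ∑∑ (λ i j → ⟦ clique? i j ⟧ * (b * b))) (∑∑-+ q (λ i j → ⟦ i ≟ j ⟧ * (d j * d j)))) ⟩
    ∑∑ q + ∑∑ (λ i j → ⟦ i ≟ j ⟧ * (d j * d j)) + ∑∑ (λ i j → ⟦ clique? i j ⟧ * (b * b))
      ≡⟨ cong₂ _+_ (trans (cong₂ _+_ (∑∑-codegree G) ∑∑-diagonal)
           (trans (cong (λ s → s + s) ∑-degree²) (twice (n + (2 + b) * (b * (2 + b)) + 2 * k′ + sum weight)))) ∑∑-cl ⟩
    2 * (n + (2 + b) * (b * (2 + b)) + 2 * k′ + sum weight) + (2 + b) * (1 + b) * (b * b) ∎
    where
    twice : ∀ x → x + x ≡ 2 * x
    twice x = cong (x +_) (sym (+-identityʳ x))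
    ∑∑-diagonal : ∀ {f : Fin n → ℕ} → ∑∑ (λ i j → ⟦ i ≟ j ⟧ * f j) ≡ sum f
    ∑∑-diagonal {f} = sum-cong-≗ {n} λ i → sum-δ i f
    ∑∑-cl : ∀ {x} → ∑∑ (λ i j → ⟦ clique? i j ⟧ * x) ≡ (2 + b) * (1 + b) * x
    ∑∑-cl {x} = begin
      ∑∑ (λ i j → ⟦ clique? i j ⟧ * x)
        ≡⟨ sum-cong-≗ {n} (λ i → *-distribʳ-sum {n} x (λ j → ⟦ clique? i j ⟧)) ⟨
      sum (λ i → sum (λ j → ⟦ clique? i j ⟧) * x)
        ≡⟨ *-distribʳ-sum {n} x (λ i → sum (λ j → ⟦ clique? i j ⟧)) ⟨
      pairs * x
        ≡⟨ cong (_* x) pairs≡ ⟩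
      (2 + b) * (1 + b) * x ∎
    pointwise : ∀ i j → q i j * q i j + ⟦ i ≟ j ⟧ * d j + ⟦ clique? i j ⟧ * b ≡
                        q i j + ⟦ i ≟ j ⟧ * (d j * d j) + ⟦ clique? i j ⟧ * (b * b)
    pointwise i j = aux (i ≟ j) (clique? i j)
      where
      aux : (eq : Dec (i ≡ j)) (cl : Dec (Clique C i j)) →
        q i j * q i j + ⟦ eq ⟧ * d j + ⟦ cl ⟧ * b ≡ q i j + ⟦ eq ⟧ * (d j * d j) + ⟦ cl ⟧ * (b * b)
      aux (yes i≡j)  (yes (_ , _ , i≢j)) = contradiction i≡j i≢j
      aux (yes refl) (no _) rewrite codegree-diagonal G i =
        solve 1 (λ d → d :* d :+ con 1 :* d :+ con 0 := d :+ con 1 :* (d :* d) :+ con 0) refl (d i)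
      aux (no i≢j) (yes ij) rewrite codegree-clique ij =
        solve 1 (λ b → b :* b :+ con 0 :+ con 1 :* b := b :+ con 0 :+ con 1 :* (b :* b)) refl b
      aux (no i≢j) (no ¬ij) = cong (λ t → t + 0 + 0) (0/1-≤ _ (codegree-outside i≢j ¬ij))

-- The structure of graphs with k cut edges

least : ∀ {P : ℕ → Set} → (∀ m → Dec (P m)) → ∀ {m} → P m → ∃[ l ] P l × (∀ {j} → P j → l ≤ j)
least {P} P? {m} Pm = search m 0 (subst P (sym (+-identityʳ m)) Pm) (λ _ → z≤n)
  where
  search : ∀ m l → P (m + l) → (∀ {j} → P j → l ≤ j) → ∃[ l ] P l × (∀ {j} → P j → l ≤ j)
  search zero    l Pl minimal = l , Pl , minimal
  search (suc m) l Pm+l minimal with P? l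
  ... | yes Pl = l , Pl , minimal
  ... | no ¬Pl = search m (suc l) (subst P (sym (+-suc m l)) Pm+l)
    λ Pj → ≤∧≢⇒< (minimal Pj) (λ { refl → ¬Pl Pj })

SpanningTree : ∀ {n} → Graph n → Fin n → Set
SpanningTree {n} G r = Σ[ F ∈ Forest (_≡ r) ] (∀ {x} → x ≢ r → Adj G x (Forest.up F x))

-- A breadth-first tree: `height` is the distance to `r`, and the parent is the second vertex of a
-- shortest walk to `r`.
connected⇒spanningTree : ∀ {n} (G : Graph n) → Connected G → ∀ r → SpanningTree G r
connected⇒spanningTree {n} G connected r =
  record { root? = _≟ r ; up = up ; height = height ; descends = λ {x} x≢r → proj₂ (up-spec x x≢r) } ,
  λ {x} x≢r → proj₁ (up-spec x x≢r)
  where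
  Reach : ℕ → Fin n → Set
  Reach zero    x = x ≡ r
  Reach (suc m) x = ∃[ y ] Adj G x y × Reach m y
  reach? : ∀ m x → Dec (Reach m x)
  reach? zero    x = x ≟ r
  reach? (suc m) x = any? λ y → adj? G x y ×-dec reach? m y
  reached : ∀ {x} → Star (Adj G) x r → ∃[ m ] Reach m x
  reached ε        = 0 , refl
  reached (a ◅ as) = let m , R = reached as in suc m , _ , a , R
  distance : ∀ x → ∃[ l ] Reach l x × (∀ {j} → Reach j x → l ≤ j)
  distance x = least (λ m → reach? m x) (proj₂ (reached (connected x r)))
  height : Fin n → ℕ
  height x = proj₁ (distance x)
  closer : ∀ x → x ≢ r → ∃[ y ] Adj G x y × height y < height x
  closer x x≢r with distance x
  ... | zero  , x≡r , _           = contradiction x≡r x≢r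
  ... | suc l , (y , xy , Ry) , _ = y , xy , s≤s (proj₂ (proj₂ (distance y)) Ry)
  up : Fin n → Fin n
  up x with x ≟ r
  ... | yes _  = x
  ... | no x≢r = proj₁ (closer x x≢r)
  up-spec : ∀ x → x ≢ r → Adj G x (up x) × height (up x) < height x
  up-spec x x≢r with x ≟ r
  ... | yes x≡r = contradiction x≡r x≢r
  ... | no x≢r′ = proj₂ (closer x x≢r′)

module RootedAt {n k} (G : Graph n) (cut? : ∀ i j → Dec (IsCutEdge G i j))
                (#cut≡ : ∑∑ (λ i j → ⟦ cut? i j ⟧) ≡ k + k)
                {r : Fin n} (tree : SpanningTree G r) where
  private
    rooted : Forest (_≡ r)
    rooted = proj₁ tree

  open Forest rooted using (up; height; descends)
  open ForestProperties rooted hiding (Up-asym)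

  treeEdge : ∀ {x} → x ≢ r → Adj G x (up x)
  treeEdge = proj₂ tree

  Cut : Fin n → Fin n → Set
  Cut = IsCutEdge G

  N : Fin n → Fin n → Set
  N i j = Adj G i j × ¬ Cut i j

  N? : ∀ i j → Dec (N i j)
  N? i j = adj? G i j ×-dec ¬? (cut? i j)

  N-sym : ∀ {i j} → N i j → N j i
  N-sym (a , ¬c) = Adj-sym G a , ¬c ∘ IsCutEdge-sym G

  N⇒≢ : ∀ {i j} → N i j → i ≢ j
  N⇒≢ (a , _) = Adj⇒≢ G a

  -- R holds at the vertex nearest to r of each part left after deleting all
  -- cut edges.
  R O Core : Fin n → Set
  R x    = x ≡ r ⊎ Cut x (up x)
  O x    = ¬ R x
  Core x = x ≡ r ⊎ ¬ Cut x (up x)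

  R? : ∀ x → Dec (R x)
  R? x = (x ≟ r) ⊎-dec cut? x (up x)

  O? : ∀ x → Dec (O x)
  O? x = ¬? (R? x)

  -- The spanning tree with every uncut parent edge disregarded. Its nonroots are the lower ends of
  -- the cut edges, so there are `k` of them in any graph of the class; only in the extremal case do
  -- its roots form a clique.
  coreForest : Forest Core
  coreForest = record { root? = λ x → (x ≟ r) ⊎-dec ¬? (cut? x (up x)) ; up = up ; height = height
                      ; descends = λ ¬core → descends (¬core ∘ inj₁) }

  open ForestProperties coreForest using () renaming (Up to CutUp)

  -- The spanning tree survives the deletion of an edge outside it, so a cut edge joins a vertex to
  -- its parent.
  cut⇒up : ∀ {i j} → Cut i j → CutUp i j ⊎ CutUp j i
  cut⇒up {i} {j} cut@(ij , disconnected) with up? i j | up? j i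
  ... | yes (i≢r , refl) | _ = inj₁ ([ i≢r , (λ ¬c → ¬c cut) ]′ , refl)
  ... | no _ | yes (j≢r , refl) = inj₂ ([ j≢r , (λ ¬c → ¬c (IsCutEdge-sym G cut)) ]′ , refl)
  ... | no ¬ij | no ¬ji = contradiction (connected-via G′ r (climb (λ x → Star (Adj G′) x r) (λ { refl → ε })
      λ {x} x≢r → deleteEdge⁺ G (treeEdge x≢r)
        [ (λ { (refl , e) → ¬ij (x≢r , sym e) }) , (λ { (refl , e) → ¬ji (x≢r , sym e) }) ]′ ◅_)) disconnected
    where G′ = deleteEdge G i j

  up⇒cut : ∀ {i j} → CutUp i j → Cut i j
  up⇒cut {i} (¬core , refl) = decidable-stable (cut? i (up i)) (¬core ∘ inj₂)

  -- Deleting the cut edge above x separates the subtree of x from the rest.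
  leaves-subtree : ∀ {x y z} → x ≢ r → Cut x (up x) → Adj G y z → x ⊒ y → ¬ (x ⊒ z) → SameEdge y z x (up x)
  leaves-subtree {x} {y} {z} x≢r (_ , disconnected) yz x⊒y x⋣z =
    decidable-stable (((y ≟ x) ×-dec (z ≟ up x)) ⊎-dec ((y ≟ up x) ×-dec (z ≟ x)))
      λ ne → disconnected (connected-via G′ r (toRoot ne))
    where
    G′ = deleteEdge G x (up x)
    outside : ∀ t → ¬ (x ⊒ t) → Star (Adj G′) t r
    outside = climb (λ t → ¬ (x ⊒ t) → Star (Adj G′) t r) (λ { refl _ → ε })
      λ {t} t≢r ih x⋣t → deleteEdge⁺ G (treeEdge t≢r)
        [ (λ { (refl , _) → x⋣t here }) , (λ (_ , e) → x⋣t (above t≢r (subst (x ⊒_) (sym e) here))) ]′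
        ◅ ih (x⋣t ∘ above t≢r)
    inside : ∀ t → x ⊒ t → Star (Adj G′) t x
    inside = climb (λ t → x ⊒ t → Star (Adj G′) t x) (λ { refl x⊒r → subst (Star (Adj G′) r) (sym (⊒-root refl x⊒r)) ε }) step
      where
      step : ∀ {t} → t ≢ r → (x ⊒ up t → Star (Adj G′) (up t) x) → x ⊒ t → Star (Adj G′) t x
      step {t} t≢r ih x⊒t with x ≟ t
      ... | yes refl = ε
      ... | no x≢t   = deleteEdge⁺ G (treeEdge t≢r)
        [ (λ { (refl , _) → x≢t refl }) , (λ { (refl , _) → ⋣-up x≢r x⊒t }) ]′ ◅ ih (⊒-up x≢t x⊒t)
    -- If yz is a different edge, then a vertex inside the subtree can climb to `x`, descend to `y`,
    -- leave along yz and climb to `r`, all without the deleted edge.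
    toRoot : ¬ SameEdge y z x (up x) → ∀ t → Star (Adj G′) t r
    toRoot ne t with x ⊒? t
    ... | no x⋣t  = outside t x⋣t
    ... | yes x⊒t = inside t x⊒t ◅◅ reverse (Adj-sym G′) (inside y x⊒y) ◅◅ deleteEdge⁺ G yz ne ◅ outside z x⋣z

  -- An uncut edge never leaves the subtree of a vertex of `R`: the subtree of `r` is everything,
  -- and any other is left only by the cut edge above its top.
  stay : ∀ {x y z} → R x → N y z → x ⊒ y → x ⊒ z
  stay {x} {y} {z} Rx (yz , ¬cut) x⊒y with x ≟ r | Rx
  ... | yes refl | _        = climb (x ⊒_) (λ { refl → here }) above z
  ... | no x≢r   | inj₁ x≡r = contradiction x≡r x≢r
  ... | no x≢r   | inj₂ cut = decidable-stable (x ⊒? z) λ x⋣z →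
    [ (λ { (refl , refl) → ¬cut cut }) , (λ { (refl , refl) → ¬cut (IsCutEdge-sym G cut) }) ]′
      (leaves-subtree x≢r cut yz x⊒y x⋣z)

  -- By `stay` each of the two would lie in the subtree of the other.
  R-isolated : ∀ {x y} → R x → R y → ¬ N x y
  R-isolated Rx Ry xy = N⇒≢ xy (⊒-antisym (stay Rx xy here) (stay Ry (N-sym xy) here))

  R-neighbour-unique : ∀ {x y z} → N z x → N z y → R x → R y → x ≡ y
  R-neighbour-unique zx zy Rx Ry = ⊒-antisym (stay Rx zy (stay Rx (N-sym zx) here)) (stay Ry zx (stay Ry (N-sym zy) here))

  nonroots≡k : nonroots coreForest ≡ k
  nonroots≡k = double-injective (trans (sym (∑∑-up-or-down coreForest cut? cut⇒up up⇒cut (IsCutEdge-sym G ∘ up⇒cut)))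
    #cut≡)

  #O #N : ℕ
  #O = sum λ x → ⟦ O? x ⟧
  #N = ∑∑ λ i j → ⟦ N? i j ⟧

  rR : R r
  rR = inj₁ refl

  roots≡ : roots coreForest ≡ 1 + #O
  roots≡ = begin
    sum (λ x → ⟦ Forest.root? coreForest x ⟧)
      ≡⟨ sum-cong-≗ {n} (λ x → ⟦⟧-⊎ (Forest.root? coreForest x) (r ≟ x) (O? x) (split x) (inj₁ ∘ sym) (λ o → inj₂ (o ∘ inj₂))
           λ { refl o → o rR }) ⟩
    sum (λ x → ⟦ r ≟ x ⟧ + ⟦ O? x ⟧)
      ≡⟨ ∑-distrib-+ (λ x → ⟦ r ≟ x ⟧) (λ x → ⟦ O? x ⟧) ⟩
    sum (λ x → ⟦ r ≟ x ⟧) + #O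
      ≡⟨ cong (_+ #O) (sum-point r) ⟩
    1 + #O ∎
    where
    open ≡-Reasoning
    split : ∀ x → Core x → r ≡ x ⊎ O x
    split x core with r ≟ x | core
    ... | yes r≡x | _ = inj₁ r≡x
    ... | no r≢x | inj₁ x≡r = contradiction (sym x≡r) r≢x
    ... | no r≢x | inj₂ ¬c  = inj₂ [ r≢x ∘ sym , ¬c ]′

  closedWalks₂≡N : closedWalks G 2 ≡ #N + (k + k)
  closedWalks₂≡N = begin
    closedWalks G 2
      ≡⟨ closedWalks₂ G ⟩
    ∑∑ (edge G)
      ≡⟨ ∑∑-cong (λ i j → ⟦⟧-⊎ (adj? G i j) (N? i j) (cut? i j) (split i j) proj₁ proj₁ proj₂) ⟩
    ∑∑ (λ i j → ⟦ N? i j ⟧ + ⟦ cut? i j ⟧)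
      ≡⟨ ∑∑-+ (λ i j → ⟦ N? i j ⟧) (λ i j → ⟦ cut? i j ⟧) ⟩
    #N + ∑∑ (λ i j → ⟦ cut? i j ⟧)
      ≡⟨ cong (#N +_) #cut≡ ⟩
    #N + (k + k) ∎
    where
    open ≡-Reasoning
    split : ∀ i j → Adj G i j → N i j ⊎ Cut i j
    split i j ij with cut? i j
    ... | yes cut = inj₂ cut
    ... | no ¬cut = inj₁ (ij , ¬cut)

  private
    toR? : ∀ i j → Dec (O i × R j × N i j)
    toR? i j = O? i ×-dec (R? j ×-dec N? i j)

    -- An uncut edge has at most one end in `R`, and a vertex of `O` has at most one uncut neighbour
    -- there. With o = `#O` this gives at most o² - o ordered pairs inside `O` and 2o between `O`
    -- and `R`, in total o + o².
    bound : Fin n → Fin n → ℕ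
    bound i j = ⟦ Clique? O? i j ⟧ + (⟦ toR? i j ⟧ + ⟦ toR? j i ⟧)

    N≤bound : ∀ i j → ⟦ N? i j ⟧ ≤ bound i j
    N≤bound i j = by-cases (N? i j) (R? i) (R? j)
      where
      by-cases : (d : Dec (N i j)) → Dec (R i) → Dec (R j) → ⟦ d ⟧ ≤ bound i j
      by-cases (no _)   _        _        = z≤n
      by-cases (yes ij) (yes Ri) (yes Rj) = contradiction ij (R-isolated Ri Rj)
      by-cases (yes ij) (yes Ri) (no Oj)  = ≤-trans (≤-reflexive (sym (⟦⟧-yes (toR? j i) (Oj , Ri , N-sym ij))))
        (≤-trans (m≤n+m ⟦ toR? j i ⟧ ⟦ toR? i j ⟧) (m≤n+m _ ⟦ Clique? O? i j ⟧))
      by-cases (yes ij) (no Oi)  (yes Rj) = ≤-trans (≤-reflexive (sym (⟦⟧-yes (toR? i j) (Oi , Rj , ij))))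
        (≤-trans (m≤m+n ⟦ toR? i j ⟧ ⟦ toR? j i ⟧) (m≤n+m _ ⟦ Clique? O? i j ⟧))
      by-cases (yes ij) (no Oi)  (no Oj)  = ≤-trans (≤-reflexive (sym (⟦⟧-yes (Clique? O? i j) (Oi , Oj , N⇒≢ ij)))) (m≤m+n _ _)

    row-toR : ∀ i → sum (λ j → ⟦ toR? i j ⟧) ≤ ⟦ O? i ⟧
    row-toR i = by-cases (R? i)
      where
      by-cases : Dec (R i) → sum (λ j → ⟦ toR? i j ⟧) ≤ ⟦ O? i ⟧
      by-cases (yes Ri) = ≤-trans (≤-reflexive (sum-zero λ j → ⟦⟧-no (toR? i j) λ (Oi , _) → Oi Ri)) z≤n
      by-cases (no Oi)  = ≤-trans (sum≤1 (λ j → ⟦ toR? i j ⟧) (λ j → ⟦⟧-≤1 (toR? i j)) λ j l pj pl →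
        let _ , Rj , ij = ⟦⟧-> (toR? i j) pj
            _ , Rl , il = ⟦⟧-> (toR? i l) pl
        in R-neighbour-unique ij il Rj Rl) (≤-reflexive (sym (⟦⟧-yes (O? i) Oi)))

    #clique #toR : ℕ
    #clique = ∑∑ λ i j → ⟦ Clique? O? i j ⟧
    #toR    = ∑∑ λ i j → ⟦ toR? i j ⟧

    #clique+#O : #clique + #O ≡ #O * #O
    #clique+#O = trans (sym (∑-distrib-+ (λ i → sum λ j → ⟦ Clique? O? i j ⟧) (λ i → ⟦ O? i ⟧)))
      (trans (sum-cong-≗ {n} (Clique-row O?)) (sym (*-distribʳ-sum {n} #O (λ i → ⟦ O? i ⟧))))

    #bound : ∑∑ bound ≡ #clique + (#toR + #toR)
    #bound = trans (∑∑-+ (λ i j → ⟦ Clique? O? i j ⟧) (λ i j → ⟦ toR? i j ⟧ + ⟦ toR? j i ⟧))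
      (cong (#clique +_) (trans (∑∑-+ (λ i j → ⟦ toR? i j ⟧) (λ i j → ⟦ toR? j i ⟧))
        (cong (#toR +_) (∑∑-transpose (λ i j → ⟦ toR? i j ⟧)))))

  -- The case of equality in both estimates. A failure of either clause makes the count strictly
  -- smaller.
  Complete : Set
  Complete = (∀ i j → Clique O i j → N i j) × (∀ i → O i → ∃[ j ] R j × N i j)

  fewer-or-complete : #N < #O + #O * #O ⊎ Complete
  fewer-or-complete with any? (λ i → any? λ j → Clique? O? i j ×-dec ¬? (N? i j))
  ... | yes (i , j , ij , ¬N) = inj₁ (<-≤-trans (∑∑-< N≤bound i j strict) total)
    where
    strict : ⟦ N? i j ⟧ < bound i j
    strict = subst₂ _<_ (sym (⟦⟧-no (N? i j) ¬N)) refl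
      (<-≤-trans (subst (0 <_) (sym (⟦⟧-yes (Clique? O? i j) ij)) (s≤s z≤n)) (m≤m+n _ _))
    total : ∑∑ bound ≤ #O + #O * #O
    total = begin
      ∑∑ bound                 ≡⟨ #bound ⟩
      #clique + (#toR + #toR)  ≤⟨ +-monoʳ-≤ #clique (+-mono-≤ (sum-≤ row-toR) (sum-≤ row-toR)) ⟩
      #clique + (#O + #O)      ≡⟨ +-assoc #clique #O #O ⟨
      #clique + #O + #O        ≡⟨ cong (_+ #O) #clique+#O ⟩
      #O * #O + #O             ≡⟨ +-comm _ #O ⟩
      #O + #O * #O             ∎
      where open ≤-Reasoning
  ... | no all-N with any? (λ i → O? i ×-dec ¬? (any? λ j → R? j ×-dec N? i j))
  ...   | no all-R = inj₂ ((λ i j ij → decidable-stable (N? i j) λ ¬N → all-N (i , j , ij , ¬N)) ,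
      λ i Oi → decidable-stable (any? λ j → R? j ×-dec N? i j) λ ¬R → all-R (i , Oi , ¬R))
  ...   | yes (i , Oi , ¬R) = inj₁ total
    where
    strict : sum (λ j → ⟦ toR? i j ⟧) < ⟦ O? i ⟧
    strict = subst₂ _<_ (sym (sum-zero λ j → ⟦⟧-no (toR? i j) λ (_ , Rj , ij) → ¬R (j , Rj , ij)))
      (sym (⟦⟧-yes (O? i) Oi)) (s≤s z≤n)
    fewer : #toR < #O
    fewer = sum-< row-toR i strict
    total : #N < #O + #O * #O
    total = begin-strict
      #N                       ≤⟨ ∑∑-≤ N≤bound ⟩
      ∑∑ bound                 ≡⟨ #bound ⟩
      #clique + (#toR + #toR)  <⟨ +-monoʳ-< #clique (+-mono-< fewer fewer) ⟩
      #clique + (#O + #O)      ≡⟨ +-assoc #clique #O #O ⟨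
      #clique + #O + #O        ≡⟨ cong (_+ #O) #clique+#O ⟩
      #O * #O + #O             ≡⟨ +-comm _ #O ⟩
      #O + #O * #O             ∎
      where open ≤-Reasoning

  -- The edge rs places the root in a part with more than one vertex. The neighbour `x` in `R` of
  -- any `i` in `O` has `i` in its subtree, hence also `s`, which equals `i` or is joined to it, and
  -- then `r`. So `x` is `r`, and all of `O` lies in one clique with `r`.
  complete⇒cliqueForest : Complete → ∀ {s} → N r s → CliqueForest G Core
  complete⇒cliqueForest (O-clique , O-toR) {s} rs = record
    { forest  = coreForest
    ; link    = link
    ; clique⁺ = λ ij → proj₁ (clique⁺ ij)
    ; up⁺     = λ ¬core → treeEdge (¬core ∘ inj₁)
    }
    where
    Os : O s
    Os Rs = R-isolated rR Rs rs
    O⇒Nr : ∀ {i} → O i → N i r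
    O⇒Nr {i} Oi with O-toR i Oi
    ... | x , Rx , ix = subst (N i) (⊒-root refl (stay Rx (N-sym rs) x⊒s)) ix
      where
      x⊒i : x ⊒ i
      x⊒i = stay Rx (N-sym ix) here
      x⊒s : x ⊒ s
      x⊒s with i ≟ s
      ... | yes refl = x⊒i
      ... | no i≢s   = stay Rx (O-clique i s (Oi , Os , i≢s)) x⊒i
    N⇒core : ∀ {i j} → N i j → Core i
    N⇒core {i} {j} ij with R? i | R? j
    ... | no Oi  | _      = inj₂ (Oi ∘ inj₂)
    ... | yes Ri | yes Rj = contradiction ij (R-isolated Ri Rj)
    ... | yes Ri | no Oj  = inj₁ (⊒-root refl (stay Ri (O⇒Nr Oj) (stay Ri ij here)))
    link : ∀ {i j} → Adj G i j → Clique Core i j ⊎ (CutUp i j ⊎ CutUp j i)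
    link {i} {j} ij with cut? i j
    ... | yes cut = inj₂ (cut⇒up cut)
    ... | no ¬cut = inj₁ (N⇒core (ij , ¬cut) , N⇒core (N-sym (ij , ¬cut)) , Adj⇒≢ G ij)
    clique⁺ : ∀ {i j} → Clique Core i j → N i j
    clique⁺ {i} {j} (ci , cj , i≢j) with i ≟ r | j ≟ r
    ... | yes refl | yes refl = contradiction refl i≢j
    ... | yes refl | no j≢r   = N-sym (O⇒Nr [ j≢r , [ (λ e → contradiction e j≢r) , id ]′ cj ]′)
    ... | no i≢r   | yes refl = O⇒Nr [ i≢r , [ (λ e → contradiction e i≢r) , id ]′ ci ]′
    ... | no i≢r   | no j≢r   = O-clique i j
      ([ i≢r , [ (λ e → contradiction e i≢r) , id ]′ ci ]′ , [ j≢r , [ (λ e → contradiction e j≢r) , id ]′ cj ]′ , i≢j)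

  -- A part with exactly two vertices would be joined by a cut edge.
  #O≢1 : #O ≢ 1
  #O≢1 #O≡1 = ¬cut (separated⇒cutEdge G (treeEdge x≢r) {x ⊒_} (x ⊒?_) here (⋣-up x≢r) only)
    where
    unique = sum≡1⇒ (λ y → ⟦ O? y ⟧) #O≡1
    x = proj₁ unique
    Ox : O x
    Ox = ⟦⟧-> (O? x) (≤-reflexive (sym (proj₁ (proj₂ unique))))
    x≢r : x ≢ r
    x≢r = Ox ∘ inj₁
    ¬cut : ¬ Cut x (up x)
    ¬cut = Ox ∘ inj₂
    others-R : ∀ {y} → y ≢ x → R y
    others-R {y} y≢x = decidable-stable (R? y) λ Oy →
      case trans (sym (⟦⟧-yes (O? y) Oy)) (proj₂ (proj₂ unique) y y≢x) of λ ()
    N-up : N x (up x)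
    N-up = treeEdge x≢r , ¬cut
    only : ∀ a b → Adj G a b → x ⊒ a → ¬ (x ⊒ b) → SameEdge a b x (up x)
    only a b ab x⊒a x⋣b with cut? a b
    ... | yes cut with cut⇒up cut
    ...   | inj₂ (¬core , refl) = contradiction (above (¬core ∘ inj₁) x⊒a) x⋣b
    ...   | inj₁ (¬core , refl) with x ≟ a
    ...     | yes refl = contradiction (inj₂ ¬cut) ¬core
    ...     | no x≢a   = contradiction (⊒-up x≢a x⊒a) x⋣b
    only a b ab x⊒a x⋣b | no ¬c with a ≟ x | b ≟ x
    ... | _        | yes refl = contradiction here x⋣b
    ... | no a≢x   | no b≢x   = contradiction (ab , ¬c) (R-isolated (others-R a≢x) (others-R b≢x))
    ... | yes refl | no b≢x   = inj₁ (refl , R-neighbour-unique (ab , ¬c) N-up (others-R b≢x) (others-R (up≢ x≢r)))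

  tree⇒cliqueForest : #O ≡ 0 → CliqueForest G (_≡ r)
  tree⇒cliqueForest #O≡0 = record
    { forest  = rooted
    ; link    = λ ij → inj₂ (Sum.map weaken weaken (cut⇒up (all-cut ij)))
    ; clique⁺ = λ { (refl , refl , ne) → contradiction refl ne }
    ; up⁺     = treeEdge
    }
    where
    all-R : ∀ x → R x
    all-R x = decidable-stable (R? x) λ Ox →
      case trans (sym (⟦⟧-yes (O? x) Ox)) (sum≡0⇒ (λ y → ⟦ O? y ⟧) #O≡0 x) of λ ()
    all-cut : ∀ {i j} → Adj G i j → Cut i j
    all-cut {i} {j} ij = decidable-stable (cut? i j) λ ¬cut → R-isolated (all-R i) (all-R j) (ij , ¬cut)
    weaken : ∀ {i j} → CutUp i j → Up i j
    weaken (¬core , e) = ¬core ∘ inj₁ , e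

  #O-from-size : ∀ {o} → n ≡ k + (1 + o) → #O ≡ o
  #O-from-size {o} n≡ = +-cancelˡ-≡ (k + 1) _ _ (begin
    k + 1 + #O                                  ≡⟨ +-assoc k 1 #O ⟩
    k + (1 + #O)                                ≡⟨ +-comm k _ ⟩
    1 + #O + k                                  ≡⟨ cong₂ _+_ roots≡ nonroots≡k ⟨
    roots coreForest + nonroots coreForest      ≡⟨ trans (roots+nonroots coreForest) n≡ ⟩
    k + (1 + o)                                 ≡⟨ +-assoc k 1 o ⟨
    k + 1 + o                                   ∎)
    where open ≡-Reasoning

PairCore : ∀ {n} → Fin n → Fin n → Fin n → Set
PairCore r s x = x ≡ r ⊎ x ≡ s

module _ {n} {G : Graph n} {r : Fin n} (F : CliqueForest G (_≡ r)) (s : Fin n) (rs : Adj G r s) where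
  open CliqueForest F

  -- As `s` is a child of `r`, making it a second root turns only its own parent edge into a clique
  -- edge. The tree thereby gets a core of size 2 + b with b = 0, to which the moment formulas
  -- apply.
  edgeCliqueForest : CliqueForest G (PairCore r s)
  edgeCliqueForest = record
    { forest  = record { root? = λ x → root? x ⊎-dec (x ≟ s) ; up = up ; height = height
                       ; descends = λ ¬C → descends (¬C ∘ inj₁) }
    ; link    = widen
    ; clique⁺ = clique
    ; up⁺     = λ ¬C → up⁺ (¬C ∘ inj₁)
    }
    where
    C : Fin n → Set
    C = PairCore r s
    r≡up-s : r ≡ up s
    r≡up-s with link rs
    ... | inj₁ (_ , s≡r , r≢s)     = contradiction (sym s≡r) r≢s
    ... | inj₂ (inj₁ (r≢r , _))    = contradiction refl r≢r
    ... | inj₂ (inj₂ (_ , e))      = e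
    one-way : ∀ {i j} → Up i j → (C i × C j) ⊎ ¬ C i × j ≡ up i
    one-way {i} (i≢r , refl) with i ≟ s
    ... | yes refl = inj₁ (inj₂ refl , inj₁ (sym r≡up-s))
    ... | no i≢s   = inj₂ ([ i≢r , i≢s ]′ , refl)
    widen : ∀ {i j} → Adj G i j → Clique C i j ⊎ ((¬ C i × j ≡ up i) ⊎ (¬ C j × i ≡ up j))
    widen ij with link ij
    ... | inj₁ (ci , cj , ne)  = inj₁ (inj₁ ci , inj₁ cj , ne)
    ... | inj₂ (inj₁ i↑j)      = Sum.map (λ (ci , cj) → ci , cj , Adj⇒≢ G ij) inj₁ (one-way i↑j)
    ... | inj₂ (inj₂ j↑i)      = Sum.map (λ (cj , ci) → ci , cj , Adj⇒≢ G ij) inj₂ (one-way j↑i)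
    clique : ∀ {i j} → Clique C i j → Adj G i j
    clique (inj₁ refl , inj₁ refl , ne) = contradiction refl ne
    clique (inj₁ refl , inj₂ refl , _)  = rs
    clique (inj₂ refl , inj₁ refl , _)  = Adj-sym G rs
    clique (inj₂ refl , inj₂ refl , ne) = contradiction refl ne

  edgeCliqueForest-roots : roots (CliqueForest.forest edgeCliqueForest) ≡ 2
  edgeCliqueForest-roots = begin
    sum (λ x → ⟦ root? x ⊎-dec (x ≟ s) ⟧)
      ≡⟨ sum-cong-≗ {n} (λ x → ⟦⟧-⊎ (root? x ⊎-dec (x ≟ s)) (r ≟ x) (s ≟ x) (Sum.map sym sym)
           (inj₁ ∘ sym) (inj₂ ∘ sym) λ { refl e → Adj⇒≢ G rs (sym e) }) ⟩
    sum (λ x → ⟦ r ≟ x ⟧ + ⟦ s ≟ x ⟧)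
      ≡⟨ ∑-distrib-+ (λ x → ⟦ r ≟ x ⟧) (λ x → ⟦ s ≟ x ⟧) ⟩
    sum (λ x → ⟦ r ≟ x ⟧) + sum (λ x → ⟦ s ≟ x ⟧)
      ≡⟨ cong₂ _+_ (sum-point r) (sum-point s) ⟩
    2 ∎
    where open ≡-Reasoning

decidedCuts×spanningTree : ∀ {n k} (G : Graph n) → 𝒢 n k G → ∀ r →
  Σ[ cut? ∈ (∀ i j → Dec (IsCutEdge G i j)) ] (∑∑ (λ i j → ⟦ cut? i j ⟧) ≡ k + k) × SpanningTree G r
decidedCuts×spanningTree G (connected , count) r =
  cutEdgeCount⇒cut? G count , cutEdgeCount⇒∑∑ G (cutEdgeCount⇒cut? G count) count , connected⇒spanningTree G connected r

-- Since n = k + 1 + `#O`, the value k = n - 2 would mean a single vertex in `O`.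
no-two-vertex-part : ∀ {n k} (G : Graph n) → 𝒢 n k G → Fin n → n ≢ k + 2
no-two-vertex-part {k = k} G G∈𝒢 r n≡ =
  let cut? , #cut , tree = decidedCuts×spanningTree G G∈𝒢 r
      open RootedAt {k = k} G cut? #cut tree
  in #O≢1 (#O-from-size n≡)

tree⇒rootedCliqueForest : ∀ {n k} (G : Graph n) → 𝒢 n k G → n ≡ k + 1 → ∀ r → CliqueForest G (_≡ r)
tree⇒rootedCliqueForest {k = k} G G∈𝒢 n≡ r =
  let cut? , #cut , tree = decidedCuts×spanningTree G G∈𝒢 r
      open RootedAt {k = k} G cut? #cut tree
  in tree⇒cliqueForest (#O-from-size n≡)

-- The bound is the second moment of a clique on 2 + b vertices with `k` hanging vertices. If every
-- edge is cut, the moment is only 2k; otherwise the spanning tree is rooted at an end of an uncut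
-- edge, as the extremal case requires.
fewer-edges-or-cliqueForest : ∀ {n k b} (G : Graph n) → 𝒢 n k G → Fin n → n ≡ k + (2 + b) →
  closedWalks G 2 < n + (2 + b) * b + k ⊎ Σ[ C ∈ (Fin n → Set) ] Σ[ F ∈ CliqueForest G C ] roots (CliqueForest.forest F) ≡ 2 + b
fewer-edges-or-cliqueForest {n} {k} {b} G G∈𝒢 r₀ n≡ = from-cuts
  (cutEdgeCount⇒cut? G (proj₂ G∈𝒢)) (cutEdgeCount⇒∑∑ G (cutEdgeCount⇒cut? G (proj₂ G∈𝒢)) (proj₂ G∈𝒢))
  where
  Goal : Set₁
  Goal = closedWalks G 2 < n + (2 + b) * b + k ⊎ Σ[ C ∈ (Fin n → Set) ] Σ[ F ∈ CliqueForest G C ] roots (CliqueForest.forest F) ≡ 2 + b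

  from-cuts : (cut? : ∀ i j → Dec (IsCutEdge G i j)) → ∑∑ (λ i j → ⟦ cut? i j ⟧) ≡ k + k → Goal
  from-cuts cut? #cut with any? (λ r → any? λ s → adj? G r s ×-dec ¬? (cut? r s))
  ... | no none = inj₁ (begin-strict
    closedWalks G 2            ≡⟨ closedWalks₂≡N ⟩
    #N + (k + k)               ≡⟨ cong (_+ (k + k)) (sum-zero λ i → sum-zero λ j → ⟦⟧-no (N? i j) λ ij → none (i , j , ij)) ⟩
    k + k                      <⟨ +-monoˡ-< k (m<m+n k {2 + b} (s≤s z≤n)) ⟩
    k + (2 + b) + k            ≡⟨ cong (_+ k) n≡ ⟨
    n + k                      ≤⟨ +-monoˡ-≤ k (m≤m+n n _) ⟩
    n + (2 + b) * b + k        ∎)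
    where
    open ≤-Reasoning
    open RootedAt {k = k} G cut? #cut (connected⇒spanningTree G (proj₁ G∈𝒢) r₀)
  ... | yes (r , s , rs) = from-part fewer-or-complete
    where
    open RootedAt {k = k} G cut? #cut (connected⇒spanningTree G (proj₁ G∈𝒢) r)
    #O≡ : #O ≡ 1 + b
    #O≡ = #O-from-size n≡
    from-part : #N < #O + #O * #O ⊎ Complete → Goal
    from-part (inj₂ complete) = inj₂ (Core , complete⇒cliqueForest complete rs , trans roots≡ (cong suc #O≡))
    from-part (inj₁ fewer) = inj₁ (begin-strict
      closedWalks G 2                              ≡⟨ closedWalks₂≡N ⟩
      #N + (k + k)                                 <⟨ +-monoˡ-< (k + k) fewer ⟩
      #O + #O * #O + (k + k)                       ≡⟨ cong (λ o → o + o * o + (k + k)) #O≡ ⟩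
      (1 + b) + (1 + b) * (1 + b) + (k + k)        ≡⟨ solve 2 (λ b k → (con 1 :+ b) :+ (con 1 :+ b) :* (con 1 :+ b) :+ (k :+ k) :=
                                                         k :+ (con 2 :+ b) :+ (con 2 :+ b) :* b :+ k) refl b k ⟩
      k + (2 + b) + (2 + b) * b + k                ≡⟨ cong (λ n → n + (2 + b) * b + k) n≡ ⟨
      n + (2 + b) * b + k                          ∎)
      where open ≤-Reasoning

-- Brooms

-- Vertex `zero` is matched with some `j` of the same label. Removing both leaves labellings whose
-- label counts still agree.
relabelling : ∀ {n m} (f g : Fin n → Fin m) →
  (∀ l → sum (λ x → ⟦ f x ≟ l ⟧) ≡ sum (λ x → ⟦ g x ≟ l ⟧)) →
  Σ[ π ∈ Permutation′ n ] (∀ x → g (π ⟨$⟩ʳ x) ≡ f x)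
relabelling {zero}  f g same = Perm.id , λ ()
relabelling {suc n} f g same = insert zero j (proj₁ rest) , λ where
    zero    → gj
    (suc x) → trans (cong g (insert-punchIn zero j (proj₁ rest) x)) (proj₂ rest x)
  where
  found : ∃[ j ] 0 < ⟦ g j ≟ f zero ⟧
  found = sum>0⇒ (λ x → ⟦ g x ≟ f zero ⟧) (subst (0 <_) (same (f zero))
    (≤-trans (≤-reflexive (sym (⟦⟧-yes (f zero ≟ f zero) refl))) (m≤m+n _ _)))
  j  = proj₁ found
  gj : g j ≡ f zero
  gj = ⟦⟧-> (g j ≟ f zero) (proj₂ found)
  rest = relabelling (f ∘ suc) (g ∘ Fin.punchIn j) λ l → +-cancelˡ-≡ ⟦ g j ≟ l ⟧ _ _ (trans
    (cong (λ y → ⟦ y ≟ l ⟧ + sum (λ x → ⟦ f (suc x) ≟ l ⟧)) gj)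
    (trans (same l) (sum-remove {i = j} (λ x → ⟦ g x ≟ l ⟧))))

two-point-sum : ∀ {n} (f : Fin n → ℕ) {u v} → u ≢ v → (∀ i → i ≢ u → i ≢ v → f i ≡ 0) → sum f ≡ f u + f v
two-point-sum {n} f {u} {v} u≢v rest = begin
  sum f
    ≡⟨ sum-cong-≗ {n} pointwise ⟩
  sum (λ i → ⟦ u ≟ i ⟧ * f i + ⟦ v ≟ i ⟧ * f i)
    ≡⟨ ∑-distrib-+ (λ i → ⟦ u ≟ i ⟧ * f i) (λ i → ⟦ v ≟ i ⟧ * f i) ⟩
  sum (λ i → ⟦ u ≟ i ⟧ * f i) + sum (λ i → ⟦ v ≟ i ⟧ * f i)
    ≡⟨ cong₂ _+_ (sum-δ u f) (sum-δ v f) ⟩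
  f u + f v ∎
  where
  open ≡-Reasoning
  pointwise : ∀ i → f i ≡ ⟦ u ≟ i ⟧ * f i + ⟦ v ≟ i ⟧ * f i
  pointwise i with u ≟ i | v ≟ i
  ... | yes refl | yes refl = contradiction refl u≢v
  ... | yes refl | no _     = sym (trans (+-identityʳ _) (+-identityʳ _))
  ... | no _     | yes refl = sym (+-identityʳ _)
  ... | no u≢i   | no v≢i   = rest i (u≢i ∘ sym) (v≢i ∘ sym)

module _ {n} {G : Graph n} {C : Fin n → Set} (F : CliqueForest G C) where
  open CliqueForest F

  parent-has-child : ∀ {x} → ¬ C x → 0 < children forest (up x)
  parent-has-child {x} ¬Cx = ≤-trans (≤-reflexive (sym (⟦⟧-yes (up? x (up x)) (¬Cx , refl))))
    (term≤sum (λ z → ⟦ up? z (up x) ⟧) x)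

  -- K_n^k is a broom with t = 0 and the second last graph a broom with t = 1.
  record Broom (t : ℕ) : Set where
    field
      hub fork      : Fin n
      hub≢fork      : hub ≢ fork
      C-hub         : C hub
      C-fork        : C fork
      attached      : ∀ {x} → ¬ C x → up x ≡ hub ⊎ up x ≡ fork
      fork-children : children forest fork ≡ t

  broom-from-children : ∀ {hub fork t} → hub ≢ fork → C hub → C fork → children forest fork ≡ t →
    (∀ i → i ≢ hub → i ≢ fork → children forest i ≡ 0) → Broom t
  broom-from-children {hub} {fork} hub≢fork Chub Cfork eq rest = record
    { hub = hub ; fork = fork ; hub≢fork = hub≢fork ; C-hub = Chub ; C-fork = Cfork
    ; attached = attached ; fork-children = eq }
    where
    attached : ∀ {x} → ¬ C x → up x ≡ hub ⊎ up x ≡ fork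
    attached {x} ¬Cx with up x ≟ hub | up x ≟ fork
    ... | yes e | _     = inj₁ e
    ... | no _  | yes e = inj₂ e
    ... | no ne | no nf = contradiction (rest (up x) ne nf) (λ z → <⇒≢ (parent-has-child ¬Cx) (sym z))

  module BroomProperties {t} (B : Broom t) {b} (roots≡ : roots forest ≡ 2 + b) where
    open Broom B

    no-other-children : ∀ i → i ≢ hub → i ≢ fork → children forest i ≡ 0
    no-other-children i i≢hub i≢fork = sum-zero λ x → ⟦⟧-no (up? x i) λ { (¬Cx , refl) → [ i≢hub , i≢fork ]′ (attached ¬Cx) }

    hub+fork : children forest hub + t ≡ nonroots forest
    hub+fork = begin
      children forest hub + t                      ≡⟨ cong (children forest hub +_) fork-children ⟨
      children forest hub + children forest fork   ≡⟨ two-point-sum (children forest) hub≢fork no-other-children ⟨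
      sum (children forest)                        ≡⟨ ∑-children forest ⟩
      nonroots forest                              ∎
      where open ≡-Reasoning

    open CliqueForestMoments F roots≡ using (weight)

    broom-weight : ∀ {s} → s + t ≡ nonroots forest → sum weight ≡ s * s + t * t + 2 * b * (s + t)
    broom-weight {s} s+t = begin
      sum weight
        ≡⟨ two-point-sum weight hub≢fork (λ i p q → zero-weight i (no-other-children i p q)) ⟩
      weight hub + weight fork
        ≡⟨ cong₂ _+_ (root-weight hub C-hub (+-cancelʳ-≡ t _ _ (trans hub+fork (sym s+t)))) (root-weight fork C-fork fork-children) ⟩
      s * s + 2 * b * s + (t * t + 2 * b * t)
        ≡⟨ solve 3 (λ s t b → s :* s :+ con 2 :* b :* s :+ (t :* t :+ con 2 :* b :* t) :=
             s :* s :+ t :* t :+ con 2 :* b :* (s :+ t)) refl s t b ⟩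
      s * s + t * t + 2 * b * (s + t) ∎
      where
      open ≡-Reasoning
      root-weight : ∀ i → C i → ∀ {x} → children forest i ≡ x → weight i ≡ x * x + 2 * b * x
      root-weight i Ci {x} ci = cong₂ (λ c e → c * c + 2 * b * e) ci
        (trans (cong₂ _*_ (⟦⟧-yes (root? i) Ci) ci) (+-identityʳ x))
      zero-weight : ∀ i → children forest i ≡ 0 → weight i ≡ 0
      zero-weight i ci = cong₂ (λ c e → c * c + e) ci
        (trans (cong (2 * b *_) (trans (cong (⟦ root? i ⟧ *_) ci) (*-zeroʳ ⟦ root? i ⟧))) (*-zeroʳ (2 * b)))

    -- Whether two distinct vertices of a broom are adjacent depends only on their kinds, so a
    -- bijection that preserves kinds is an isomorphism.
    Kind : Fin 5 → Fin n → Set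
    Kind 0F x = x ≡ hub
    Kind 1F x = x ≡ fork
    Kind 2F x = C x × x ≢ hub × x ≢ fork
    Kind 3F x = Up x hub
    Kind 4F x = Up x fork

    label : Fin n → Fin 5
    label x = if does (root? x)
      then (if does (x ≟ hub) then 0F else if does (x ≟ fork) then 1F else 2F)
      else (if does (up x ≟ hub) then 3F else 4F)

    kind⇒label : ∀ l {x} → Kind l x → label x ≡ l
    kind⇒label 0F refl rewrite dec-true (root? hub) C-hub | dec-true (hub ≟ hub) refl = refl
    kind⇒label 1F refl rewrite dec-true (root? fork) C-fork | dec-false (fork ≟ hub) (hub≢fork ∘ sym)
      | dec-true (fork ≟ fork) refl = refl
    kind⇒label 2F {x} (Cx , x≢hub , x≢fork) rewrite dec-true (root? x) Cx | dec-false (x ≟ hub) x≢hub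
      | dec-false (x ≟ fork) x≢fork = refl
    kind⇒label 3F {x} (¬Cx , e) rewrite dec-false (root? x) ¬Cx | dec-true (up x ≟ hub) (sym e) = refl
    kind⇒label 4F {x} (¬Cx , e) rewrite dec-false (root? x) ¬Cx | dec-false (up x ≟ hub) (λ e′ → hub≢fork (trans (sym e′) (sym e))) = refl

    kind : ∀ x → ∃[ l ] Kind l x
    kind x with root? x | x ≟ hub | x ≟ fork
    ... | yes _  | yes e | _     = 0F , e
    ... | yes _  | no _  | yes e = 1F , e
    ... | yes Cx | no ne | no nf = 2F , Cx , ne , nf
    ... | no ¬Cx | _     | _     = [ (λ e → 3F , ¬Cx , sym e) , (λ e → 4F , ¬Cx , sym e) ]′ (attached ¬Cx)

    label⇒kind : ∀ {l x} → label x ≡ l → Kind l x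
    label⇒kind {x = x} refl = let l , K = kind x in subst (λ l → Kind l x) (sym (kind⇒label l K)) K

    #label : Fin 5 → ℕ
    #label 0F = 1
    #label 1F = 1
    #label 2F = b
    #label 3F = children forest hub
    #label 4F = t

    ∑-label : ∀ l → sum (λ x → ⟦ label x ≟ l ⟧) ≡ #label l
    ∑-label 0F = trans (sum-cong-≗ {n} λ x → ⟦⟧-cong (label x ≟ 0F) (hub ≟ x) (sym ∘ label⇒kind) (kind⇒label 0F ∘ sym)) (sum-point hub)
    ∑-label 1F = trans (sum-cong-≗ {n} λ x → ⟦⟧-cong (label x ≟ 1F) (fork ≟ x) (sym ∘ label⇒kind) (kind⇒label 1F ∘ sym)) (sum-point fork)
    ∑-label 3F = sum-cong-≗ {n} λ x → ⟦⟧-cong (label x ≟ 3F) (up? x hub) label⇒kind (kind⇒label 3F)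
    ∑-label 4F = trans (sum-cong-≗ {n} λ x → ⟦⟧-cong (label x ≟ 4F) (up? x fork) label⇒kind (kind⇒label 4F)) fork-children
    ∑-label 2F = +-cancelʳ-≡ 2 _ _ (begin
      sum (λ x → ⟦ label x ≟ 2F ⟧) + 2
        ≡⟨ cong₂ (λ p q → sum (λ x → ⟦ label x ≟ 2F ⟧) + (p + q)) (∑-label 0F) (∑-label 1F) ⟨
      sum (λ x → ⟦ label x ≟ 2F ⟧) + (sum (λ x → ⟦ label x ≟ 0F ⟧) + sum (λ x → ⟦ label x ≟ 1F ⟧))
        ≡⟨ trans (∑-distrib-+ (λ x → ⟦ label x ≟ 2F ⟧) (λ x → ⟦ label x ≟ 0F ⟧ + ⟦ label x ≟ 1F ⟧))
             (cong (sum (λ x → ⟦ label x ≟ 2F ⟧) +_) (∑-distrib-+ (λ x → ⟦ label x ≟ 0F ⟧) (λ x → ⟦ label x ≟ 1F ⟧))) ⟨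
      sum (λ x → ⟦ label x ≟ 2F ⟧ + (⟦ label x ≟ 0F ⟧ + ⟦ label x ≟ 1F ⟧))
        ≡⟨ sum-cong-≗ {n} pointwise ⟩
      roots forest
        ≡⟨ trans roots≡ (+-comm 2 b) ⟩
      b + 2 ∎)
      where
      open ≡-Reasoning
      pointwise : ∀ x → ⟦ label x ≟ 2F ⟧ + (⟦ label x ≟ 0F ⟧ + ⟦ label x ≟ 1F ⟧) ≡ ⟦ root? x ⟧
      pointwise x with kind x
      ... | 0F , refl rewrite kind⇒label 0F refl = sym (⟦⟧-yes (root? hub) C-hub)
      ... | 1F , refl rewrite kind⇒label 1F refl = sym (⟦⟧-yes (root? fork) C-fork)
      ... | 2F , K@(Cx , _) rewrite kind⇒label 2F K = sym (⟦⟧-yes (root? x) Cx)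
      ... | 3F , K@(¬Cx , _) rewrite kind⇒label 3F K = sym (⟦⟧-no (root? x) ¬Cx)
      ... | 4F , K@(¬Cx , _) rewrite kind⇒label 4F K = sym (⟦⟧-no (root? x) ¬Cx)

module _ {n} {G G′ : Graph n} {C C′ : Fin n → Set} (F : CliqueForest G C) (F′ : CliqueForest G′ C′)
         {t} (B : Broom F t) (B′ : Broom F′ t) {b}
         (roots≡ : roots (CliqueForest.forest F) ≡ 2 + b) (roots≡′ : roots (CliqueForest.forest F′) ≡ 2 + b) where
  private
    module F  = CliqueForest F
    module F′ = CliqueForest F′
    module B  = BroomProperties F B roots≡
    module B′ = BroomProperties F′ B′ roots≡′

  label-preserving⇒Adj : (f : Fin n → Fin n) → (∀ {x y} → f x ≡ f y → x ≡ y) →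
    (∀ x → B′.label (f x) ≡ B.label x) → ∀ {i j} → Adj G i j → Adj G′ (f i) (f j)
  label-preserving⇒Adj f injective preserves {i} {j} ij with F.link ij
  ... | inj₁ (Ci , Cj , i≢j) = F′.clique⁺ (C-preserved Ci , C-preserved Cj , i≢j ∘ injective)
    where
    C-preserved : ∀ {x} → C x → C′ (f x)
    C-preserved {x} Cx with B.kind x
    ... | 0F , K = subst C′ (sym (B′.label⇒kind {0F} (trans (preserves x) (B.kind⇒label 0F K)))) (Broom.C-hub B′)
    ... | 1F , K = subst C′ (sym (B′.label⇒kind {1F} (trans (preserves x) (B.kind⇒label 1F K)))) (Broom.C-fork B′)
    ... | 2F , K = proj₁ (B′.label⇒kind {2F} (trans (preserves x) (B.kind⇒label 2F K)))
    ... | 3F , ¬Cx , _ = contradiction Cx ¬Cx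
    ... | 4F , ¬Cx , _ = contradiction Cx ¬Cx
  ... | inj₂ ud = [ upward , Adj-sym G′ ∘ upward ]′ ud
    where
    transfer : ∀ l {x} → B.Kind l x → B′.Kind l (f x)
    transfer l {x} K = B′.label⇒kind (trans (preserves x) (B.kind⇒label l K))
    Up⇒Adj : ∀ {x y z} → F′.Up x z → y ≡ z → Adj G′ x y
    Up⇒Adj (¬C′x , refl) refl = F′.up⁺ ¬C′x
    upward : ∀ {x y} → F.Up x y → Adj G′ (f x) (f y)
    upward {x} {y} (¬Cx , refl) with Broom.attached B ¬Cx
    ... | inj₁ e = Up⇒Adj (transfer 3F (¬Cx , sym e)) (transfer 0F e)
    ... | inj₂ e = Up⇒Adj (transfer 4F (¬Cx , sym e)) (transfer 1F e)

module _ {n} {G G′ : Graph n} {C C′ : Fin n → Set} (F : CliqueForest G C) (F′ : CliqueForest G′ C′) {b}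
         (roots≡ : roots (CliqueForest.forest F) ≡ 2 + b) (roots≡′ : roots (CliqueForest.forest F′) ≡ 2 + b) where
  private
    module F  = CliqueForest F
    module F′ = CliqueForest F′

  nonroots-equal : nonroots F.forest ≡ nonroots F′.forest
  nonroots-equal = +-cancelˡ-≡ (2 + b) _ _ (begin
    2 + b + nonroots F.forest             ≡⟨ cong (_+ nonroots F.forest) roots≡ ⟨
    roots F.forest + nonroots F.forest    ≡⟨ roots+nonroots F.forest ⟩
    n                                     ≡⟨ roots+nonroots F′.forest ⟨
    roots F′.forest + nonroots F′.forest  ≡⟨ cong (_+ nonroots F′.forest) roots≡′ ⟩
    2 + b + nonroots F′.forest            ∎)
    where open ≡-Reasoning

  brooms-isomorphic : ∀ {t} → Broom F t → Broom F′ t → G ≅ G′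
  brooms-isomorphic {t} B B′ = π , λ i j → T-ext (forward i j)
    λ a → subst₂ (Adj G) (inverseˡ π) (inverseˡ π) (backward (π ⟨$⟩ʳ i) (π ⟨$⟩ʳ j) a)
    where
    module B  = BroomProperties F B roots≡
    module B′ = BroomProperties F′ B′ roots≡′
    same-size : ∀ l → B.#label l ≡ B′.#label l
    same-size 0F = refl
    same-size 1F = refl
    same-size 2F = refl
    same-size 3F = +-cancelʳ-≡ t _ _ (trans B.hub+fork (trans nonroots-equal (sym B′.hub+fork)))
    same-size 4F = refl
    relabel = relabelling B.label B′.label λ l → trans (B.∑-label l) (trans (same-size l) (sym (B′.∑-label l)))
    π = proj₁ relabel
    forward : ∀ i j → Adj G i j → Adj G′ (π ⟨$⟩ʳ i) (π ⟨$⟩ʳ j)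
    forward i j = label-preserving⇒Adj F F′ B B′ roots≡ roots≡′ (π ⟨$⟩ʳ_)
      (λ e → trans (sym (inverseˡ π)) (trans (cong (π ⟨$⟩ˡ_) e) (inverseˡ π))) (proj₂ relabel)
    backward : ∀ i j → Adj G′ i j → Adj G (π ⟨$⟩ˡ i) (π ⟨$⟩ˡ j)
    backward i j = label-preserving⇒Adj F′ F B′ B roots≡′ roots≡ (π ⟨$⟩ˡ_)
      (λ e → trans (sym (inverseʳ π)) (trans (cong (π ⟨$⟩ʳ_) e) (inverseʳ π)))
      (λ x → trans (sym (proj₂ relabel (π ⟨$⟩ˡ x))) (cong B′.label (inverseʳ π)))

  private
    module M  = CliqueForestMoments F roots≡
    module M′ = CliqueForestMoments F′ roots≡′

  closedWalks-equal : ∀ i → i < 4 → closedWalks G i ≡ closedWalks G′ i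
  closedWalks-equal 0 _ = refl
  closedWalks-equal 1 _ = trans (closedWalks₁ G) (sym (closedWalks₁ G′))
  closedWalks-equal 2 _ = trans M.closedWalks₂≡ (trans (cong (n + (2 + b) * b +_) nonroots-equal) (sym M′.closedWalks₂≡))
  closedWalks-equal 3 _ = trans M.closedWalks₃≡ (sym M′.closedWalks₃≡)
  closedWalks-equal (suc (suc (suc (suc _)))) (s≤s (s≤s (s≤s (s≤s ()))))

  weight<⇒closedWalks₄< : sum M.weight < sum M′.weight → closedWalks G 4 < closedWalks G′ 4
  weight<⇒closedWalks₄< lt = +-cancelʳ-< _ _ _ (+-cancelʳ-< _ _ _ (subst₂ _<_ (sym M.closedWalks₄≡)
    (sym (trans (cong (λ k → closedWalks G′ 4 + (n + (2 + b) * b + k) + (2 + b) * (1 + b) * b) nonroots-equal) M′.closedWalks₄≡))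
    (+-monoˡ-< _ (*-monoʳ-< 2 (subst (λ k → n + (2 + b) * (b * (2 + b)) + 2 * k + sum M.weight < n + (2 + b) * (b * (2 + b)) + 2 * nonroots F′.forest + sum M′.weight)
      (sym nonroots-equal) (+-monoʳ-< _ lt))))))

-- Child distributions

-- The value of `broom-weight` for t = 1 and 2 + m nonroots, left in the shape s * s + t * t + 2 * b
-- * (s + t) with s = 1 + m.
broomWeight : ℕ → ℕ → ℕ
broomWeight b m = (1 + m) * (1 + m) + 1 * 1 + 2 * b * (1 + m + 1)

module _ {n} {G : Graph n} {C : Fin n → Set} (F : CliqueForest G C) {b}
         (roots≡ : roots (CliqueForest.forest F) ≡ 2 + b) where
  open CliqueForest F
  private
    c : Fin n → ℕ
    c = children forest

  open CliqueForestMoments F roots≡ using (weight)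

  -- Outside `C`, `v` would have a parent different from itself that also has a child. As there are
  -- at least two roots, a second one is available as the childless fork.
  star⇒broom : ∀ {v} → (∀ i → i ≢ v → c i ≡ 0) → Broom F 0
  star⇒broom {v} rest = broom-from-children F v≢u Cv Cu (rest u (v≢u ∘ sym)) (λ i i≢v _ → rest i i≢v)
    where
    has-child⇒v : ∀ {i} → 0 < c i → i ≡ v
    has-child⇒v {i} pos = decidable-stable (i ≟ v) λ i≢v → <⇒≢ pos (sym (rest i i≢v))
    Cv : C v
    Cv = decidable-stable (root? v) λ ¬Cv → up≢ ¬Cv (has-child⇒v (parent-has-child F ¬Cv))
    second : ∃[ u ] C u × v ≢ u
    second = decidable-stable (any? λ u → root? u ×-dec ¬? (v ≟ u)) λ none → <⇒≱ (s≤s (s≤s z≤n))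
      (≤-trans (≤-reflexive (sym roots≡)) (≤-trans
        (sum-≤ λ u → ⟦⟧-≤ (root? u) (v ≟ u) λ Cu → decidable-stable (v ≟ u) λ v≢u → none (u , Cu , v≢u))
        (≤-reflexive (sum-point v))))
    u = proj₁ second
    Cu = proj₁ (proj₂ second)
    v≢u = proj₂ (proj₂ second)

  -- The children numbers of the second last graph, with no claim that the two parents lie in `C`.
  record NearStar (m : ℕ) : Set where
    field
      {big small} : Fin n
      big≢small   : big ≢ small
      big≡        : c big ≡ 1 + m
      small≡      : c small ≡ 1
      rest        : ∀ i → i ≢ big → i ≢ small → c i ≡ 0

  -- There are 2 + m children in all; the cases are a vertex with all of them, a vertex with all but
  -- one, and at most `m` at every vertex.
  child-distribution : ∀ {m} → nonroots forest ≡ 2 + m → Broom F 0 ⊎ (NearStar m ⊎ (∀ i → c i ≤ m))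
  child-distribution {m} nonroots≡ with any? (λ v → c v ℕ.≟ 2 + m) | any? (λ v → c v ℕ.≟ 1 + m)
  ... | yes (v , cv) | _ = inj₁ (star⇒broom {v} λ i i≢v → n≤0⇒n≡0 (+-cancelˡ-≤ (c v) _ _ (begin
      c v + c i  ≤⟨ two-terms≤sum c (i≢v ∘ sym) ⟩
      sum c      ≡⟨ trans (∑-children forest) (trans nonroots≡ (sym cv)) ⟩
      c v        ≡⟨ +-identityʳ (c v) ⟨
      c v + 0    ∎)))
    where open ≤-Reasoning
  ... | no _ | yes (v , cv) = inj₂ (inj₁ (record { big≢small = v≢u ; big≡ = cv ; small≡ = cu ; rest = rest }))
    where
    others : Fin n → ℕ
    others i = ⟦ ¬? (v ≟ i) ⟧ * c i
    others-≢ : ∀ {i} → v ≢ i → others i ≡ c i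
    others-≢ {i} v≢i = trans (cong (_* c i) (⟦⟧-yes (¬? (v ≟ i)) v≢i)) (+-identityʳ (c i))
    ∑-others : sum others ≡ 1
    ∑-others = +-cancelˡ-≡ (1 + m) _ _ (begin
      1 + m + sum others
        ≡⟨ cong (_+ sum others) (trans (sum-δ v c) cv) ⟨
      sum (λ i → ⟦ v ≟ i ⟧ * c i) + sum others
        ≡⟨ ∑-distrib-+ (λ i → ⟦ v ≟ i ⟧ * c i) others ⟨
      sum (λ i → ⟦ v ≟ i ⟧ * c i + others i)
        ≡⟨ sum-cong-≗ {n} pointwise ⟩
      sum c
        ≡⟨ trans (∑-children forest) nonroots≡ ⟩
      2 + m
        ≡⟨ cong suc (+-comm 1 m) ⟩
      1 + m + 1 ∎)
      where
      open ≡-Reasoning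
      pointwise : ∀ i → ⟦ v ≟ i ⟧ * c i + others i ≡ c i
      pointwise i with v ≟ i
      ... | yes _ = trans (+-identityʳ _) (+-identityʳ _)
      ... | no _  = +-identityʳ _
    found = sum≡1⇒ others ∑-others
    u = proj₁ found
    v≢u : v ≢ u
    v≢u v≡u = case trans (sym (cong (_* c u) (⟦⟧-no (¬? (v ≟ u)) λ ne → ne v≡u))) (proj₁ (proj₂ found)) of λ ()
    cu : c u ≡ 1
    cu = trans (sym (others-≢ v≢u)) (proj₁ (proj₂ found))
    rest : ∀ i → i ≢ v → i ≢ u → c i ≡ 0
    rest i i≢v i≢u = trans (sym (others-≢ (i≢v ∘ sym))) (proj₂ (proj₂ found) i i≢u)
  ... | no none₂ | no none₁ = inj₂ (inj₂ λ i → ≤-pred (≤∧≢⇒<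
    (≤-pred (≤∧≢⇒< (≤-trans (term≤sum c i) (≤-reflexive (trans (∑-children forest) nonroots≡))) (λ e → none₂ (i , e))))
    (λ e → none₁ (i , e))))

  -- Replacing c² by mc bounds the weight by (m + 2b)(2 + m), which is exactly 2 less than
  -- `broomWeight b m`.
  spread⇒weight< : ∀ {m} → nonroots forest ≡ 2 + m → (∀ i → c i ≤ m) → sum weight < broomWeight b m
  spread⇒weight< {m} nonroots≡ c≤m = begin-strict
    sum weight
      ≤⟨ sum-≤ pointwise ⟩
    sum (λ i → (m + 2 * b) * c i)
      ≡⟨ *-distribˡ-sum {n} (m + 2 * b) c ⟨
    (m + 2 * b) * sum c
      ≡⟨ cong ((m + 2 * b) *_) (trans (∑-children forest) nonroots≡) ⟩
    (m + 2 * b) * (2 + m)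
      <⟨ m<n+m _ {2} (s≤s z≤n) ⟩
    2 + (m + 2 * b) * (2 + m)
      ≡⟨ solve 2 (λ m b → con 2 :+ (m :+ con 2 :* b) :* (con 2 :+ m) :=
           (con 1 :+ m) :* (con 1 :+ m) :+ con 1 :* con 1 :+ con 2 :* b :* (con 1 :+ m :+ con 1)) refl m b ⟩
    broomWeight b m ∎
    where
    open ≤-Reasoning
    pointwise : ∀ i → weight i ≤ (m + 2 * b) * c i
    pointwise i = begin
      c i * c i + 2 * b * (⟦ root? i ⟧ * c i)
        ≤⟨ +-mono-≤ (*-monoˡ-≤ (c i) (c≤m i)) (*-monoʳ-≤ (2 * b) (≤-trans (*-monoˡ-≤ (c i) (⟦⟧-≤1 (root? i))) (≤-reflexive (+-identityʳ (c i))))) ⟩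
      m * c i + 2 * b * c i
        ≡⟨ *-distribʳ-+ (c i) m (2 * b) ⟨
      (m + 2 * b) * c i ∎

  module _ {m} (near : NearStar m) where
    open NearStar near

    nearStar⇒broom : C big → C small → Broom F 1
    nearStar⇒broom Cbig Csmall = broom-from-children F big≢small Cbig Csmall small≡ rest

    -- `full` credits every parent with the term 2bc and adds up to `broomWeight b m`. A parent
    -- outside `C` loses that term, which is positive because b > 0.
    nearStar-outside⇒weight< : 0 < b → ∀ {i} → ¬ C i → 0 < c i → sum weight < broomWeight b m
    nearStar-outside⇒weight< 0<b {i} ¬Ci 0<ci = <-≤-trans (sum-< le i lt) (≤-reflexive total)
      where
      full : Fin n → ℕ
      full i = c i * c i + 2 * b * c i
      le : ∀ i → weight i ≤ full i
      le i = +-monoʳ-≤ (c i * c i) (*-monoʳ-≤ (2 * b)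
        (≤-trans (*-monoˡ-≤ (c i) (⟦⟧-≤1 (root? i))) (≤-reflexive (+-identityʳ (c i)))))
      lt : weight i < full i
      lt = +-monoʳ-< (c i * c i) (subst (_< 2 * b * c i)
        (sym (trans (cong (λ e → 2 * b * (e * c i)) (⟦⟧-no (root? i) ¬Ci)) (*-zeroʳ (2 * b))))
        (*-mono-≤ {1} {2 * b} {1} (≤-trans 0<b (m≤m+n b _)) 0<ci))
      total : sum full ≡ broomWeight b m
      total = trans (two-point-sum full big≢small λ i p q → trans (cong (λ x → x * x + 2 * b * x) (rest i p q)) (*-zeroʳ (2 * b)))
        (trans (cong₂ (λ x y → (x * x + 2 * b * x) + (y * y + 2 * b * y)) big≡ small≡)
          (solve 2 (λ m b → (con 1 :+ m) :* (con 1 :+ m) :+ con 2 :* b :* (con 1 :+ m) :+ (con 1 :+ con 2 :* b :* con 1) :=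
            (con 1 :+ m) :* (con 1 :+ m) :+ con 1 :* con 1 :+ con 2 :* b :* (con 1 :+ m :+ con 1)) refl m b))

    big-or-small : ∀ {i} → 0 < c i → i ≡ big ⊎ i ≡ small
    big-or-small {i} pos with i ≟ big | i ≟ small
    ... | yes e | _     = inj₁ e
    ... | no _  | yes e = inj₂ e
    ... | no p  | no q  = contradiction (sym (rest i p q)) (<⇒≢ pos)

    -- If one of the two lies outside `C`, its parent has a child and hence is the other one. In a
    -- tree this makes the pair available as a new core.
    big-small-adjacent : Adj G big small
    big-small-adjacent with root? big | root? small
    ... | yes Cb | yes Cs = clique⁺ (Cb , Cs , big≢small)
    ... | no ¬Cb | _ = subst (Adj G big)
      ([ (λ e → contradiction e (up≢ ¬Cb)) , id ]′ (big-or-small (parent-has-child F ¬Cb))) (up⁺ ¬Cb)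
    ... | yes _ | no ¬Cs = Adj-sym G (subst (Adj G small)
      ([ id , (λ e → contradiction e (up≢ ¬Cs)) ]′ (big-or-small (parent-has-child F ¬Cs))) (up⁺ ¬Cs))

module _ {n} {G : Graph n} {C C′ : Fin n → Set} (F : CliqueForest G C) (F′ : CliqueForest G C′)
         (roots≡ : roots (CliqueForest.forest F) ≡ 2) (roots≡′ : roots (CliqueForest.forest F′) ≡ 2) where

  -- In a tree the number of children is the degree minus one, whichever edge
  -- is taken as the clique.
  children-equal : ∀ i → children (CliqueForest.forest F) i ≡ children (CliqueForest.forest F′) i
  children-equal i = +-cancelˡ-≡ (1 + ⟦ root? F i ⟧ * 0) _ _ (begin
    1 + ⟦ root? F i ⟧ * 0 + children (forest F) i     ≡⟨ CliqueForestMoments.degree≡ F roots≡ i ⟨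
    degree G i                                        ≡⟨ CliqueForestMoments.degree≡ F′ roots≡′ i ⟩
    1 + ⟦ root? F′ i ⟧ * 0 + children (forest F′) i
      ≡⟨ cong (λ z → 1 + z + children (forest F′) i) (trans (*-zeroʳ ⟦ root? F′ i ⟧) (sym (*-zeroʳ ⟦ root? F i ⟧))) ⟩
    1 + ⟦ root? F i ⟧ * 0 + children (forest F′) i    ∎)
    where
    open ≡-Reasoning
    open CliqueForest using (forest; root?)

  nearStar-transport : ∀ {m} → NearStar F roots≡ m → NearStar F′ roots≡′ m
  nearStar-transport near = record
    { big≢small = big≢small
    ; big≡      = trans (sym (children-equal big)) big≡
    ; small≡    = trans (sym (children-equal small)) small≡
    ; rest      = λ i p q → trans (sym (children-equal i)) (rest i p q)
    }
    where open NearStar near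

-- The graphs of the theorem

∑-toℕ< : ∀ {n a} → a ≤ n → sum {n} (λ x → ⟦ toℕ x <? a ⟧) ≡ a
∑-toℕ< {n}     z≤n       = sum-zero {n} λ x → ⟦⟧-no (toℕ x <? 0) λ ()
∑-toℕ< {suc n} {suc a} (s≤s a≤n) = cong suc (trans
  (sum-cong-≗ {n} λ x → ⟦⟧-cong (suc (toℕ x) <? suc a) (toℕ x <? a) ≤-pred s≤s) (∑-toℕ< a≤n))

module _ {n k : ℕ} where
  private
    clique : ℕ
    clique = suc n ∸ k

    K-rel : Fin (suc n) → Fin (suc n) → Bool
    K-rel i j = ((toℕ i <ᵇ clique) ∧ (toℕ j <ᵇ clique)) ∨ (toℕ i ≡ᵇ 0)

  K⁻ : ∀ {i j} → Adj (K (suc n) k) i j → i ≢ j × ((toℕ i < clique × toℕ j < clique) ⊎ (i ≡ zero ⊎ j ≡ zero))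
  K⁻ {i} {j} a with fromRel⁻ K-rel a
  ... | i≢j , inj₁ t = i≢j , Sum.map (λ t → let p , q = ∧⁻ {toℕ i <ᵇ clique} t in <ᵇ⇒< _ _ p , <ᵇ⇒< _ _ q)
                                     (λ t → inj₁ (toℕ-injective (≡ᵇ⇒≡ _ 0 t))) (∨⁻ {(toℕ i <ᵇ clique) ∧ (toℕ j <ᵇ clique)} t)
  ... | i≢j , inj₂ t = i≢j , Sum.map (λ t → let q , p = ∧⁻ {toℕ j <ᵇ clique} t in <ᵇ⇒< _ _ p , <ᵇ⇒< _ _ q)
                                     (λ t → inj₂ (toℕ-injective (≡ᵇ⇒≡ _ 0 t))) (∨⁻ {(toℕ j <ᵇ clique) ∧ (toℕ i <ᵇ clique)} t)

  K⁺-clique : ∀ {i j} → i ≢ j → toℕ i < clique → toℕ j < clique → Adj (K (suc n) k) i j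
  K⁺-clique {i} {j} i≢j p q = fromRel⁺ K-rel i≢j (inj₁ (∨⁺ {(toℕ i <ᵇ clique) ∧ (toℕ j <ᵇ clique)} (inj₁ (∧⁺ (<⇒<ᵇ p) (<⇒<ᵇ q)))))

  K⁺-centre : ∀ {i} → i ≢ zero → Adj (K (suc n) k) i zero
  K⁺-centre {i} i≢0 = fromRel⁺ K-rel i≢0 (inj₂ (∨⁺ {(0 <ᵇ clique) ∧ (toℕ i <ᵇ clique)} (inj₂ _)))

  -- For the star K_n^{n-1} the core may be taken to be an edge instead of
  -- the one-vertex clique K_1.
  K-cliqueForest : ∀ {a} → 1 ≤ a → clique ≤ a → a ≤ clique ⊎ a ≤ 2 → CliqueForest (K (suc n) k) (λ x → toℕ x < a)
  K-cliqueForest {a} 1≤a q≤a a≤ = record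
    { forest  = record { root? = λ x → toℕ x <? a ; up = λ _ → zero ; height = toℕ
                       ; descends = λ ¬C → ≤-trans 1≤a (≮⇒≥ ¬C) }
    ; link    = link
    ; clique⁺ = clique⁺ a≤
    ; up⁺     = λ ¬C → K⁺-centre λ { refl → ¬C 1≤a }
    }
    where
    link : ∀ {i j} → Adj (K (suc n) k) i j →
      Clique (λ x → toℕ x < a) i j ⊎ ((¬ (toℕ i < a) × j ≡ zero) ⊎ (¬ (toℕ j < a) × i ≡ zero))
    link {i} {j} ij with K⁻ {i} {j} ij
    ... | i≢j , inj₁ (p , q) = inj₁ (<-≤-trans p q≤a , <-≤-trans q q≤a , i≢j)
    ... | i≢j , inj₂ (inj₁ refl) with toℕ j <? a
    ...   | yes Cj = inj₁ (1≤a , Cj , i≢j)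
    ...   | no ¬Cj = inj₂ (inj₂ (¬Cj , refl))
    link {i} {j} ij | i≢j , inj₂ (inj₂ refl) with toℕ i <? a
    ...   | yes Ci = inj₁ (Ci , 1≤a , i≢j)
    ...   | no ¬Ci = inj₂ (inj₁ (¬Ci , refl))
    one : ∀ {x : Fin (suc n)} → a ≤ 2 → x ≢ zero → toℕ x < a → toℕ x ≡ 1
    one {zero}  _   x≢0 _ = contradiction refl x≢0
    one {suc x} a≤2 _   p = cong suc (n<1⇒n≡0 (≤-pred (<-≤-trans p a≤2)))
    clique⁺ : a ≤ clique ⊎ a ≤ 2 → ∀ {i j} → Clique (λ x → toℕ x < a) i j → Adj (K (suc n) k) i j
    clique⁺ (inj₁ a≤q) (p , q , i≢j) = K⁺-clique i≢j (<-≤-trans p a≤q) (<-≤-trans q a≤q)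
    clique⁺ (inj₂ a≤2) {i} {j} (p , q , i≢j) with i ≟ zero | j ≟ zero
    ... | yes refl | _        = Adj-sym (K (suc n) k) (K⁺-centre (i≢j ∘ sym))
    ... | no _     | yes refl = K⁺-centre i≢j
    ... | no i≢0   | no j≢0   = contradiction (toℕ-injective (trans (one a≤2 i≢0 p) (sym (one a≤2 j≢0 q)))) i≢j

module _ {n k a : ℕ} (F : CliqueForest (K (2 + n) k) (λ x → toℕ x < a)) (up≡ : ∀ x → CliqueForest.up F x ≡ zero) where
  open CliqueForest F using (forest; up?)

  K-broom : 2 ≤ a → Broom F 0
  K-broom 2≤a = record
    { hub = zero ; fork = suc zero ; hub≢fork = λ () ; C-hub = ≤-trans (s≤s z≤n) 2≤a ; C-fork = 2≤a
    ; attached = λ {x} _ → inj₁ (up≡ x)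
    ; fork-children = sum-zero λ x → ⟦⟧-no (up? x (suc zero)) λ (_ , e) → case trans e (up≡ x) of λ () }

addEdge⁺ : ∀ {n} (G : Graph n) {v w i j} → i ≢ j → Adj G i j ⊎ SameEdge i j v w → Adj (addEdge G v w) i j
addEdge⁺ G {v} {w} {i} {j} i≢j = fromRel⁺ (λ i j → adj G i j ∨ ((i == v) ∧ (j == w))) i≢j ∘
  [ (λ ij → inj₁ (∨⁺ (inj₁ ij))) ,
    [ (λ (p , q) → inj₁ (∨⁺ {adj G i j} (inj₂ (∧⁺ (==-T p) (==-T q))))) ,
      (λ (p , q) → inj₂ (∨⁺ {adj G j i} (inj₂ (∧⁺ (==-T q) (==-T p))))) ]′ ]′

addEdge⁻ : ∀ {n} (G : Graph n) {v w i j} → Adj (addEdge G v w) i j → Adj G i j ⊎ SameEdge i j v w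
addEdge⁻ G {v} {w} {i} {j} a with proj₂ (fromRel⁻ (λ i j → adj G i j ∨ ((i == v) ∧ (j == w))) a)
... | inj₁ t = Sum.map id (λ t → let p , q = ∧⁻ {i == v} t in inj₁ (T-== p , T-== q)) (∨⁻ {adj G i j} t)
... | inj₂ t = Sum.map (Adj-sym G) (λ t → let p , q = ∧⁻ {j == v} t in inj₂ (T-== q , T-== p)) (∨⁻ {adj G j i} t)

module _ {p k q : ℕ} (q≡ : 2 + p ∸ k ≡ q) (2≤q : 2 ≤ q) (q≤ : q ≤ 1 + p) where
  private
    n = 2 + p

    w : Fin n
    w = fromℕ (suc p)

    C : Fin n → Set
    C x = toℕ x < q

    ¬Cw : ¬ C w
    ¬Cw = ≤⇒≯ (≤-trans q≤ (≤-reflexive (sym (toℕ-fromℕ (suc p)))))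

    C₀ : C zero
    C₀ = ≤-trans (s≤s z≤n) 2≤q

    up : Fin n → Fin n
    up x = if does (x ≟ w) then suc zero else zero

    up-w : ∀ {x} → x ≡ w → up x ≡ suc zero
    up-w {x} e rewrite dec-true (x ≟ w) e = refl

    up-≢w : ∀ {x} → x ≢ w → up x ≡ zero
    up-≢w {x} ne rewrite dec-false (x ≟ w) ne = refl

    toℕ-up : ∀ x → toℕ (up x) ≤ 1
    toℕ-up x with does (x ≟ w)
    ... | true  = ≤-refl
    ... | false = z≤n

    without : Graph n
    without = deleteEdge (K n k) zero w

    clique⁺ : ∀ {i j} → Clique C i j → Adj (G₃ p k) i j
    clique⁺ {i} {j} (Ci , Cj , i≢j) = addEdge⁺ without i≢j (inj₁ (deleteEdge⁺ (K n k) {zero} {w} {i} {j}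
      (K⁺-clique {1 + p} {k} {i} {j} i≢j (subst (toℕ i <_) (sym q≡) Ci) (subst (toℕ j <_) (sym q≡) Cj))
      [ (λ { (_ , refl) → ¬Cw Cj }) , (λ { (refl , _) → ¬Cw Ci }) ]′))

    up⁺ : ∀ {x} → ¬ C x → Adj (G₃ p k) x (up x)
    up⁺ {x} ¬Cx = by-cases (x ≟ w)
      where
      x≢0 : x ≢ zero
      x≢0 refl = ¬Cx C₀
      by-cases : Dec (x ≡ w) → Adj (G₃ p k) x (up x)
      by-cases (yes x≡w) = subst (Adj (G₃ p k) x) (sym (up-w x≡w))
        (addEdge⁺ without (λ { refl → ¬Cx 2≤q }) (inj₂ (inj₂ (x≡w , refl))))
      by-cases (no x≢w) = subst (Adj (G₃ p k) x) (sym (up-≢w x≢w))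
        (addEdge⁺ without {suc zero} {w} x≢0 (inj₁ (deleteEdge⁺ (K n k) {zero} {w} {x} {zero} (K⁺-centre {1 + p} {k} {x} x≢0) [ x≢0 ∘ proj₁ , x≢w ∘ proj₁ ]′)))

    centre-link : ∀ {j} → zero ≢ j → j ≢ w → Clique C zero j ⊎ (¬ C j × zero ≡ up j)
    centre-link {j} 0≢j j≢w with toℕ j <? q
    ... | yes Cj = inj₁ (C₀ , Cj , 0≢j)
    ... | no ¬Cj = inj₂ (¬Cj , sym (up-≢w j≢w))

    Clique-swap : ∀ {i j} → Clique C i j → Clique C j i
    Clique-swap (Ci , Cj , i≢j) = Cj , Ci , i≢j ∘ sym

    link : ∀ {i j} → Adj (G₃ p k) i j → Clique C i j ⊎ ((¬ C i × j ≡ up i) ⊎ (¬ C j × i ≡ up j))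
    link {i} {j} ij with addEdge⁻ without {suc zero} {w} {i} {j} ij
    ... | inj₂ (inj₁ (refl , refl)) = inj₂ (inj₂ (¬Cw , sym (up-w refl)))
    ... | inj₂ (inj₂ (refl , refl)) = inj₂ (inj₁ (¬Cw , sym (up-w refl)))
    ... | inj₁ a with deleteEdge⁻ (K n k) {zero} {w} {i} {j} a
    ...   | a′ , ne with K⁻ {1 + p} {k} {i} {j} a′
    ...     | i≢j , inj₁ (Ci , Cj)     = inj₁ (subst (toℕ i <_) q≡ Ci , subst (toℕ j <_) q≡ Cj , i≢j)
    ...     | i≢j , inj₂ (inj₁ refl) = Sum.map id inj₂ (centre-link i≢j λ e → ne (inj₁ (refl , e)))
    ...     | i≢j , inj₂ (inj₂ refl) = Sum.map Clique-swap inj₁ (centre-link (i≢j ∘ sym) λ e → ne (inj₂ (e , refl)))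

  G₃-cliqueForest : CliqueForest (G₃ p k) C
  G₃-cliqueForest = record
    -- Vertex numbers serve as heights: nonroots are numbered from q ≥ 2 on, and their parents are 0
    -- and 1.
    { forest  = record { root? = λ x → toℕ x <? q ; up = up ; height = toℕ
                       ; descends = λ {x} ¬C → ≤-<-trans (toℕ-up x) (≤-trans 2≤q (≮⇒≥ ¬C)) }
    ; link    = link
    ; clique⁺ = clique⁺
    ; up⁺     = up⁺
    }

  G₃-broom : Broom G₃-cliqueForest 1
  G₃-broom = record
    { hub = zero ; fork = suc zero ; hub≢fork = λ () ; C-hub = C₀ ; C-fork = 2≤q
    ; attached = λ {x} _ → attached x
    ; fork-children = trans (sum-cong-≗ {n} λ x → ⟦⟧-cong (up? x (suc zero)) (w ≟ x) (to x)
        (λ { refl → ¬Cw , sym (up-w refl) })) (sum-point w) }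
    where
    open CliqueForest G₃-cliqueForest using (up?; Up)
    attached : ∀ x → up x ≡ zero ⊎ up x ≡ suc zero
    attached x with does (x ≟ w)
    ... | true  = inj₂ refl
    ... | false = inj₁ refl
    to : ∀ x → Up x (suc zero) → w ≡ x
    to x (_ , e) = decidable-stable (w ≟ x) λ ne → case trans e (up-≢w (ne ∘ sym)) of λ ()

module _ (p : ℕ) where
  private
    star : Graph (2 + p)
    star = K (2 + p) (1 + p)

    one : 2 + p ∸ (1 + p) ≡ 1
    one = m+n∸n≡m 1 p

    star⁻ : ∀ {i j} → Adj star i j → i ≢ j × (i ≡ zero ⊎ j ≡ zero)
    star⁻ {i} {j} a with K⁻ {1 + p} {1 + p} {i} {j} a
    ... | i≢j , inj₂ z       = i≢j , z
    ... | i≢j , inj₁ (x , y) = i≢j , inj₁ (toℕ-injective (n<1⇒n≡0 (subst (toℕ i <_) one x)))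

    -- `attachPendant` shifts the star by one: its centre 0 becomes 1, the leaf 1 becomes 2, and the
    -- new vertex 0 hangs from 2.
    centre : Fin (3 + p)
    centre = suc zero

    up : Fin (3 + p) → Fin (3 + p)
    up zero    = suc (suc zero)
    up (suc _) = centre

    height : Fin (3 + p) → ℕ
    height zero          = 2
    height (suc zero)    = 0
    height (suc (suc _)) = 1

    descends : ∀ {x} → x ≢ centre → height (up x) < height x
    descends {zero}        _ = s≤s (s≤s z≤n)
    descends {suc zero}    ne = contradiction refl ne
    descends {suc (suc _)} _ = s≤s z≤n

    link : ∀ {i j} → Adj (K⁎ p) i j → Clique (_≡ centre) i j ⊎ ((i ≢ centre × j ≡ up i) ⊎ (j ≢ centre × i ≡ up j))
    link {zero} {suc j} a = inj₂ (inj₁ ((λ ()) , cong suc (T-== ([ id , (λ ()) ]′ (∨⁻ {j == suc zero} a)))))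
    link {suc i} {zero} a = inj₂ (inj₂ ((λ ()) , cong suc (T-== a)))
    link {suc i} {suc j} a with ∧⁻ {not (i == j)} a
    ... | _ , t with star⁻ {i} {j} ([ id , Adj-sym star {j} {i} ]′ (∨⁻ {adj star i j} t))
    ...   | i≢j , inj₁ refl = inj₂ (inj₂ ((λ { refl → i≢j refl }) , refl))
    ...   | i≢j , inj₂ refl = inj₂ (inj₁ ((λ { refl → i≢j refl }) , refl))

    up⁺ : ∀ {x} → x ≢ centre → Adj (K⁎ p) x (up x)
    up⁺ {zero}        _  = _
    up⁺ {suc zero}    ne = contradiction refl ne
    up⁺ {suc (suc i)} _  = ∨⁺ {adj star (suc i) zero} (inj₁ (K⁺-centre {1 + p} {1 + p} {suc i} λ ()))

  -- The one-vertex core serves to count cut edges, since no clique edge then needs a third vertex.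
  -- For the moments the core is widened to the edge between the two branching vertices.
  K⁎-cliqueForest : CliqueForest (K⁎ p) (_≡ centre)
  K⁎-cliqueForest = record
    { forest  = record { root? = _≟ centre ; up = up ; height = height ; descends = descends }
    ; link    = link
    ; clique⁺ = λ { (refl , refl , ne) → contradiction refl ne }
    ; up⁺     = up⁺
    }

  K⁎-edge : Adj (K⁎ p) (suc zero) (suc (suc zero))
  K⁎-edge = Adj-sym (K⁎ p) {suc (suc zero)} {suc zero} (up⁺ {suc (suc zero)} λ ())

  K⁎-broom : Broom (edgeCliqueForest K⁎-cliqueForest (suc (suc zero)) K⁎-edge) 1
  K⁎-broom = record
    { hub = suc zero ; fork = suc (suc zero) ; hub≢fork = λ () ; C-hub = inj₁ refl ; C-fork = inj₂ refl
    ; attached = λ {x} _ → attached x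
    ; fork-children = trans (sum-cong-≗ {3 + p} λ x → ⟦⟧-cong (up? x (suc (suc zero))) (zero ≟ x) (to x)
        (λ { refl → [ (λ ()) , (λ ()) ]′ , refl })) (sum-point {3 + p} zero) }
    where
    open CliqueForest (edgeCliqueForest K⁎-cliqueForest (suc (suc zero)) K⁎-edge) using (up?; Up)
    attached : ∀ x → up x ≡ suc zero ⊎ up x ≡ suc (suc zero)
    attached zero    = inj₂ refl
    attached (suc _) = inj₁ refl
    to : ∀ x → Up x (suc (suc zero)) → zero ≡ x
    to zero    _       = refl
    to (suc _) (_ , ())

-- The second last graph

-- All cores are ranged over because a tree admits several, and the one that exhibits a broom need
-- not be the one at hand.
NoBroom : ∀ {n} → Graph n → ℕ → ℕ → Set₁
NoBroom G b t = ∀ {C} (F : CliqueForest G C) → roots (CliqueForest.forest F) ≡ 2 + b → ¬ Broom F t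

module _ {n} {G : Graph n} {b m : ℕ} where

  -- The near-star with a parent outside the core is left as a hypothesis, as it is where the two
  -- settings differ: for b > 0 its weight is smaller, while in a tree a change of core shows that
  -- it is a broom after all.
  noBroom⇒weight< : ∀ {C} (F : CliqueForest G C) (roots≡ : roots (CliqueForest.forest F) ≡ 2 + b) →
    nonroots (CliqueForest.forest F) ≡ 2 + m → NoBroom G b 0 → NoBroom G b 1 →
    (∀ near → ¬ C (NearStar.big {roots≡ = roots≡} {m = m} near) ⊎ ¬ C (NearStar.small near) →
      sum (CliqueForestMoments.weight F roots≡) < broomWeight b m) →
    sum (CliqueForestMoments.weight F roots≡) < broomWeight b m
  noBroom⇒weight< F roots≡ nonroots≡ none₀ none₁ outside with child-distribution F roots≡ nonroots≡
  ... | inj₁ broom₀         = contradiction broom₀ (none₀ F roots≡)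
  ... | inj₂ (inj₂ spread)  = spread⇒weight< F roots≡ nonroots≡ spread
  ... | inj₂ (inj₁ near) with CliqueForest.root? F (NearStar.big near) | CliqueForest.root? F (NearStar.small near)
  ...   | yes Cbig | yes Csmall = contradiction (nearStar⇒broom F roots≡ near Cbig Csmall) (none₁ F roots≡)
  ...   | no ¬Cbig | _          = outside near (inj₁ ¬Cbig)
  ...   | yes _    | no ¬Csmall = outside near (inj₂ ¬Csmall)

  noBroom⇒weight<-blocks : 0 < b → ∀ {C} (F : CliqueForest G C) (roots≡ : roots (CliqueForest.forest F) ≡ 2 + b) →
    nonroots (CliqueForest.forest F) ≡ 2 + m → NoBroom G b 0 → NoBroom G b 1 →
    sum (CliqueForestMoments.weight F roots≡) < broomWeight b m
  noBroom⇒weight<-blocks 0<b F roots≡ nonroots≡ none₀ none₁ = noBroom⇒weight< F roots≡ nonroots≡ none₀ none₁ λ near →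
    [ (λ ¬C → nearStar-outside⇒weight< F roots≡ near 0<b ¬C (subst (0 <_) (sym (NearStar.big≡ near)) (s≤s z≤n)))
    , (λ ¬C → nearStar-outside⇒weight< F roots≡ near 0<b ¬C (subst (0 <_) (sym (NearStar.small≡ near)) (s≤s z≤n))) ]′

module _ {n} {G : Graph n} {m : ℕ} (rootedAt : ∀ r → CliqueForest G (_≡ r)) where

  -- A tree with the child counts of a broom becomes one when its two
  -- branching vertices are taken as the clique.
  noBroom⇒weight<-tree : ∀ {r s} (rs : Adj G r s) → let F = edgeCliqueForest (rootedAt r) s rs
                                                        roots≡ = edgeCliqueForest-roots (rootedAt r) s rs in
    nonroots (CliqueForest.forest F) ≡ 2 + m → NoBroom G 0 0 → NoBroom G 0 1 →
    sum (CliqueForestMoments.weight F {b = 0} roots≡) < broomWeight 0 m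
  noBroom⇒weight<-tree {r} {s} rs nonroots≡ none₀ none₁ = noBroom⇒weight< {m = m} F roots≡ nonroots≡ none₀ none₁ λ near _ →
    let open NearStar near using (big; small)
        adjacent = big-small-adjacent F roots≡ near
        F′ = edgeCliqueForest (rootedAt big) small adjacent
        roots≡′ = edgeCliqueForest-roots (rootedAt big) small adjacent
    in contradiction (nearStar⇒broom F′ {b = 0} roots≡′ (nearStar-transport F F′ roots≡ roots≡′ near) (inj₁ refl) (inj₂ refl))
         (none₁ F′ roots≡′)
    where
    F = edgeCliqueForest (rootedAt r) s rs
    roots≡ = edgeCliqueForest-roots (rootedAt r) s rs

first-edge : ∀ {n} {R : Fin n → Fin n → Set} {i j} → Star R i j → i ≢ j → ∃[ l ] R i l
first-edge ε       i≢i = contradiction refl i≢i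
first-edge (e ◅ _) _   = _ , e

-- One of the vertices 0, 1, 2 differs from both `i` and `j`.
third-vertex : ∀ {p b} {i j : Fin (3 + p)} → i ≢ j → ∃[ l ] toℕ l < 3 + b × l ≢ i × l ≢ j
third-vertex {p} {b} {i} {j} i≢j with 0F ≟ i | 0F ≟ j | 1F ≟ i | 1F ≟ j
... | no 0≢i   | no 0≢j   | _        | _        = 0F , s≤s z≤n , 0≢i , 0≢j
... | yes refl | yes refl | _        | _        = contradiction refl i≢j
... | yes refl | no _     | _        | no 1≢j   = 1F , s≤s (s≤s z≤n) , (λ ()) , 1≢j
... | yes refl | no _     | _        | yes refl = 2F , s≤s (s≤s (s≤s z≤n)) , (λ ()) , λ ()
... | no _     | yes refl | no 1≢i   | _        = 1F , s≤s (s≤s z≤n) , 1≢i , λ ()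
... | no _     | yes refl | yes refl | _        = 2F , s≤s (s≤s (s≤s z≤n)) , (λ ()) , λ ()

-- From closed walk counts to the S-order

module _ {c ℓ₁ ℓ₂} (ℝ : RealNumbers c ℓ₁ ℓ₂) where
  open Spectral ℝ

  module _ {n} {eig : Graph n → Fin n → RealNumbers.Carrier ℝ} (isSpectrum : ∀ G → IsSpectrum G (eig G)) (k : ℕ) where
    open SOrder eig

    IsSecondLast : Graph n → Set _
    IsSecondLast H =
      𝒢 n k H × (H ≺ K n k) × (∀ G → 𝒢 n k G → ¬ (G ≅ K n k) → ¬ (G ≅ H) → G ≺ H)

    module _ {b m : ℕ} (4≤n-1 : 4 ≤ n ∸ 1) (n≡ : 2 + b + (2 + m) ≡ n)
      {CK CH : Fin n → Set} {H : Graph n}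
      (FK : CliqueForest (K n k) CK) (rootsK : roots (CliqueForest.forest FK) ≡ 2 + b) (broomK : Broom FK 0)
      (FH : CliqueForest H CH) (rootsH : roots (CliqueForest.forest FH) ≡ 2 + b) (broomH : Broom FH 1)
      where

      -- `4≤n-1` makes the fourth moment one of those compared. The number 2 + m counts the vertices
      -- outside the core; this is `k` for a block but k - 1 for a tree, where one cut edge is taken
      -- as the core.
      broom₁-secondLast : 𝒢 n k H →
        (∀ G → 𝒢 n k G → NoBroom G b 0 → NoBroom G b 1 →
          closedWalks G 2 < n + (2 + b) * b + (2 + m) ⊎
          Σ[ C ∈ (Fin n → Set) ] Σ[ F ∈ CliqueForest G C ] Σ[ roots≡ ∈ roots (CliqueForest.forest F) ≡ 2 + b ]
            sum (CliqueForestMoments.weight F roots≡) < broomWeight b m) →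
        IsSecondLast H
      broom₁-secondLast H∈𝒢 below = H∈𝒢 , H≺K , others
        where
        nonrootsH : nonroots (CliqueForest.forest FH) ≡ 2 + m
        nonrootsH = +-cancelˡ-≡ (2 + b) _ _ (trans (cong (_+ nonroots (CliqueForest.forest FH)) (sym rootsH))
          (trans (roots+nonroots (CliqueForest.forest FH)) (sym n≡)))
        1+m+1 : 1 + m + 1 ≡ 2 + m
        1+m+1 = cong suc (+-comm m 1)
        weightH : sum (CliqueForestMoments.weight FH rootsH) ≡ broomWeight b m
        weightH = BroomProperties.broom-weight FH broomH rootsH {1 + m} (trans 1+m+1 (sym nonrootsH))
        weightK : sum (CliqueForestMoments.weight FK rootsK) ≡ (2 + m) * (2 + m) + 0 * 0 + 2 * b * (2 + m + 0)
        weightK = BroomProperties.broom-weight FK broomK rootsK {2 + m} (trans (+-identityʳ _)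
          (sym (trans (nonroots-equal FK FH {b = b} rootsK rootsH) nonrootsH)))
        H≺K : H ≺ K n k
        H≺K = ≺-from-closedWalks ℝ isSpectrum {H} {K n k} 4 (s≤s z≤n) 4≤n-1 (closedWalks-equal FH FK rootsH rootsK)
          (weight<⇒closedWalks₄< FH FK rootsH rootsK (subst₂ _<_ (sym weightH) (sym weightK) (begin-strict
            broomWeight b m
              -- Moving the fork's only child to the hub changes (1 + m)² + 1 into (2 + m)², a gain
              -- of 2 + 2m.
              <⟨ m<n+m _ {2 + 2 * m} (s≤s z≤n) ⟩
            2 + 2 * m + broomWeight b m
              ≡⟨ solve 2 (λ m b → con 2 :+ con 2 :* m :+ ((con 1 :+ m) :* (con 1 :+ m) :+ con 1 :* con 1 :+ con 2 :* b :* (con 1 :+ m :+ con 1)) :=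
                   (con 2 :+ m) :* (con 2 :+ m) :+ con 0 :* con 0 :+ con 2 :* b :* (con 2 :+ m :+ con 0)) refl m b ⟩
            (2 + m) * (2 + m) + 0 * 0 + 2 * b * (2 + m + 0) ∎)))
          where open ≤-Reasoning
        others : ∀ G → 𝒢 n k G → ¬ (G ≅ K n k) → ¬ (G ≅ H) → G ≺ H
        others G G∈𝒢 G≇K G≇H with below G G∈𝒢 (λ F r B → G≇K (brooms-isomorphic F FK {b = b} r rootsK B broomK))
                                              (λ F r B → G≇H (brooms-isomorphic F FH {b = b} r rootsH B broomH))
        ... | inj₁ fewer = ≺-from-closedWalks ℝ isSpectrum {G} {H} 2 (s≤s z≤n) (≤-trans (s≤s (s≤s z≤n)) 4≤n-1)
          (λ { 0 _ → refl ; 1 _ → trans (closedWalks₁ G) (sym (closedWalks₁ H)) ; (suc (suc _)) (s≤s (s≤s ())) })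
          (<-≤-trans fewer (≤-reflexive (sym (trans (CliqueForestMoments.closedWalks₂≡ FH rootsH)
            (cong (n + (2 + b) * b +_) nonrootsH)))))
        ... | inj₂ (_ , F , roots≡ , lighter) = ≺-from-closedWalks ℝ isSpectrum {G} {H} 4 (s≤s z≤n) 4≤n-1
          (closedWalks-equal F FH {b = b} roots≡ rootsH)
          (weight<⇒closedWalks₄< F FH {b = b} roots≡ rootsH (<-≤-trans lighter (≤-reflexive (sym weightH))))

  module _ {p} {eig : Graph (3 + p) → Fin (3 + p) → RealNumbers.Carrier ℝ} (isSpectrum : ∀ G → IsSpectrum G (eig G)) where

    G₃-secondLast : ∀ {m} → 2 + m ≤ p → IsSecondLast isSpectrum (2 + m) (G₃ (1 + p) (2 + m))
    -- The clique has n - k = 3 + b vertices with b = p ∸ k, so the core parameter is 1 + b, which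
    -- is positive as `noBroom⇒weight<-blocks` requires.
    G₃-secondLast {m} k≤p = broom₁-secondLast isSpectrum k {1 + b} {m} (s≤s (s≤s (≤-trans (s≤s (s≤s z≤n)) k≤p))) n≡
      FK (∑-toℕ< 3+b≤n)
      (K-broom {1 + p} {k} {3 + b} FK (λ _ → refl) (s≤s (s≤s z≤n)))
      FH (∑-toℕ< 3+b≤n) (G₃-broom {1 + p} {k} clique≡ (s≤s (s≤s z≤n)) 3+b≤)
      (cliqueForest-𝒢 FH (λ { (_ , _ , i≢j) → third-vertex i≢j }) {zero} (s≤s z≤n) nonroots≡)
      λ G G∈𝒢 none₀ none₁ → Sum.map id
        (λ (C , F , roots≡) → C , F , roots≡ ,
          noBroom⇒weight<-blocks {m = m} (s≤s z≤n) F roots≡ (nonroots-from (CliqueForest.forest F) roots≡) none₀ none₁)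
        (fewer-edges-or-cliqueForest {k = k} {b = 1 + b} G G∈𝒢 zero (trans (sym n≡) (+-comm (3 + b) k)))
      where
      k = 2 + m
      b = p ∸ k
      b+k : b + k ≡ p
      b+k = m∸n+n≡m k≤p
      n≡ : 2 + (1 + b) + (2 + m) ≡ 3 + p
      n≡ = cong (3 +_) b+k
      clique≡ : 3 + p ∸ k ≡ 3 + b
      clique≡ = trans (cong (_∸ k) (sym n≡)) (m+n∸n≡m (3 + b) k)
      3+b≤ : 3 + b ≤ 2 + p
      3+b≤ = s≤s (s≤s (subst (suc b ≤_) b+k (≤-trans (≤-reflexive (+-comm 1 b)) (+-monoʳ-≤ b (s≤s z≤n)))))
      3+b≤n : 3 + b ≤ 3 + p
      3+b≤n = ≤-trans 3+b≤ (n≤1+n _)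
      FK = K-cliqueForest {2 + p} {k} {3 + b} (s≤s z≤n) (≤-reflexive clique≡) (inj₁ (≤-reflexive (sym clique≡)))
      FH = G₃-cliqueForest {1 + p} {k} clique≡ (s≤s (s≤s z≤n)) 3+b≤
      nonroots-from : ∀ {C} (F : Forest {3 + p} C) → roots F ≡ 3 + b → nonroots F ≡ k
      nonroots-from F roots≡ = +-cancelˡ-≡ (3 + b) _ _ (trans (cong (_+ nonroots F) (sym roots≡)) (trans (roots+nonroots F) (sym n≡)))
      nonroots≡ : nonroots (CliqueForest.forest FH) ≡ k
      nonroots≡ = nonroots-from (CliqueForest.forest FH) (∑-toℕ< 3+b≤n)

  module _ {p : ℕ} where
    private
      n = 3 + p
      k = 2 + p

    star-clique≡1 : n ∸ k ≡ 1
    star-clique≡1 = m+n∸n≡m 1 k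

    starCliqueForest : CliqueForest (K n k) (λ x → toℕ x < 2)
    starCliqueForest = K-cliqueForest {2 + p} {k} {2} (s≤s z≤n) (≤-trans (≤-reflexive star-clique≡1) (s≤s z≤n)) (inj₂ ≤-refl)

    starCliqueForest-roots : roots (CliqueForest.forest starCliqueForest) ≡ 2
    starCliqueForest-roots = ∑-toℕ< {n} (s≤s (s≤s z≤n))

    star-broom : Broom starCliqueForest 0
    star-broom = K-broom {1 + p} {k} {2} starCliqueForest (λ _ → refl) (s≤s (s≤s z≤n))

    module _ (G : Graph n) (G∈𝒢 : 𝒢 n k G) where
      rootedAt : ∀ r → CliqueForest G (_≡ r)
      rootedAt = tree⇒rootedCliqueForest {k = k} G G∈𝒢 (cong (λ x → 2 + x) (+-comm 1 p))

      tree-edge : ∃[ s ] Adj G zero s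
      tree-edge = first-edge (proj₁ G∈𝒢 zero (suc zero)) λ ()

      treeCliqueForest : CliqueForest G (PairCore zero (proj₁ tree-edge))
      treeCliqueForest = edgeCliqueForest (rootedAt zero) (proj₁ tree-edge) (proj₂ tree-edge)

      treeCliqueForest-roots : roots (CliqueForest.forest treeCliqueForest) ≡ 2
      treeCliqueForest-roots = edgeCliqueForest-roots (rootedAt zero) (proj₁ tree-edge) (proj₂ tree-edge)

      treeCliqueForest-nonroots : nonroots (CliqueForest.forest treeCliqueForest) ≡ 1 + p
      treeCliqueForest-nonroots = +-cancelˡ-≡ 2 _ _ (trans (cong (_+ nonroots (CliqueForest.forest treeCliqueForest)) (sym treeCliqueForest-roots))
        (roots+nonroots (CliqueForest.forest treeCliqueForest)))

  -- Only one vertex lies outside the core edge, so exactly one vertex has a child. For n = 3 and k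
  -- = 2 there is thus no graph besides the star.
  three-vertex-tree : ∀ (G : Graph 3) → 𝒢 3 2 G → G ≅ K 3 2
  three-vertex-tree G G∈𝒢 = brooms-isomorphic F (starCliqueForest {0}) {b = 0} roots≡ (starCliqueForest-roots {0})
    (star⇒broom F {b = 0} roots≡ (proj₂ (proj₂ (sum≡1⇒ (children (CliqueForest.forest F))
      (trans (∑-children (CliqueForest.forest F)) (treeCliqueForest-nonroots {0} G G∈𝒢)))))) (star-broom {0})
    where
    F = treeCliqueForest {0} G G∈𝒢
    roots≡ = treeCliqueForest-roots {0} G G∈𝒢

  K⁎-secondLast : ∀ {p} {eig : Graph (5 + p) → Fin (5 + p) → RealNumbers.Carrier ℝ} (isSpectrum : ∀ G → IsSpectrum G (eig G)) →
    IsSecondLast isSpectrum (4 + p) (K⁎ (2 + p))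
  K⁎-secondLast {p} isSpectrum = broom₁-secondLast isSpectrum (4 + p) {0} {1 + p} (s≤s (s≤s (s≤s (s≤s z≤n)))) refl
    (starCliqueForest {2 + p}) (starCliqueForest-roots {2 + p}) (star-broom {2 + p})
    (edgeCliqueForest F (suc (suc zero)) (K⁎-edge (2 + p))) (edgeCliqueForest-roots F (suc (suc zero)) (K⁎-edge (2 + p))) (K⁎-broom (2 + p))
    (cliqueForest-𝒢 F (λ { (refl , refl , ne) → contradiction refl ne }) {suc zero} refl nonroots≡)
    λ G G∈𝒢 none₀ none₁ → inj₂ (_ , treeCliqueForest G G∈𝒢 , treeCliqueForest-roots G G∈𝒢 ,
      noBroom⇒weight<-tree {m = 1 + p} (rootedAt G G∈𝒢) (proj₂ (tree-edge G G∈𝒢)) (treeCliqueForest-nonroots G G∈𝒢) none₀ none₁)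
    where
    F = K⁎-cliqueForest (2 + p)
    nonroots≡ : nonroots (CliqueForest.forest F) ≡ 4 + p
    nonroots≡ = ℕ.suc-injective (trans (cong (_+ nonroots (CliqueForest.forest F)) (sym roots≡1)) (roots+nonroots (CliqueForest.forest F)))
      where
      roots≡1 : roots (CliqueForest.forest F) ≡ 1
      roots≡1 = trans (sum-cong-≗ {5 + p} λ x → ⟦⟧-cong (x ≟ suc zero) (suc zero ≟ x) sym sym) (sum-point {5 + p} (suc zero))

H-tree : ∀ p → H (3 + p) (2 + p) ≡ K⁎ p
H-tree p = cong (λ t → if t then K⁎ p else G₃ (1 + p) (2 + p)) (dec-true (2 + p ℕ.≟ 2 + p) refl)

H-blocks : ∀ p {k} → k ≢ 2 + p → H (3 + p) k ≡ G₃ (1 + p) k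
H-blocks p {k} k≢ = cong (λ t → if t then K⁎ p else G₃ (1 + p) k) (dec-false (k ℕ.≟ 2 + p) k≢)

theorem2p2 : ∀ {c ℓ₁ ℓ₂} (ℝ : RealNumbers c ℓ₁ ℓ₂) →
    let open Spectral ℝ in
    (n k : ℕ)
    (eig : Graph n → Fin n → RealNumbers.Carrier ℝ)
    (isSpectrum : ∀ G → IsSpectrum G (eig G)) →
    let open SOrder eig in
    2 ≤ k → k ≤ n ∸ 1 →
    ¬ (n ≡ 4 × k ≡ 3) →
    Σ[ G ∈ Graph n ] (𝒢 n k G × ¬ (G ≅ K n k)) →
    𝒢 n k (H n k)
    × (H n k ≺ K n k)
    × (∀ (G : Graph n) → 𝒢 n k G → ¬ (G ≅ K n k) → ¬ (G ≅ H n k) → G ≺ H n k)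
theorem2p2 ℝ zero k eig isSpectrum 2≤k k≤0 _ _ = contradiction (≤-trans 2≤k k≤0) λ ()
theorem2p2 ℝ (suc zero) k eig isSpectrum 2≤k k≤0 _ _ = contradiction (≤-trans 2≤k k≤0) λ ()
theorem2p2 ℝ (suc (suc zero)) k eig isSpectrum 2≤k k≤1 _ _ = contradiction (≤-trans 2≤k k≤1) λ { (s≤s ()) }
theorem2p2 ℝ (suc (suc (suc p))) k eig isSpectrum 2≤k k≤2+p not-4-3 (G , G∈𝒢 , G≇K) with k ℕ.≟ 2 + p
... | no k≢2+p = subst (IsSecondLast ℝ isSpectrum k) (sym (H-blocks p k≢2+p))
    (blocks 2≤k (≤-pred (≤∧≢⇒< (≤-pred (≤∧≢⇒< k≤2+p k≢2+p)) k≢1+p)))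
  where
  -- The given graph refutes k = n - 2, which would require a part with exactly two vertices.
  k≢1+p : k ≢ 1 + p
  k≢1+p refl = no-two-vertex-part {k = 1 + p} G G∈𝒢 zero (cong suc (+-comm 2 p))
  blocks : ∀ {k} → 2 ≤ k → k ≤ p → IsSecondLast ℝ isSpectrum k (G₃ (1 + p) k)
  blocks (s≤s (s≤s z≤n)) k≤p = G₃-secondLast ℝ isSpectrum k≤p
theorem2p2 ℝ 3 _ eig isSpectrum _ _ _ (G , G∈𝒢 , G≇K) | yes refl = contradiction (three-vertex-tree ℝ G G∈𝒢) G≇K
-- Here the order stops at `S₃`, which does not distinguish the star from the path.
theorem2p2 ℝ 4 _ eig isSpectrum _ _ not-4-3 _ | yes refl = contradiction (refl , refl) not-4-3
theorem2p2 ℝ (suc (suc (suc (suc (suc p))))) _ eig isSpectrum _ _ _ _ | yes refl =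
  subst (IsSecondLast ℝ isSpectrum (4 + p)) (sym (H-tree (2 + p))) (K⁎-secondLast ℝ isSpectrum)
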